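{- Let $l\ge1$ be an integer, let $p_1,\dots,p_l\ge 1$ be integers, and fix $0<c<1$. Let $m=cn$ and let $\pi$ be chosen uniformly at random from $\mathrm{PF}(m,n)$. Then, as $n\to\infty$, $$\mathbb E\left(\prod_{i=1}^l\pi_i^{p_i}\right)=\frac{n^{\sum_{i=1}^lp_i}}{\prod_{i=1}^l(p_i+1)}\left(1+\frac1n\left(\frac{\sum_{i=1}^lp_i+l}{2}-\frac{c\sum_{i=1}^lp_i}{1-c}\right)+O\left(\frac1{n^2}\right)\right).$$
   Context: Write $[n]=\{1,\dots,n\}$. For integers $0\le m\le n$, $\mathrm{PF}(m,n)$ denotes the set of parking functions with $m$ cars and $n$ spots: sequences $(\pi_1,\dots,\pi_m)\in[n]^m$ such that, when cars $1,\dots,m$ enter in order a one-way street with spots $1,\dots,n$ and car $i$ parks in spot $\pi_i$ if it is free and otherwise in the first free spot after $\pi_i$, all cars park. Equivalently, the non-decreasing rearrangement $(\lambda_1,\dots,\lambda_m)$ satisfies $\lambda_i\le n-m+i$ for all $i$. The limit $n\to\infty$ is along integers $n$ with $cn$ an integer; $c,l,p_1,\dots,p_l$ are fixed and the $O$-constant may depend on them. -}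

module Defs where

open import Data.Fin.Base using (Fin; zero; suc; toℕ; inject≤)
open import Data.Fin.Subset using (Subset; inside; outside; ⊥)
open import Data.Integer.Base using (+_)
open import Data.List.Base
  using (List; []; _∷_; [_]; map; foldr; filter; length; allFin; cartesianProductWith)
open import Data.Maybe as Maybe using (Maybe; just; nothing; _>>=_; Is-just)
open import Data.Maybe.Relation.Unary.Any using (dec)
open import Data.Nat.Base as ℕ using (ℕ; zero; suc)
import Data.Nat.Properties as ℕ
open import Data.Rational.Base
  using (ℚ; 0ℚ; 1ℚ; _/_; _+_; _-_; _*_; _<_; NonZero; positive)
open import Data.Rational.Properties using (pos⇒nonZero; +-monoˡ-<; +-inverseʳ)
open import Data.Unit.Base using (tt)
open import Data.Vec.Base using (Vec; []; _∷_; lookup)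
open import Relation.Binary.PropositionalEquality using (subst)
open import Relation.Nullary.Decidable using (yes)
open import Relation.Unary using (Decidable)

import Algebra.Properties.CommutativeMonoid.Sum ℕ.+-0-commutativeMonoid as Sum
import Algebra.Properties.CommutativeMonoid.Sum ℕ.*-1-commutativeMonoid as Product

infixl 10 ∑-syntax ∏-syntax

∑-syntax : ∀ n → (Fin n → ℕ) → ℕ
∑-syntax _ = Sum.sum

∏-syntax : ∀ n → (Fin n → ℕ) → ℕ
∏-syntax _ = Product.sum

syntax ∑-syntax n (λ i → x) = ∑[ i < n ] x
syntax ∏-syntax n (λ i → x) = ∏[ i < n ] x

-- A street with n spots is the subset of occupied spots; `nothing` means that
-- the car drives off the end of the street without parking.

parkFirstFree : ∀ {n} → Subset n → Maybe (Subset n)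
parkFirstFree []            = nothing
parkFirstFree (outside ∷ s) = just (inside ∷ s)
parkFirstFree (inside  ∷ s) = Maybe.map (inside ∷_) (parkFirstFree s)

parkFrom : ∀ {n} → Fin n → Subset n → Maybe (Subset n)
parkFrom zero    s       = parkFirstFree s
parkFrom (suc i) (b ∷ s) = Maybe.map (b ∷_) (parkFrom i s)

parkAll : ∀ {m n} → Vec (Fin n) m → Subset n → Maybe (Subset n)
parkAll []      s = just s
parkAll (i ∷ π) s = parkFrom i s >>= parkAll π

IsParkingFunction : ∀ {m n} → Vec (Fin n) m → Set
IsParkingFunction π = Is-just (parkAll π ⊥)

isParkingFunction? : ∀ {m n} → Decidable (IsParkingFunction {m} {n})
isParkingFunction? π = dec (λ _ → yes tt) (parkAll π ⊥)

sequences : ∀ m n → List (Vec (Fin n) m)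
sequences zero    n = [ [] ]
sequences (suc m) n = cartesianProductWith _∷_ (allFin n) (sequences m n)

PF : ∀ m n → List (Vec (Fin n) m)
PF m n = filter isParkingFunction? (sequences m n)

-- `Fin n` counts from 0, the spots of the street from 1.
spot : ∀ {n} → Fin n → ℕ
spot i = suc (toℕ i)

fromℕ : ℕ → ℚ
fromℕ k = + k / 1

-- The value on [] is a convention; PF m n is nonempty whenever m ≤ n.
average : List ℚ → ℚ
average []         = 0ℚ
average xs@(_ ∷ _) = foldr _+_ 0ℚ xs * (+ 1 / length xs)

-- Expectation under the uniform distribution on PF m n: the list `PF m n`
-- contains each parking function exactly once.
𝔼 : ∀ m n → (Vec (Fin n) m → ℚ) → ℚ
𝔼 m n X = average (map X (PF m n))

monomial : ∀ {l m n} → (Fin l → ℕ) → l ℕ.≤ m → Vec (Fin n) m → ℕ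
monomial {l} p l≤m π = ∏[ i < l ] (spot (lookup π (inject≤ i l≤m)) ℕ.^ p i)

∏suc-nonZero : ∀ {l} (p : Fin l → ℕ) → ℕ.NonZero (∏[ i < l ] suc (p i))
∏suc-nonZero {zero}  p = _
∏suc-nonZero {suc l} p =
  ℕ.m*n≢0 (suc (p zero)) _ {{_}} {{∏suc-nonZero (λ i → p (suc i))}}

1-c-nonZero : ∀ {c} → c < 1ℚ → NonZero (1ℚ - c)
1-c-nonZero {c} c<1 =
  pos⇒nonZero (1ℚ - c)
    {{positive (subst (_< 1ℚ - c) (+-inverseʳ c) (+-monoˡ-< _ c<1))}}

{-# OPTIONS --safe #-}
module Submission where

-- Write m = l + M and park the last M cars ρ first. Let Kⱼ be the length of the longest final
-- stretch of the street that then has fewer than j free spots. A prefix a ∈ [n]ˡ extends ρ to a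
-- parking function iff every aᵢ ≤ n − K₁, unless at least two of the aᵢ exceed n − Kₗ. Hence the
-- average over a of ∏ (aᵢ/n)^pᵢ on the extending prefixes is ∏ᵢ n^-(pᵢ+1) ∑_{v ≤ n − K₁} v^pᵢ up to
-- O((Kₗ/n)²), and the trapezoidal rule turns the i-th factor into
-- (1 + (pᵢ+1)(1/2 − K₁)/n + O(((1+K₁)/n)²)) / (pᵢ+1).
-- Averaging over ρ requires two facts. The mean of K₁ is M/(n+1−M), because counting the ways to
-- add one car relates it to |PF(M+1,n)| and |PF(M,n)|, where |PF(m,n)| = (n+1−m)(n+1)^(m−1).
-- The second moment of Kₗ is bounded: Kₗ = t forces at least t+1−l of the M ≤ cn cars to prefer
-- one of the last t spots, which a Chernoff bound makes exponentially unlikely.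
-- Finally one divides by |PF(m,n)|.

open import Defs
open import Algebra.Bundles using (CommutativeRing)
import Algebra.Properties.CommutativeMonoid.Sum as SumOf
open import Data.Bool.Base using (Bool; true; false; if_then_else_)
open import Data.Fin.Base using (Fin; zero; suc; toℕ; inject≤)
import Data.Fin.Properties as Fin
open import Data.Fin.Subset using (Subset; inside; outside; ⊥)
open import Data.Integer.Base as ℤ using (+_; +[1+_]; -[1+_])
import Data.Integer.Properties as ℤ
open import Data.List.Base as List using (List; []; _∷_; foldr; filter; length; allFin; cartesianProductWith)
import Data.List.Properties as List
open import Data.Maybe using (Is-just)
open import Data.Maybe.Base using (Maybe; just; nothing)
open import Data.Maybe.Relation.Unary.Any using (just)
open import Data.Nat.Base as ℕ using (ℕ; zero; suc; z≤n; s≤s)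
import Data.Nat.Properties as ℕ
open import Data.Nat.Tactic.RingSolver using () renaming (solve-∀ to ℕ-solve-∀)
open import Data.Product.Base using (_×_; _,_; proj₁; proj₂; Σ-syntax; ∃-syntax)
open import Data.Rational.Base using (ℚ; mkℚ; 0ℚ; 1ℚ; ½; _/_; _+_; _-_; -_; _*_; _÷_; 1/_; _<_; _≤_; ∣_∣; nonNegative; positive; toℚᵘ)
open import Data.Rational.Properties
open import Data.Rational.Unnormalised.Base as ℚᵘ using (mkℚᵘ; *≡*; *≤*)
import Data.Rational.Unnormalised.Properties as ℚᵘ
open import Data.Sum.Base using (_⊎_; inj₁; inj₂; [_,_]′)
open import Data.Vec.Base using (Vec; []; _∷_; _++_; lookup)
open import Function.Base using (_∘_)
open import Function.Bundles using (_⇔_; mk⇔; Equivalence)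
open import Level using (0ℓ)
open import Relation.Binary.PropositionalEquality
open import Relation.Nullary.Decidable.Core using (Dec; yes; no; dec⇒maybe; map′)
open import Relation.Nullary.Negation.Core using (¬_; contradiction)
open import Relation.Unary using (Decidable)
open import Tactic.RingSolver using (solve-∀)
open import Tactic.RingSolver.Core.AlmostCommutativeRing using (AlmostCommutativeRing; fromCommutativeRing)

open import Algebra.Properties.CommutativeSemiring.Exp (CommutativeRing.commutativeSemiring +-*-commutativeRing) using (_^_; ^-homo-*; ^-distrib-*; ^-assocʳ)
open SumOf *-1-commutativeMonoid using () renaming (sum to ∏ℚ; sum-cong-≗ to ∏-cong; ∑-distrib-+ to ∏-distrib-*)
open SumOf +-0-commutativeMonoid using () renaming (sum to ∑ℚ; sum-cong-≗ to ∑ℚ-cong; ∑-distrib-+ to ∑ℚ-distrib-+)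

-- The event of parking depends only on how many cars prefer each final stretch of the street, not
-- on the order of entry; this is why the l cars of the monomial may be treated as the last ones.
-- The obstacle is that these l cars can block one another. They can do so only where fewer than l
-- spots are left, and two independent uniform cars land there with probability of order (Kₗ/n)².
-- Hence their interaction is invisible at order 1/n: only the mean of K₁ has to be known exactly,
-- while for Kₗ a bounded second moment is enough. That moment is taken over all preference
-- sequences, where the cars are independent, and transferred to parking functions because a
-- proportion of at least 1 - c of the sequences of M cars park. Every error constant must be
-- uniform in n and in the cars already parked, so the expansions are stated for whole families and
-- carry their constants with them. All quantities stay rational; Bernoulli's inequality takes the
-- place of the exponential function.

ℚ-ring : AlmostCommutativeRing 0ℓ 0ℓ
ℚ-ring = fromCommutativeRing +-*-commutativeRing (λ q → dec⇒maybe (0ℚ ≟ q))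

-- The embedding of ℕ in ℚ

toℚᵘ-fromℕ : ∀ k → toℚᵘ (fromℕ k) ℚᵘ.≃ mkℚᵘ (+ k) 0
toℚᵘ-fromℕ k = toℚᵘ-fromℚᵘ (mkℚᵘ (+ k) 0)

fromℕ-+ : ∀ a b → fromℕ (a ℕ.+ b) ≡ fromℕ a + fromℕ b
fromℕ-+ a b = toℚᵘ-injective (begin
  toℚᵘ (fromℕ (a ℕ.+ b))             ≈⟨ toℚᵘ-fromℕ (a ℕ.+ b) ⟩
  mkℚᵘ (+ (a ℕ.+ b)) 0               ≈⟨ *≡* (cong (ℤ._* + 1) (sym (cong₂ ℤ._+_ (ℤ.*-identityʳ (+ a)) (ℤ.*-identityʳ (+ b))))) ⟩
  mkℚᵘ (+ a) 0 ℚᵘ.+ mkℚᵘ (+ b) 0     ≈⟨ ℚᵘ.+-cong (toℚᵘ-fromℕ a) (toℚᵘ-fromℕ b) ⟨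
  toℚᵘ (fromℕ a) ℚᵘ.+ toℚᵘ (fromℕ b) ≈⟨ toℚᵘ-homo-+ (fromℕ a) (fromℕ b) ⟨
  toℚᵘ (fromℕ a + fromℕ b)           ∎)
  where open ℚᵘ.≃-Reasoning

fromℕ-suc : ∀ k → fromℕ (suc k) ≡ 1ℚ + fromℕ k
fromℕ-suc = fromℕ-+ 1

fromℕ-* : ∀ a b → fromℕ (a ℕ.* b) ≡ fromℕ a * fromℕ b
fromℕ-* a b = toℚᵘ-injective (begin
  toℚᵘ (fromℕ (a ℕ.* b))             ≈⟨ toℚᵘ-fromℕ (a ℕ.* b) ⟩
  mkℚᵘ (+ (a ℕ.* b)) 0               ≈⟨ *≡* (cong (ℤ._* + 1) (ℤ.pos-* a b)) ⟩
  mkℚᵘ (+ a) 0 ℚᵘ.* mkℚᵘ (+ b) 0     ≈⟨ ℚᵘ.*-cong (toℚᵘ-fromℕ a) (toℚᵘ-fromℕ b) ⟨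
  toℚᵘ (fromℕ a) ℚᵘ.* toℚᵘ (fromℕ b) ≈⟨ toℚᵘ-homo-* (fromℕ a) (fromℕ b) ⟨
  toℚᵘ (fromℕ a * fromℕ b)           ∎)
  where open ℚᵘ.≃-Reasoning

fromℕ-^ : ∀ a k → fromℕ (a ℕ.^ k) ≡ fromℕ a ^ k
fromℕ-^ a zero    = refl
fromℕ-^ a (suc k) = trans (fromℕ-* a (a ℕ.^ k)) (cong (fromℕ a *_) (fromℕ-^ a k))

fromℕ-mono-≤ : ∀ {a b} → a ℕ.≤ b → fromℕ a ≤ fromℕ b
fromℕ-mono-≤ {a} {b} a≤b = toℚᵘ-cancel-≤ (begin
  toℚᵘ (fromℕ a) ≃⟨ toℚᵘ-fromℕ a ⟩
  mkℚᵘ (+ a) 0   ≤⟨ *≤* (ℤ.*-monoʳ-≤-nonNeg (+ 1) (ℤ.+≤+ a≤b)) ⟩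
  mkℚᵘ (+ b) 0   ≃⟨ toℚᵘ-fromℕ b ⟨
  toℚᵘ (fromℕ b) ∎)
  where open ℚᵘ.≤-Reasoning

fromℕ-cancel-≤ : ∀ {a b} → fromℕ a ≤ fromℕ b → a ℕ.≤ b
fromℕ-cancel-≤ {a} {b} le with a ℕ.≤? b
... | yes a≤b = a≤b
... | no a≰b  = contradiction (begin
  mkℚᵘ (+ suc b) 0 ≤⟨ *≤* (ℤ.*-monoʳ-≤-nonNeg (+ 1) (ℤ.+≤+ (ℕ.≰⇒> a≰b))) ⟩
  mkℚᵘ (+ a) 0     ≃⟨ toℚᵘ-fromℕ a ⟨
  toℚᵘ (fromℕ a)   ≤⟨ toℚᵘ-mono-≤ le ⟩
  toℚᵘ (fromℕ b)   ≃⟨ toℚᵘ-fromℕ b ⟩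
  mkℚᵘ (+ b) 0     ∎) λ where
    (*≤* leq) → ℕ.1+n≰n (ℤ.drop‿+≤+ (ℤ.*-cancelʳ-≤-pos (+ suc b) (+ b) (+ 1) leq))
  where open ℚᵘ.≤-Reasoning

0≤fromℕ : ∀ k → 0ℚ ≤ fromℕ k
0≤fromℕ k = fromℕ-mono-≤ {0} {k} z≤n

/-*-cancel : ∀ a n .{{_ : ℕ.NonZero n}} → (+ a / n) * fromℕ n ≡ fromℕ a
/-*-cancel a n@(suc d) = toℚᵘ-injective (begin
  toℚᵘ ((+ a / n) * fromℕ n)           ≈⟨ toℚᵘ-homo-* (+ a / n) (fromℕ n) ⟩
  toℚᵘ (+ a / n) ℚᵘ.* toℚᵘ (fromℕ n)   ≈⟨ ℚᵘ.*-cong (toℚᵘ-fromℚᵘ (mkℚᵘ (+ a) d)) (toℚᵘ-fromℕ n) ⟩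
  mkℚᵘ (+ a) d ℚᵘ.* mkℚᵘ (+ n) 0       ≈⟨ *≡* (trans (ℤ.*-identityʳ (+ a ℤ.* + n)) (cong (λ k → + a ℤ.* + k) (sym (ℕ.*-identityʳ n)))) ⟩
  mkℚᵘ (+ a) 0                         ≈⟨ toℚᵘ-fromℕ a ⟨
  toℚᵘ (fromℕ a)                       ∎)
  where open ℚᵘ.≃-Reasoning

-- Inequalities in ℚ

-- Many inequalities below are proved by naming their slack `e`: its sign is evident, and the
-- identity is left to ring arithmetic.
≤-by : ∀ {a b} e → 0ℚ ≤ e → a + e ≡ b → a ≤ b
≤-by {a} e 0≤e refl = subst (_≤ a + e) (+-identityʳ a) (+-monoʳ-≤ a 0≤e)

≤⇒0≤- : ∀ {a b} → a ≤ b → 0ℚ ≤ b - a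
≤⇒0≤- {a} {b} a≤b = subst (_≤ b - a) (+-inverseʳ a) (+-monoˡ-≤ (- a) a≤b)

0≤-⇒≤ : ∀ {a b} → 0ℚ ≤ b - a → a ≤ b
0≤-⇒≤ {a} {b} 0≤ = ≤-by (b - a) 0≤ (ring a b)
  where
  ring : ∀ a b → a + (b - a) ≡ b
  ring = solve-∀ ℚ-ring

0≤+ : ∀ {a b} → 0ℚ ≤ a → 0ℚ ≤ b → 0ℚ ≤ a + b
0≤+ = +-mono-≤

*-monoˡ-≤ : ∀ {r a b} → 0ℚ ≤ r → a ≤ b → r * a ≤ r * b
*-monoˡ-≤ {r} 0≤r = *-monoˡ-≤-nonNeg r {{nonNegative 0≤r}}

*-monoʳ-≤ : ∀ {r a b} → 0ℚ ≤ r → a ≤ b → a * r ≤ b * r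
*-monoʳ-≤ {r} 0≤r = *-monoʳ-≤-nonNeg r {{nonNegative 0≤r}}

*-mono-≤ : ∀ {a b r s} → 0ℚ ≤ a → 0ℚ ≤ s → a ≤ b → r ≤ s → a * r ≤ b * s
*-mono-≤ 0≤a 0≤s a≤b r≤s = ≤-trans (*-monoˡ-≤ 0≤a r≤s) (*-monoʳ-≤ 0≤s a≤b)

0≤* : ∀ {a b} → 0ℚ ≤ a → 0ℚ ≤ b → 0ℚ ≤ a * b
0≤* {a} {b} 0≤a 0≤b = subst (_≤ a * b) (*-zeroʳ a) (*-monoˡ-≤ 0≤a 0≤b)

*-cancelˡ-≤ : ∀ {r a b} → 0ℚ < r → r * a ≤ r * b → a ≤ b
*-cancelˡ-≤ {r} 0<r = *-cancelˡ-≤-pos r {{positive 0<r}}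

0<-* : ∀ {a b} → 0ℚ < a → 0ℚ < b → 0ℚ < a * b
0<-* {a} {b} 0<a 0<b = positive⁻¹ (a * b) {{pos*pos⇒pos a {{positive 0<a}} b {{positive 0<b}}}}

0≤1 : 0ℚ ≤ 1ℚ
0≤1 = 0≤fromℕ 1

0<1 : 0ℚ < 1ℚ
0<1 = positive⁻¹ 1ℚ

0≤½ : 0ℚ ≤ ½
0≤½ = nonNegative⁻¹ ½

0≤-^ : ∀ {a} k → 0ℚ ≤ a → 0ℚ ≤ a ^ k
0≤-^ zero    0≤a = 0≤1
0≤-^ (suc k) 0≤a = 0≤* 0≤a (0≤-^ k 0≤a)

^-monoˡ-≤ : ∀ {a b} k → 0ℚ ≤ a → a ≤ b → a ^ k ≤ b ^ k
^-monoˡ-≤ zero    0≤a a≤b = ≤-refl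
^-monoˡ-≤ (suc k) 0≤a a≤b = *-mono-≤ 0≤a (0≤-^ k (≤-trans 0≤a a≤b)) a≤b (^-monoˡ-≤ k 0≤a a≤b)

1^k≡1 : ∀ k → 1ℚ ^ k ≡ 1ℚ
1^k≡1 zero    = refl
1^k≡1 (suc k) = trans (*-identityˡ (1ℚ ^ k)) (1^k≡1 k)

^-≤1 : ∀ {a} k → 0ℚ ≤ a → a ≤ 1ℚ → a ^ k ≤ 1ℚ
^-≤1 k 0≤a a≤1 = ≤-trans (^-monoˡ-≤ k 0≤a a≤1) (≤-reflexive (1^k≡1 k))

1≤-^ : ∀ {a} k → 1ℚ ≤ a → 1ℚ ≤ a ^ k
1≤-^ k 1≤a = ≤-trans (≤-reflexive (sym (1^k≡1 k))) (^-monoˡ-≤ k 0≤1 1≤a)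

0≤² : ∀ u → 0ℚ ≤ u * u
0≤² u with ≤-total 0ℚ u
... | inj₁ 0≤u = 0≤* 0≤u 0≤u
... | inj₂ u≤0 = subst (0ℚ ≤_) (ring u) (0≤* (neg-antimono-≤ u≤0) (neg-antimono-≤ u≤0))
  where
  ring : ∀ u → - u * - u ≡ u * u
  ring = solve-∀ ℚ-ring

0<-^ : ∀ {a} k → 0ℚ < a → 0ℚ < a ^ k
0<-^ zero    0<a = 0<1
0<-^ (suc k) 0<a = 0<-* 0<a (0<-^ k 0<a)

-- The induction step drops the term k u². The tail bound applies it to positive u and, in order to
-- bound a power from above through its reciprocal, also to negative u.
bernoulli : ∀ {u} k → - 1ℚ ≤ u → 1ℚ + fromℕ k * u ≤ (1ℚ + u) ^ k
bernoulli {u} zero    _    = ≤-reflexive (ring u)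
  where
  ring : ∀ u → 1ℚ + 0ℚ * u ≡ 1ℚ
  ring = solve-∀ ℚ-ring
bernoulli {u} (suc k) -1≤u = begin
  1ℚ + fromℕ (suc k) * u                   ≡⟨ cong (λ t → 1ℚ + t * u) (fromℕ-suc k) ⟩
  1ℚ + (1ℚ + fromℕ k) * u                  ≤⟨ ≤-by (fromℕ k * (u * u)) (0≤* (0≤fromℕ k) (0≤² u)) (ring (fromℕ k) u) ⟩
  (1ℚ + u) * (1ℚ + fromℕ k * u)            ≤⟨ *-monoˡ-≤ 0≤1+u (bernoulli k -1≤u) ⟩
  (1ℚ + u) * (1ℚ + u) ^ k                  ∎
  where
  open ≤-Reasoning
  ring : ∀ k u → 1ℚ + (1ℚ + k) * u + k * (u * u) ≡ (1ℚ + u) * (1ℚ + k * u)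
  ring = solve-∀ ℚ-ring
  ring₁ : ∀ u → u - - 1ℚ ≡ 1ℚ + u
  ring₁ = solve-∀ ℚ-ring
  0≤1+u : 0ℚ ≤ 1ℚ + u
  0≤1+u = subst (0ℚ ≤_) (ring₁ u) (≤⇒0≤- -1≤u)

∣+∣≤ : ∀ {a b A B} → ∣ a ∣ ≤ A → ∣ b ∣ ≤ B → ∣ a + b ∣ ≤ A + B
∣+∣≤ {a} {b} ∣a∣≤A ∣b∣≤B = ≤-trans (∣p+q∣≤∣p∣+∣q∣ a b) (+-mono-≤ ∣a∣≤A ∣b∣≤B)

∣*∣≤ : ∀ {a b A B} → ∣ a ∣ ≤ A → ∣ b ∣ ≤ B → ∣ a * b ∣ ≤ A * B
∣*∣≤ {a} {b} ∣a∣≤A ∣b∣≤B =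
  subst (_≤ _) (sym (∣p*q∣≡∣p∣*∣q∣ a b)) (*-mono-≤ (0≤∣p∣ a) (≤-trans (0≤∣p∣ b) ∣b∣≤B) ∣a∣≤A ∣b∣≤B)

0≤⇒∣∣≤ : ∀ {a b} → 0ℚ ≤ a → a ≤ b → ∣ a ∣ ≤ b
0≤⇒∣∣≤ 0≤a a≤b = subst (_≤ _) (sym (0≤p⇒∣p∣≡p 0≤a)) a≤b

∣-∣≤ : ∀ a {b} → ∣ a ∣ ≤ b → ∣ - a ∣ ≤ b
∣-∣≤ a {b} = subst (_≤ b) (sym (∣-p∣≡∣p∣ a))

-- The trapezoidal rule

-- 2(p+1) times the error of the trapezoidal rule for tᵖ on [z, y].

trapezoidError : ℕ → ℚ → ℚ → ℚ
trapezoidError p z y =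
  fromℕ (suc p) * ((y - z) * (y ^ p + z ^ p)) - (1ℚ + 1ℚ) * (y ^ suc p - z ^ suc p)

-- The increment (p + 1)p is what one step of the recurrence in `trapezoidError-bounds` costs; its
-- factor p is the Lipschitz constant of tᵖ on [0, 1].
trapezoidConst : ℕ → ℚ
trapezoidConst zero    = 0ℚ
trapezoidConst (suc p) = trapezoidConst p + fromℕ (suc p) * fromℕ p

0≤trapezoidConst : ∀ p → 0ℚ ≤ trapezoidConst p
0≤trapezoidConst zero    = ≤-refl
0≤trapezoidConst (suc p) = 0≤+ (0≤trapezoidConst p) (0≤* (0≤fromℕ (suc p)) (0≤fromℕ p))

module _ {z y : ℚ} (0≤z : 0ℚ ≤ z) (z≤y : z ≤ y) (y≤1 : y ≤ 1ℚ) where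

  private
    0≤y : 0ℚ ≤ y
    0≤y = ≤-trans 0≤z z≤y
    0≤δ : 0ℚ ≤ y - z
    0≤δ = ≤⇒0≤- z≤y

  ^-lipschitz : ∀ p → y ^ p - z ^ p ≤ fromℕ p * (y - z)
  ^-lipschitz zero    = ≤-reflexive (ring y z)
    where
    ring : ∀ y z → 1ℚ - 1ℚ ≡ 0ℚ * (y - z)
    ring = solve-∀ ℚ-ring
  ^-lipschitz (suc p) = begin
    y * y ^ p - z * z ^ p                   ≡⟨ ring₁ y z (y ^ p) (z ^ p) ⟩
    y * (y ^ p - z ^ p) + (y - z) * z ^ p   ≤⟨ +-mono-≤
                                                (*-mono-≤ 0≤y (0≤* (0≤fromℕ p) 0≤δ) y≤1 (^-lipschitz p))
                                                (*-monoˡ-≤ 0≤δ (^-≤1 p 0≤z (≤-trans z≤y y≤1))) ⟩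
    1ℚ * (fromℕ p * (y - z)) + (y - z) * 1ℚ ≡⟨ ring₂ (fromℕ p) (y - z) ⟩
    (1ℚ + fromℕ p) * (y - z)                ≡⟨ cong (_* (y - z)) (fromℕ-suc p) ⟨
    fromℕ (suc p) * (y - z)                 ∎
    where
    open ≤-Reasoning
    ring₁ : ∀ y z a b → y * a - z * b ≡ y * (a - b) + (y - z) * b
    ring₁ = solve-∀ ℚ-ring
    ring₂ : ∀ p d → 1ℚ * (p * d) + d * 1ℚ ≡ (1ℚ + p) * d
    ring₂ = solve-∀ ℚ-ring

  -- Calculus is avoided by the recurrence E(p+1) = ½(y + z) E(p) + ½(p + 1)(y - z)²(yᵖ - zᵖ). Both
  -- terms are nonnegative, the mean ½(y + z) is at most 1, and `^-lipschitz` supplies the third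
  -- factor y - z.
  trapezoidError-bounds : ∀ p → 0ℚ ≤ trapezoidError p z y ×
    trapezoidError p z y ≤ trapezoidConst p * ((y - z) * (y - z) * (y - z))
  trapezoidError-bounds zero    = ≤-reflexive (sym (ring₁ y z)) , ≤-reflexive (ring₂ y z)
    where
    ring₁ : ∀ y z → 1ℚ * ((y - z) * (1ℚ + 1ℚ)) - (1ℚ + 1ℚ) * (y * 1ℚ - z * 1ℚ) ≡ 0ℚ
    ring₁ = solve-∀ ℚ-ring
    ring₂ : ∀ y z → 1ℚ * ((y - z) * (1ℚ + 1ℚ)) - (1ℚ + 1ℚ) * (y * 1ℚ - z * 1ℚ)
            ≡ 0ℚ * ((y - z) * (y - z) * (y - z))
    ring₂ = solve-∀ ℚ-ring
  trapezoidError-bounds (suc p) =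
    subst (0ℚ ≤_) (sym recurrence)
      (0≤+ (0≤* 0≤mean 0≤E) (0≤* 0≤½ (0≤* 0≤q (0≤* (0≤* 0≤δ 0≤δ) 0≤d)))) ,
    (begin
    trapezoidError (suc p) z y
      ≡⟨ recurrence ⟩
    ½ * (y + z) * E + ½ * (q * (δ * δ * d))
      ≤⟨ +-mono-≤ (*-mono-≤ 0≤mean (0≤* (0≤trapezoidConst p) 0≤δ³) mean≤1 E≤)
           (≤-trans (*-monoʳ-≤ (0≤* 0≤q (0≤* (0≤* 0≤δ 0≤δ) 0≤d)) ½≤1)
             (*-monoˡ-≤ 0≤1 (*-monoˡ-≤ 0≤q (*-monoˡ-≤ (0≤* 0≤δ 0≤δ) (^-lipschitz p))))) ⟩
    1ℚ * (trapezoidConst p * (δ * δ * δ)) + 1ℚ * (q * (δ * δ * (fromℕ p * δ)))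
      ≡⟨ ring₃ (trapezoidConst p) q (fromℕ p) δ ⟩
    (trapezoidConst p + q * fromℕ p) * (δ * δ * δ)
      ∎)
    where
    open ≤-Reasoning
    q δ d E : ℚ
    q = fromℕ (suc p)
    δ = y - z
    d = y ^ p - z ^ p
    E = trapezoidError p z y
    0≤q : 0ℚ ≤ q
    0≤q = 0≤fromℕ (suc p)
    0≤d : 0ℚ ≤ d
    0≤d = ≤⇒0≤- (^-monoˡ-≤ p 0≤z z≤y)
    0≤δ³ : 0ℚ ≤ δ * δ * δ
    0≤δ³ = 0≤* (0≤* 0≤δ 0≤δ) 0≤δ
    0≤mean : 0ℚ ≤ ½ * (y + z)
    0≤mean = 0≤* 0≤½ (0≤+ 0≤y 0≤z)
    mean≤1 : ½ * (y + z) ≤ 1ℚ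
    mean≤1 = *-monoˡ-≤ 0≤½ (+-mono-≤ y≤1 (≤-trans z≤y y≤1))
    ½≤1 : ½ ≤ 1ℚ
    ½≤1 = ≤-by ½ 0≤½ refl
    0≤E : 0ℚ ≤ E
    0≤E = proj₁ (trapezoidError-bounds p)
    E≤ : E ≤ trapezoidConst p * (δ * δ * δ)
    E≤ = proj₂ (trapezoidError-bounds p)
    ring : ∀ q y z a b → (1ℚ + q) * ((y - z) * (y * a + z * b)) - (1ℚ + 1ℚ) * (y * (y * a) - z * (z * b))
      ≡ ½ * (y + z) * (q * ((y - z) * (a + b)) - (1ℚ + 1ℚ) * (y * a - z * b))
        + ½ * (q * ((y - z) * (y - z) * (a - b)))
    ring = solve-∀ ℚ-ring
    recurrence : trapezoidError (suc p) z y ≡ ½ * (y + z) * E + ½ * (q * (δ * δ * d))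
    recurrence = trans
      (cong (λ s → s * ((y - z) * (y ^ suc p + z ^ suc p)) - (1ℚ + 1ℚ) * (y ^ suc (suc p) - z ^ suc (suc p)))
        (fromℕ-suc (suc p)))
      (ring q y z (y ^ p) (z ^ p))
    ring₃ : ∀ t q p δ → 1ℚ * (t * (δ * δ * δ)) + 1ℚ * (q * (δ * δ * (p * δ))) ≡ (t + q * p) * (δ * δ * δ)
    ring₃ = solve-∀ ℚ-ring

-- Sums

∑ℚ-nonNeg : ∀ {n} {f : Fin n → ℚ} → (∀ v → 0ℚ ≤ f v) → 0ℚ ≤ ∑ℚ f
∑ℚ-nonNeg {zero}  0≤f = ≤-refl
∑ℚ-nonNeg {suc n} 0≤f = 0≤+ (0≤f zero) (∑ℚ-nonNeg (0≤f ∘ suc))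

∑ℚ-* : ∀ {n} c (f : Fin n → ℚ) → ∑ℚ (λ v → c * f v) ≡ c * ∑ℚ f
∑ℚ-* {zero}  c f = sym (*-zeroʳ c)
∑ℚ-* {suc n} c f =
  trans (cong (_+_ (c * f zero)) (∑ℚ-* c (f ∘ suc))) (sym (*-distribˡ-+ c (f zero) (∑ℚ (f ∘ suc))))

∑ℚ-const : ∀ n c → ∑ℚ {n} (λ _ → c) ≡ fromℕ n * c
∑ℚ-const zero    c = sym (*-zeroˡ c)
∑ℚ-const (suc n) c = begin
  c + ∑ℚ {n} (λ _ → c)  ≡⟨ cong (_+_ c) (∑ℚ-const n c) ⟩
  c + fromℕ n * c       ≡⟨ ring c (fromℕ n) ⟩
  (1ℚ + fromℕ n) * c    ≡⟨ cong (_* c) (fromℕ-suc n) ⟨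
  fromℕ (suc n) * c     ∎
  where
  open ≡-Reasoning
  ring : ∀ c n → c + n * c ≡ (1ℚ + n) * c
  ring = solve-∀ ℚ-ring

∑< : ℕ → (ℕ → ℚ) → ℚ
∑< n f = ∑ℚ {n} (f ∘ toℕ)

∑<-last : ∀ n (f : ℕ → ℚ) → ∑< (suc n) f ≡ ∑< n f + f n
∑<-last zero    f = trans (+-identityʳ (f 0)) (sym (+-identityˡ (f 0)))
∑<-last (suc n) f = trans (cong (_+_ (f 0)) (∑<-last n (f ∘ suc))) (sym (+-assoc (f 0) _ _))

-- A positive linear functional. Sums over spots, means, and their iterations over sequences of cars
-- are all instances, so monotonicity and the triangle inequality are derived once.
record Functional (A : Set) : Set where
  field
    ⟨_⟩    : (A → ℚ) → ℚ
    ⟨⟩-cong : ∀ {f g} → (∀ a → f a ≡ g a) → ⟨ f ⟩ ≡ ⟨ g ⟩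
    ⟨⟩-+    : ∀ f g → ⟨ (λ a → f a + g a) ⟩ ≡ ⟨ f ⟩ + ⟨ g ⟩
    ⟨⟩-*    : ∀ c f → ⟨ (λ a → c * f a) ⟩ ≡ c * ⟨ f ⟩
    ⟨⟩-0≤   : ∀ {f} → (∀ a → 0ℚ ≤ f a) → 0ℚ ≤ ⟨ f ⟩

  ⟨⟩-0 : ⟨ (λ _ → 0ℚ) ⟩ ≡ 0ℚ
  ⟨⟩-0 = trans (⟨⟩-* 0ℚ (λ _ → 0ℚ)) (*-zeroˡ ⟨ (λ _ → 0ℚ) ⟩)

  ⟨⟩-*ʳ : ∀ f c → ⟨ (λ a → f a * c) ⟩ ≡ ⟨ f ⟩ * c
  ⟨⟩-*ʳ f c = trans (⟨⟩-cong (λ a → *-comm (f a) c)) (trans (⟨⟩-* c f) (*-comm c ⟨ f ⟩))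

  ⟨⟩-- : ∀ f g → ⟨ (λ a → f a - g a) ⟩ ≡ ⟨ f ⟩ - ⟨ g ⟩
  ⟨⟩-- f g = trans (⟨⟩-cong (λ a → ring (f a) (g a)))
    (trans (⟨⟩-+ f (λ a → (- 1ℚ) * g a)) (trans (cong (_+_ ⟨ f ⟩) (⟨⟩-* (- 1ℚ) g)) (sym (ring ⟨ f ⟩ ⟨ g ⟩))))
    where
    ring : ∀ a b → a - b ≡ a + (- 1ℚ) * b
    ring = solve-∀ ℚ-ring

  ⟨⟩-mono-≤ : ∀ {f g} → (∀ a → f a ≤ g a) → ⟨ f ⟩ ≤ ⟨ g ⟩
  ⟨⟩-mono-≤ {f} {g} f≤g = 0≤-⇒≤ (subst (0ℚ ≤_) (⟨⟩-- g f) (⟨⟩-0≤ (λ a → ≤⇒0≤- (f≤g a))))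

  ∣⟨⟩∣≤ : ∀ {f g} → (∀ a → ∣ f a ∣ ≤ g a) → ∣ ⟨ f ⟩ ∣ ≤ ⟨ g ⟩
  ∣⟨⟩∣≤ {f} {g} ∣f∣≤g with ∣p∣≡p∨∣p∣≡-p ⟨ f ⟩
  ... | inj₁ eq = subst (_≤ ⟨ g ⟩) (sym eq) (⟨⟩-mono-≤ (λ a → ≤-trans (p≤∣p∣ (f a)) (∣f∣≤g a)))
    where
    p≤∣p∣ : ∀ p → p ≤ ∣ p ∣
    p≤∣p∣ p with ≤-total 0ℚ p
    ... | inj₁ 0≤p = ≤-reflexive (sym (0≤p⇒∣p∣≡p 0≤p))
    ... | inj₂ p≤0 = ≤-trans p≤0 (0≤∣p∣ p)
  ... | inj₂ eq = subst (_≤ ⟨ g ⟩) (sym (trans eq (trans (ring ⟨ f ⟩) (sym (⟨⟩-* (- 1ℚ) f)))))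
                    (⟨⟩-mono-≤ (λ a → ≤-trans (-p≤∣p∣ (f a)) (∣f∣≤g a)))
    where
    ring : ∀ a → - a ≡ (- 1ℚ) * a
    ring = solve-∀ ℚ-ring
    -p≤∣p∣ : ∀ p → (- 1ℚ) * p ≤ ∣ p ∣
    -p≤∣p∣ p with ≤-total 0ℚ p
    ... | inj₁ 0≤p = ≤-trans (≤-reflexive (sym (ring p))) (≤-trans (neg-antimono-≤ 0≤p) (0≤∣p∣ p))
    ... | inj₂ p≤0 = ≤-reflexive (trans (sym (ring p)) (sym (trans (sym (∣-p∣≡∣p∣ p)) (0≤p⇒∣p∣≡p (neg-antimono-≤ p≤0)))))

open Functional

∑ᶠ : ∀ n → Functional (Fin n)
∑ᶠ n = record
  { ⟨_⟩ = ∑ℚ ; ⟨⟩-cong = ∑ℚ-cong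
  ; ⟨⟩-+ = ∑ℚ-distrib-+ ; ⟨⟩-* = ∑ℚ-* ; ⟨⟩-0≤ = ∑ℚ-nonNeg }

scale : ∀ {A} x → 0ℚ ≤ x → Functional A → Functional A
scale x 0≤x F = record
  { ⟨_⟩     = λ f → x * ⟨ F ⟩ f
  ; ⟨⟩-cong = λ f≡g → cong (x *_) (⟨⟩-cong F f≡g)
  ; ⟨⟩-+    = λ f g → trans (cong (x *_) (⟨⟩-+ F f g)) (*-distribˡ-+ x _ _)
  ; ⟨⟩-*    = λ c f → trans (cong (x *_) (⟨⟩-* F c f)) (ring x c (⟨ F ⟩ f))
  ; ⟨⟩-0≤   = λ 0≤f → 0≤* 0≤x (⟨⟩-0≤ F 0≤f) }
  where
  ring : ∀ x c f → x * (c * f) ≡ c * (x * f)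
  ring = solve-∀ ℚ-ring

infixl 8 _⊗_

-- The m-fold product measure as an iterated integral. `∑ᶠ n ⊗ m` sums over all preference
-- sequences; the product of a mean makes the cars independent and uniform.
_⊗_ : ∀ {A} → Functional A → ∀ m → Functional (Vec A m)
F ⊗ zero = record
  { ⟨_⟩ = λ f → f [] ; ⟨⟩-cong = λ f≡g → f≡g []
  ; ⟨⟩-+ = λ _ _ → refl ; ⟨⟩-* = λ _ _ → refl ; ⟨⟩-0≤ = λ 0≤f → 0≤f [] }
F ⊗ suc m = record
  { ⟨_⟩     = λ f → ⟨ F ⟩ (λ v → ⟨ F ⊗ m ⟩ (λ π → f (v ∷ π)))
  ; ⟨⟩-cong = λ f≡g → ⟨⟩-cong F (λ v → ⟨⟩-cong (F ⊗ m) (λ π → f≡g (v ∷ π)))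
  ; ⟨⟩-+    = λ f g → trans (⟨⟩-cong F (λ v → ⟨⟩-+ (F ⊗ m) _ _)) (⟨⟩-+ F _ _)
  ; ⟨⟩-*    = λ c f → trans (⟨⟩-cong F (λ v → ⟨⟩-* (F ⊗ m) c _)) (⟨⟩-* F c _)
  ; ⟨⟩-0≤   = λ 0≤f → ⟨⟩-0≤ F (λ v → ⟨⟩-0≤ (F ⊗ m) (λ π → 0≤f (v ∷ π))) }

⟨⟩-∑ℚ-comm : ∀ {A} (F : Functional A) {n} (f : A → Fin n → ℚ) →
  ⟨ F ⟩ (λ a → ∑ℚ (f a)) ≡ ∑ℚ (λ v → ⟨ F ⟩ (λ a → f a v))
⟨⟩-∑ℚ-comm F {zero}  f = ⟨⟩-0 F
⟨⟩-∑ℚ-comm F {suc n} f =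
  trans (⟨⟩-+ F (λ a → f a zero) _) (cong (_+_ (⟨ F ⟩ (λ a → f a zero))) (⟨⟩-∑ℚ-comm F (λ a → f a ∘ suc)))

-- Fubini: linearity moves `F` through one finite sum at a time.
⟨⟩-⊗-comm : ∀ {A} (F : Functional A) n m (f : A → Vec (Fin n) m → ℚ) →
  ⟨ F ⟩ (λ a → ⟨ ∑ᶠ n ⊗ m ⟩ (f a)) ≡ ⟨ ∑ᶠ n ⊗ m ⟩ (λ π → ⟨ F ⟩ (λ a → f a π))
⟨⟩-⊗-comm F n zero    f = refl
⟨⟩-⊗-comm F n (suc m) f =
  trans (⟨⟩-∑ℚ-comm F (λ a v → ⟨ ∑ᶠ n ⊗ m ⟩ (λ π → f a (v ∷ π)))) (∑ℚ-cong {n} (λ v → ⟨⟩-⊗-comm F n m (λ a π → f a (v ∷ π))))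

⊗-++ : ∀ {A} (F : Functional A) l m (f : Vec A (l ℕ.+ m) → ℚ) →
  ⟨ F ⊗ (l ℕ.+ m) ⟩ f ≡ ⟨ F ⊗ l ⟩ (λ a → ⟨ F ⊗ m ⟩ (λ π → f (a ++ π)))
⊗-++ F zero    m f = refl
⊗-++ F (suc l) m f = ⟨⟩-cong F (λ v → ⊗-++ F l m (λ π → f (v ∷ π)))

⊗-scale : ∀ {A} x (0≤x : 0ℚ ≤ x) (F : Functional A) m f →
  ⟨ scale x 0≤x F ⊗ m ⟩ f ≡ x ^ m * ⟨ F ⊗ m ⟩ f
⊗-scale x 0≤x F zero    f = sym (*-identityˡ (f []))
⊗-scale x 0≤x F (suc m) f = begin
  x * ⟨ F ⟩ (λ v → ⟨ scale x 0≤x F ⊗ m ⟩ (λ π → f (v ∷ π)))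
    ≡⟨ cong (x *_) (⟨⟩-cong F (λ v → ⊗-scale x 0≤x F m _)) ⟩
  x * ⟨ F ⟩ (λ v → x ^ m * ⟨ F ⊗ m ⟩ (λ π → f (v ∷ π)))
    ≡⟨ cong (x *_) (⟨⟩-* F (x ^ m) _) ⟩
  x * (x ^ m * ⟨ F ⊗ suc m ⟩ f)
    ≡⟨ *-assoc x (x ^ m) _ ⟨
  x ^ suc m * ⟨ F ⊗ suc m ⟩ f ∎
  where open ≡-Reasoning

-- Independence of the coordinates: the factor of the first one leaves the inner functionals by
-- linearity.
⊗-∏ : ∀ {A} (F : Functional A) {l} (w : Fin l → A → ℚ) →
  ⟨ F ⊗ l ⟩ (λ a → ∏ℚ (λ i → w i (lookup a i))) ≡ ∏ℚ (λ i → ⟨ F ⟩ (w i))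
⊗-∏ F {zero}  w = refl
⊗-∏ F {suc l} w = trans
  (⟨⟩-cong F (λ v → trans (⟨⟩-* (F ⊗ l) (w zero v) _) (cong (w zero v *_) (⊗-∏ F (w ∘ suc)))))
  (⟨⟩-*ʳ F (w zero) _)

⊗-const : ∀ {A} (F : Functional A) → ⟨ F ⟩ (λ _ → 1ℚ) ≡ 1ℚ → ∀ m c → ⟨ F ⊗ m ⟩ (λ _ → c) ≡ c
⊗-const F F1≡1 zero    c = refl
⊗-const F F1≡1 (suc m) c = trans (⟨⟩-cong F (λ _ → trans (⊗-const F F1≡1 m c) (sym (*-identityʳ c))))
  (trans (⟨⟩-* F c (λ _ → 1ℚ)) (trans (cong (c *_) F1≡1) (*-identityʳ c)))

-- Power sums

-- The right Riemann sum of mesh x for (p + 1)tᵖ on [0, kx], normalised so that its leading term is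
-- (kx)ᵖ⁺¹.
powerSum : ℚ → ℕ → ℕ → ℚ
powerSum x p k = fromℕ (suc p) * (x * ∑< k (λ v → (fromℕ (suc v) * x) ^ p))

-- The right Riemann sum exceeds the trapezoidal sum by half its last term, because tᵖ vanishes at 0
-- for p ≥ 1. Hence r is the sum of the `trapezoidError` of the k cells, each at most
-- `trapezoidConst p` times x³.
powerSum-bounds : ∀ x → 0ℚ ≤ x → ∀ q k → fromℕ k * x ≤ 1ℚ →
  let p = suc q
      r = (1ℚ + 1ℚ) * powerSum x p k - ((1ℚ + 1ℚ) * (fromℕ k * x) ^ suc p + fromℕ (suc p) * (x * (fromℕ k * x) ^ p))
  in 0ℚ ≤ r × r ≤ trapezoidConst p * (x * x * (fromℕ k * x))
powerSum-bounds x 0≤x q zero    _    = ≤-reflexive (sym r≡0) , ≤-reflexive (trans r≡0 (ring₂ x (trapezoidConst (suc q))))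
  where
  ring : ∀ x s a → (1ℚ + 1ℚ) * (s * (x * 0ℚ)) - ((1ℚ + 1ℚ) * (0ℚ * x * (0ℚ * x * a)) + s * (x * (0ℚ * x * a))) ≡ 0ℚ
  ring = solve-∀ ℚ-ring
  r≡0 = ring x (fromℕ (suc (suc q))) ((0ℚ * x) ^ q)
  ring₂ : ∀ x t → 0ℚ ≡ t * (x * x * (0ℚ * x))
  ring₂ = solve-∀ ℚ-ring
powerSum-bounds x 0≤x q (suc k) y≤1 =
  subst (0ℚ ≤_) (sym step) (0≤+ (proj₁ ih) (proj₁ E-bounds)) ,
  (begin
  r (suc k)                                                        ≡⟨ step ⟩
  r k + trapezoidError p z y                                       ≤⟨ +-mono-≤ (proj₂ ih) (proj₂ E-bounds) ⟩
  t * (x * x * z) + t * ((y - z) * (y - z) * (y - z))              ≡⟨ cong (λ d → t * (x * x * z) + t * (d * d * d)) y-z≡x ⟩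
  t * (x * x * z) + t * (x * x * x)                                ≡⟨ ring₂ t x z ⟩
  t * (x * x * (x + z))                                            ≡⟨ cong (λ y → t * (x * x * y)) y≡x+z ⟨
  t * (x * x * y)                                                  ∎)
  where
  open ≤-Reasoning
  p = suc q
  t = trapezoidConst p
  s = fromℕ (suc p)
  z = fromℕ k * x
  y = fromℕ (suc k) * x
  r : ℕ → ℚ
  r k = (1ℚ + 1ℚ) * powerSum x p k - ((1ℚ + 1ℚ) * (fromℕ k * x) ^ suc p + s * (x * (fromℕ k * x) ^ p))
  ring₀ : ∀ k x → (1ℚ + k) * x ≡ x + k * x
  ring₀ = solve-∀ ℚ-ring
  ring₁ : ∀ x z → x + z - z ≡ x
  ring₁ = solve-∀ ℚ-ring
  ring₂ : ∀ t x z → t * (x * x * z) + t * (x * x * x) ≡ t * (x * x * (x + z))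
  ring₂ = solve-∀ ℚ-ring
  y≡x+z : y ≡ x + z
  y≡x+z = trans (cong (_* x) (fromℕ-suc k)) (ring₀ (fromℕ k) x)
  y-z≡x : y - z ≡ x
  y-z≡x = trans (cong (_- z) y≡x+z) (ring₁ x z)
  0≤z : 0ℚ ≤ z
  0≤z = 0≤* (0≤fromℕ k) 0≤x
  z≤y : z ≤ y
  z≤y = *-monoʳ-≤ 0≤x (fromℕ-mono-≤ (ℕ.n≤1+n k))
  ih = powerSum-bounds x 0≤x q k (≤-trans z≤y y≤1)
  E-bounds = trapezoidError-bounds 0≤z z≤y y≤1 p
  ring₃ : ∀ s x S a z b y → (1ℚ + 1ℚ) * (s * (x * (S + a))) - ((1ℚ + 1ℚ) * (y * a) + s * (x * a))
    ≡ (1ℚ + 1ℚ) * (s * (x * S)) - ((1ℚ + 1ℚ) * (z * b) + s * (x * b))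
      + (s * (x * (a + b)) - (1ℚ + 1ℚ) * (y * a - z * b))
  ring₃ = solve-∀ ℚ-ring
  step : r (suc k) ≡ r k + trapezoidError p z y
  step = trans (cong (λ S → (1ℚ + 1ℚ) * (s * (x * S)) - ((1ℚ + 1ℚ) * y ^ suc p + s * (x * y ^ p)))
                 (∑<-last k (λ v → (fromℕ (suc v) * x) ^ p)))
         (trans (ring₃ s x (∑< k (λ v → (fromℕ (suc v) * x) ^ p)) (y ^ p) z (z ^ p) y)
                (cong (λ d → r k + (s * (d * (y ^ p + z ^ p)) - (1ℚ + 1ℚ) * (y * y ^ p - z * z ^ p))) (sym y-z≡x)))

-- First-order expansions f = 1 + h + O(y²)

record Expansion {I : Set} (y f h : I → ℚ) : Set where
  field
    -- The constants precede the index, so every bound is uniform over `I`. Later `I` consists of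
    -- all truncated streets, and then of all streets for fixed c and l.
    B C    : ℚ
    0≤B    : 0ℚ ≤ B
    0≤C    : 0ℚ ≤ C
    linear : ∀ i → ∣ h i ∣ ≤ B * y i
    error  : ∀ i → ∣ f i - (1ℚ + h i) ∣ ≤ C * (y i * y i)

module _ {I : Set} {y : I → ℚ} where

  open Expansion

  expansion-cong : ∀ {f g h k} → (∀ i → f i ≡ g i) → (∀ i → h i ≡ k i) → Expansion y f h → Expansion y g k
  expansion-cong f≡g h≡k ex = record
    { B = B ex ; C = C ex ; 0≤B = 0≤B ex ; 0≤C = 0≤C ex
    ; linear = λ i → subst (λ h → ∣ h ∣ ≤ B ex * y i) (h≡k i) (linear ex i)
    ; error  = λ i → subst₂ (λ f h → ∣ f - (1ℚ + h) ∣ ≤ C ex * (y i * y i)) (f≡g i) (h≡k i) (error ex i) }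

  expansion-1+ : ∀ {h : I → ℚ} b → 0ℚ ≤ b → (∀ i → ∣ h i ∣ ≤ b * y i) → Expansion y (λ i → 1ℚ + h i) h
  expansion-1+ {h} b 0≤b ∣h∣≤ = record
    { B = b ; C = 0ℚ ; 0≤B = 0≤b ; 0≤C = ≤-refl ; linear = ∣h∣≤
    ; error = λ i → ≤-reflexive (trans (cong ∣_∣ (+-inverseʳ (1ℚ + h i))) (sym (*-zeroˡ (y i * y i)))) }

  expansion-shift : ∀ {f g h} {k : I → ℚ} b c → 0ℚ ≤ b → 0ℚ ≤ c →
    (∀ i → ∣ k i ∣ ≤ b * y i) → (∀ i → ∣ g i - (f i + k i) ∣ ≤ c * (y i * y i)) →
    Expansion y f h → Expansion y g (λ i → h i + k i)
  expansion-shift {f} {g} {h} {k} b c 0≤b 0≤c ∣k∣≤ ∣g-f-k∣≤ ex = record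
    { B = B ex + b ; C = c + C ex ; 0≤B = 0≤+ (0≤B ex) 0≤b ; 0≤C = 0≤+ 0≤c (0≤C ex)
    ; linear = λ i → subst (∣ h i + k i ∣ ≤_) (sym (*-distribʳ-+ (y i) (B ex) b)) (∣+∣≤ (linear ex i) (∣k∣≤ i))
    ; error  = λ i → subst₂ _≤_ (cong ∣_∣ (ring (f i) (g i) (h i) (k i))) (sym (*-distribʳ-+ (y i * y i) c (C ex)))
                       (∣+∣≤ (∣g-f-k∣≤ i) (error ex i)) }
    where
    ring : ∀ f g h k → g - (f + k) + (f - (1ℚ + h)) ≡ g - (1ℚ + (h + k))
    ring = solve-∀ ℚ-ring

  module _ (0≤y : ∀ i → 0ℚ ≤ y i) (y≤2 : ∀ i → y i ≤ 1ℚ + 1ℚ) where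

    -- fg - (1 + h + k) = hk + (f - 1 - h)g + (g - 1 - k)(1 + h). The field `linear` makes hk of
    -- second order, and y ≤ 2 bounds the factors g and 1 + h by constants.
    expansion-* : ∀ {f g h k} → Expansion y f h → Expansion y g k →
      Expansion y (λ i → f i * g i) (λ i → h i + k i)
    expansion-* {f} {g} {h} {k} ef eg = record
      { B = B ef + B eg ; C = c
      ; 0≤B = 0≤+ (0≤B ef) (0≤B eg)
      ; 0≤C = 0≤+ (0≤+ (0≤* (0≤B ef) (0≤B eg)) (0≤* (0≤C ef) (0≤+ 0≤4Cg 0≤1+2Bg)))
                  (0≤* (0≤C eg) (0≤+ 0≤1 (0≤* (0≤B ef) (0≤fromℕ 2))))
      ; linear = λ i → subst (∣ h i + k i ∣ ≤_) (sym (*-distribʳ-+ (y i) (B ef) (B eg))) (∣+∣≤ (linear ef i) (linear eg i))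
      ; error  = λ i → subst₂ _≤_ (cong ∣_∣ (ring (f i) (g i) (h i) (k i)))
                   (ring₂ (y i) (B ef) (B eg) (C ef) (1ℚ + B eg * (1ℚ + 1ℚ)) (C eg * ((1ℚ + 1ℚ) * (1ℚ + 1ℚ))) (C eg) (1ℚ + B ef * (1ℚ + 1ℚ)))
                   (∣+∣≤ (∣+∣≤ (∣*∣≤ (linear ef i) (linear eg i))
                               (∣*∣≤ (error ef i) (∣g∣≤ i)))
                         (∣*∣≤ (error eg i) (∣1+h∣≤ i))) }
      where
      c = B ef * B eg + C ef * (C eg * ((1ℚ + 1ℚ) * (1ℚ + 1ℚ)) + (1ℚ + B eg * (1ℚ + 1ℚ))) + C eg * (1ℚ + B ef * (1ℚ + 1ℚ))
      0≤4Cg = 0≤* (0≤C eg) (0≤fromℕ 4)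
      0≤1+2Bg = 0≤+ 0≤1 (0≤* (0≤B eg) (0≤fromℕ 2))
      ring : ∀ f g h k → h * k + (f - (1ℚ + h)) * g + (g - (1ℚ + k)) * (1ℚ + h) ≡ f * g - (1ℚ + (h + k))
      ring = solve-∀ ℚ-ring
      ring₂ : ∀ y b b' c s c' d r → b * y * (b' * y) + c * (y * y) * (c' + s) + d * (y * y) * r
        ≡ (b * b' + c * (c' + s) + d * r) * (y * y)
      ring₂ = solve-∀ ℚ-ring
      ring₃ : ∀ g k → g - (1ℚ + k) + (1ℚ + k) ≡ g
      ring₃ = solve-∀ ℚ-ring
      ∣1+h∣≤ : ∀ i → ∣ 1ℚ + h i ∣ ≤ 1ℚ + B ef * (1ℚ + 1ℚ)
      ∣1+h∣≤ i = ∣+∣≤ {1ℚ} {h i} ≤-refl (≤-trans (linear ef i) (*-monoˡ-≤ (0≤B ef) (y≤2 i)))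
      ∣1+k∣≤ : ∀ i → ∣ 1ℚ + k i ∣ ≤ 1ℚ + B eg * (1ℚ + 1ℚ)
      ∣1+k∣≤ i = ∣+∣≤ {1ℚ} {k i} ≤-refl (≤-trans (linear eg i) (*-monoˡ-≤ (0≤B eg) (y≤2 i)))
      ∣g∣≤ : ∀ i → ∣ g i ∣ ≤ C eg * ((1ℚ + 1ℚ) * (1ℚ + 1ℚ)) + (1ℚ + B eg * (1ℚ + 1ℚ))
      ∣g∣≤ i = subst (λ a → ∣ a ∣ ≤ _) (ring₃ (g i) (k i))
        (∣+∣≤ (≤-trans (error eg i) (*-monoˡ-≤ (0≤C eg) (*-mono-≤ (0≤y i) (0≤fromℕ 2) (y≤2 i) (y≤2 i)))) (∣1+k∣≤ i))

    private
      expansion-1 : Expansion y (λ _ → 1ℚ) (λ _ → 0ℚ)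
      expansion-1 = expansion-1+ 0ℚ ≤-refl (λ i → ≤-reflexive (sym (*-zeroˡ (y i))))

    expansion-^ : ∀ {f h} k → Expansion y f h → Expansion y (λ i → f i ^ k) (λ i → fromℕ k * h i)
    expansion-^ {h = h} zero    ex = expansion-cong (λ _ → refl) (λ i → sym (*-zeroˡ (h i))) expansion-1
    expansion-^ {h = h} (suc k) ex =
      expansion-cong (λ _ → refl) (λ i → trans (ring (h i) (fromℕ k)) (cong (_* h i) (sym (fromℕ-suc k))))
        (expansion-* ex (expansion-^ k ex))
      where
      ring : ∀ h k → h + k * h ≡ (1ℚ + k) * h
      ring = solve-∀ ℚ-ring

    expansion-∏ : ∀ {l} {f h : Fin l → I → ℚ} → (∀ j → Expansion y (f j) (h j)) →
      Expansion y (λ i → ∏ℚ (λ j → f j i)) (λ i → ∑ℚ (λ j → h j i))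
    expansion-∏ {zero}  ex = expansion-1
    expansion-∏ {suc l} ex = expansion-* (ex zero) (expansion-∏ (ex ∘ suc))

-- With z = Lx = 1 - Kx the power sum is zᵖ⁺¹ + ½(p + 1)x zᵖ up to second order. The first term is
-- expanded as a power of 1 - Kx; in the second, zᵖ is replaced by 1, at a cost of order x times Kx.
-- The scale (1 + K)x dominates both small quantities x and Kx.
powerSum-expansion : ∀ {I : Set} (x : I → ℚ) (L K : I → ℕ) →
  (∀ i → 0ℚ ≤ x i) → (∀ i → x i ≤ 1ℚ) → (∀ i → fromℕ (L i) * x i + fromℕ (K i) * x i ≡ 1ℚ) → ∀ q →
  Expansion (λ i → (1ℚ + fromℕ (K i)) * x i) (λ i → powerSum (x i) (suc q) (L i))
            (λ i → fromℕ (suc (suc q)) * (½ * x i - fromℕ (K i) * x i))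
powerSum-expansion {I} x L K 0≤x x≤1 partition q =
  expansion-cong (λ _ → refl) (λ i → ring₁ s (x i) (k i))
    (expansion-shift {k = λ i → ½ * s * x i} (½ * s) (½ * (s * fromℕ p) + ½ * t) (0≤* 0≤½ 0≤s)
      (0≤+ (0≤* 0≤½ (0≤* 0≤s (0≤fromℕ p))) (0≤* 0≤½ (0≤trapezoidConst p)))
      (λ i → 0≤⇒∣∣≤ (0≤* (0≤* 0≤½ 0≤s) (0≤x i)) (*-monoˡ-≤ (0≤* 0≤½ 0≤s) (x≤y i)))
      (λ i → subst₂ _≤_ (cong ∣_∣ (ring₂ (powerSum (x i) p (L i)) (z i ^ suc p) s (x i) (z i ^ p)))
                (ring₃ s (fromℕ p) t (y i))
                (∣+∣≤ (0≤⇒∣∣≤ (0≤* 0≤½ (proj₁ (r-bounds i)))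
                              (*-monoˡ-≤ 0≤½ (≤-trans (proj₂ (r-bounds i))
                                (*-monoˡ-≤ (0≤trapezoidConst p)
                                  (≤-trans (*-mono-≤ (0≤* (0≤x i) (0≤x i)) 0≤1
                                              (*-mono-≤ (0≤x i) (0≤y i) (x≤y i) (x≤y i)) (z≤1 i))
                                    (≤-reflexive (*-identityʳ (y i * y i))))))))
                      (∣-∣≤ (½ * s * x i * (1ℚ - z i ^ p))
                        (0≤⇒∣∣≤ (0≤* (0≤* (0≤* 0≤½ 0≤s) (0≤x i)) (≤⇒0≤- (^-≤1 p (0≤z i) (z≤1 i))))
                          (*-mono-≤ (0≤* (0≤* 0≤½ 0≤s) (0≤x i)) (0≤* (0≤fromℕ p) (0≤y i))
                            (*-monoˡ-≤ (0≤* 0≤½ 0≤s) (x≤y i)) (1-z^p≤ i))))))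
      (expansion-^ 0≤y y≤2 (suc p)
        (expansion-cong (λ i → trans (ring₄ (k i)) (sym (z≡1-k i))) (λ _ → refl)
          (expansion-1+ {h = λ i → - k i} 1ℚ 0≤1
            (λ i → ∣-∣≤ (k i)
              (0≤⇒∣∣≤ (0≤k i) (≤-trans (k≤y i) (≤-reflexive (sym (*-identityˡ (y i)))))))))))
  where
  p = suc q
  s = fromℕ (suc p)
  t = trapezoidConst p
  k z y : I → ℚ
  k i = fromℕ (K i) * x i
  z i = fromℕ (L i) * x i
  y i = (1ℚ + fromℕ (K i)) * x i
  0≤s = 0≤fromℕ (suc p)
  0≤k : ∀ i → 0ℚ ≤ k i
  0≤k i = 0≤* (0≤fromℕ (K i)) (0≤x i)
  0≤z : ∀ i → 0ℚ ≤ z i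
  0≤z i = 0≤* (0≤fromℕ (L i)) (0≤x i)
  ring₀ : ∀ x k → x + k * x ≡ (1ℚ + k) * x
  ring₀ = solve-∀ ℚ-ring
  ring₀′ : ∀ x k → k * x + x ≡ (1ℚ + k) * x
  ring₀′ = solve-∀ ℚ-ring
  x≤y : ∀ i → x i ≤ y i
  x≤y i = ≤-by (k i) (0≤k i) (ring₀ (x i) (fromℕ (K i)))
  k≤y : ∀ i → k i ≤ y i
  k≤y i = ≤-by (x i) (0≤x i) (ring₀′ (x i) (fromℕ (K i)))
  0≤y : ∀ i → 0ℚ ≤ y i
  0≤y i = ≤-trans (0≤x i) (x≤y i)
  z≤1 : ∀ i → z i ≤ 1ℚ
  z≤1 i = ≤-by (k i) (0≤k i) (partition i)
  k≤1 : ∀ i → k i ≤ 1ℚ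
  k≤1 i = ≤-by (z i) (0≤z i) (trans (+-comm (k i) (z i)) (partition i))
  y≤2 : ∀ i → y i ≤ 1ℚ + 1ℚ
  y≤2 i = subst (_≤ 1ℚ + 1ℚ) (ring₀ (x i) (fromℕ (K i))) (+-mono-≤ (x≤1 i) (k≤1 i))
  ring₄ : ∀ k → 1ℚ + - k ≡ 1ℚ - k
  ring₄ = solve-∀ ℚ-ring
  ring₅ : ∀ z k → z ≡ z + k - k
  ring₅ = solve-∀ ℚ-ring
  ring₆ : ∀ k → 1ℚ - (1ℚ - k) ≡ k
  ring₆ = solve-∀ ℚ-ring
  z≡1-k : ∀ i → z i ≡ 1ℚ - k i
  z≡1-k i = trans (ring₅ (z i) (k i)) (cong (_- k i) (partition i))
  1-z≤y : ∀ i → 1ℚ - z i ≤ y i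
  1-z≤y i = subst (_≤ y i) (sym (trans (cong (λ w → 1ℚ - w) (z≡1-k i)) (ring₆ (k i)))) (k≤y i)
  1-z^p≤ : ∀ i → 1ℚ - z i ^ p ≤ fromℕ p * y i
  1-z^p≤ i = ≤-trans (≤-reflexive (cong (_- z i ^ p) (sym (1^k≡1 p))))
    (≤-trans (^-lipschitz (0≤z i) (z≤1 i) ≤-refl p) (*-monoˡ-≤ (0≤fromℕ p) (1-z≤y i)))
  r-bounds : ∀ i → _
  r-bounds i = powerSum-bounds (x i) (0≤x i) q (L i) (z≤1 i)
  ring₁ : ∀ s x k → s * - k + ½ * s * x ≡ s * (½ * x - k)
  ring₁ = solve-∀ ℚ-ring
  ring₂ : ∀ F f s x g → ½ * ((1ℚ + 1ℚ) * F - ((1ℚ + 1ℚ) * f + s * (x * g))) + - (½ * s * x * (1ℚ - g)) ≡ F - (f + ½ * s * x)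
  ring₂ = solve-∀ ℚ-ring
  ring₃ : ∀ s p t y → ½ * (t * (y * y)) + ½ * s * y * (p * y) ≡ (½ * (s * p) + ½ * t) * (y * y)
  ring₃ = solve-∀ ℚ-ring

-- Parking

bit : Bool → ℕ
bit b = if b then 1 else 0

bit≤1 : ∀ b → bit b ℕ.≤ 1
bit≤1 false = z≤n
bit≤1 true  = s≤s z≤n

bit-≤ : ∀ {k v} → k ℕ.≤ v → bit (k ℕ.<ᵇ suc v) ≡ 1
bit-≤ z≤n       = refl
bit-≤ (s≤s k≤v) = bit-≤ k≤v

bit-> : ∀ {k v} → v ℕ.< k → bit (k ℕ.<ᵇ suc v) ≡ 0
bit-> {suc zero}    (s≤s z≤n) = refl
bit-> {suc (suc k)} {zero}  _ = refl
bit-> {suc (suc k)} {suc v} (s≤s v<k) = bit-> v<k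

bit-antitone : ∀ {j k} v → j ℕ.≤ k → bit (k ℕ.<ᵇ suc v) ℕ.≤ bit (j ℕ.<ᵇ suc v)
bit-antitone {j} {k} v j≤k with k ℕ.≤? v
... | yes k≤v rewrite bit-≤ k≤v | bit-≤ (ℕ.≤-trans j≤k k≤v) = ℕ.≤-refl
... | no  k≰v rewrite bit-> (ℕ.≰⇒> k≰v) = z≤n

#≥ : ∀ {n m} → ℕ → Vec (Fin n) m → ℕ
#≥ k []      = 0
#≥ k (v ∷ π) = bit (k ℕ.<ᵇ suc (toℕ v)) ℕ.+ #≥ k π

#≥-antitone : ∀ {n m j k} (π : Vec (Fin n) m) → j ℕ.≤ k → #≥ k π ℕ.≤ #≥ j π
#≥-antitone []      j≤k = z≤n
#≥-antitone (v ∷ π) j≤k = ℕ.+-mono-≤ (bit-antitone (toℕ v) j≤k) (#≥-antitone π j≤k)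

#≥-≤ : ∀ {n m} k (π : Vec (Fin n) m) → #≥ k π ℕ.≤ m
#≥-≤ k []      = z≤n
#≥-≤ k (v ∷ π) = ℕ.+-mono-≤ (bit≤1 _) (#≥-≤ k π)

#≥-zero : ∀ {n m} (π : Vec (Fin n) m) → #≥ 0 π ≡ m
#≥-zero []      = refl
#≥-zero (v ∷ π) = cong suc (#≥-zero π)

#≥-++ : ∀ {n l m} k (a : Vec (Fin n) l) (π : Vec (Fin n) m) → #≥ k (a ++ π) ≡ #≥ k a ℕ.+ #≥ k π
#≥-++ k []      π = refl
#≥-++ k (v ∷ a) π = trans (cong (bit _ ℕ.+_) (#≥-++ k a π)) (sym (ℕ.+-assoc (bit _) (#≥ k a) (#≥ k π)))

#≥-lookup : ∀ {n m} {k} (π : Vec (Fin n) m) i → k ℕ.≤ toℕ (lookup π i) → 1 ℕ.≤ #≥ k π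
#≥-lookup (v ∷ π) zero    k≤v rewrite bit-≤ k≤v = s≤s z≤n
#≥-lookup (v ∷ π) (suc i) k≤v = ℕ.≤-trans (#≥-lookup π i k≤v) (ℕ.m≤n+m _ _)

#≥-witness : ∀ {n m} k (π : Vec (Fin n) m) → 1 ℕ.≤ #≥ k π → ∃[ i ] k ℕ.≤ toℕ (lookup π i)
#≥-witness k (v ∷ π) 1≤ with k ℕ.≤? toℕ v
... | yes k≤v = zero , k≤v
... | no  k≰v rewrite bit-> (ℕ.≰⇒> k≰v) with #≥-witness k π 1≤
...   | i , k≤ = suc i , k≤

-- The counting form of λᵢ ≤ n - m + i: at most n - k cars prefer one of the last n - k spots. It is
-- symmetric in the cars, unlike the parking process.
Good : ∀ n {m} → Vec (Fin n) m → Set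
Good n π = ∀ k → k ℕ.< n → #≥ k π ℕ.+ k ℕ.≤ n

private
  occupied : ∀ {n} → ℕ → Subset n → ℕ
  occupied k       []      = 0
  occupied zero    (b ∷ s) = bit b ℕ.+ occupied zero s
  occupied (suc k) (b ∷ s) = occupied k s

  occupied-⊥ : ∀ {n} k → occupied k (⊥ {n}) ≡ 0
  occupied-⊥ {zero}  k       = refl
  occupied-⊥ {suc n} zero    = occupied-⊥ {n} zero
  occupied-⊥ {suc n} (suc k) = occupied-⊥ {n} k

  occupied-≤ : ∀ {n} k (s : Subset n) → k ℕ.≤ n → occupied k s ℕ.+ k ℕ.≤ n
  occupied-≤ zero    []      _         = z≤n
  occupied-≤ zero    (b ∷ s) _         =
    ℕ.≤-trans (ℕ.≤-reflexive (ℕ.+-assoc (bit b) (occupied 0 s) 0)) (ℕ.+-mono-≤ (bit≤1 b) (occupied-≤ 0 s z≤n))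
  occupied-≤ (suc k) (b ∷ s) (s≤s k≤n) =
    ℕ.≤-trans (ℕ.≤-reflexive (ℕ.+-suc (occupied k s) k)) (s≤s (occupied-≤ k s k≤n))

  -- In the last alternative the car jumps over k, hence the spots from i to k are occupied.
  ParkedFrom : ∀ {n} → ℕ → Subset n → Maybe (Subset n) → Set
  ParkedFrom {n} i s nothing   = n ℕ.≤ occupied i s ℕ.+ i
  ParkedFrom {n} i s (just s′) = ∀ k →
    bit (k ℕ.<ᵇ suc i) ℕ.+ occupied k s ℕ.≤ occupied k s′ ×
    (occupied k s′ ℕ.≤ bit (k ℕ.<ᵇ suc i) ℕ.+ occupied k s ⊎
     (i ℕ.≤ k × occupied k s′ ℕ.≤ suc (occupied k s) × occupied k s ℕ.+ k ℕ.≤ occupied i s ℕ.+ i))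

  +-suc-≤ : ∀ {a b c d} → a ℕ.+ b ℕ.≤ c ℕ.+ d → a ℕ.+ suc b ℕ.≤ c ℕ.+ suc d
  +-suc-≤ {a} {b} {c} {d} le = subst₂ ℕ._≤_ (sym (ℕ.+-suc a b)) (sym (ℕ.+-suc c d)) (s≤s le)

  parkFirstFree-parked : ∀ {n} (s : Subset n) → ParkedFrom 0 s (parkFirstFree s)
  parkFirstFree-parked []            = z≤n
  parkFirstFree-parked (outside ∷ s) zero    = ℕ.≤-refl , inj₁ ℕ.≤-refl
  parkFirstFree-parked (outside ∷ s) (suc k) = ℕ.≤-refl , inj₁ ℕ.≤-refl
  parkFirstFree-parked (inside ∷ s) with parkFirstFree s | parkFirstFree-parked s
  ... | nothing | n≤ = s≤s n≤
  ... | just s′ | ih = λ where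
    zero    → s≤s (proj₁ (ih 0)) , inj₁ (s≤s ([ (λ le → le) , (λ (_ , le , _) → le) ]′ (proj₂ (ih 0))))
    (suc k) → ℕ.≤-trans (ℕ.m≤n+m (occupied k s) (bit (k ℕ.<ᵇ 1))) (proj₁ (ih k)) , beyond k (proj₂ (ih k))
   where
    beyond : ∀ k →
      occupied k s′ ℕ.≤ bit (k ℕ.<ᵇ 1) ℕ.+ occupied k s ⊎
        (0 ℕ.≤ k × occupied k s′ ℕ.≤ suc (occupied k s) × occupied k s ℕ.+ k ℕ.≤ occupied 0 s ℕ.+ 0) →
      occupied k s′ ℕ.≤ occupied k s ⊎
        (0 ℕ.≤ suc k × occupied k s′ ℕ.≤ suc (occupied k s) × occupied k s ℕ.+ suc k ℕ.≤ suc (occupied 0 s) ℕ.+ 0)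
    -- Spot 0 is taken, so the car is pushed past it: seen from position 1 the street gains a car
    -- that did not prefer it, and the first alternative becomes the second.
    beyond zero    (inj₁ le) = inj₂ (z≤n , le , ℕ.≤-reflexive (ℕ.+-suc (occupied 0 s) 0))
    beyond (suc k) (inj₁ le) = inj₁ le
    beyond k (inj₂ (_ , le , le′)) = inj₂ (z≤n , le , ℕ.≤-trans (ℕ.≤-reflexive (ℕ.+-suc (occupied k s) k)) (s≤s le′))

  parkFrom-parked : ∀ {n} (i : Fin n) (s : Subset n) → ParkedFrom (toℕ i) s (parkFrom i s)
  parkFrom-parked zero    s       = parkFirstFree-parked s
  parkFrom-parked (suc i) (b ∷ s) with parkFrom i s | parkFrom-parked i s
  ... | nothing | n≤ = ℕ.≤-trans (s≤s n≤) (ℕ.≤-reflexive (sym (ℕ.+-suc (occupied (toℕ i) s) (toℕ i))))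
  ... | just s′ | ih = λ where
    zero    → ℕ.≤-trans (ℕ.≤-reflexive (sym (ℕ.+-suc (bit b) (occupied 0 s)))) (ℕ.+-monoʳ-≤ (bit b) (proj₁ (ih 0))) ,
              inj₁ (ℕ.≤-trans (ℕ.+-monoʳ-≤ (bit b) ([ (λ le → le) , (λ (_ , le , _) → le) ]′ (proj₂ (ih 0))))
                     (ℕ.≤-reflexive (ℕ.+-suc (bit b) (occupied 0 s))))
    (suc k) → proj₁ (ih k) ,
              [ inj₁ , (λ (i≤k , le , le′) → inj₂ (s≤s i≤k , le , +-suc-≤ {occupied k s} {c = occupied (toℕ i) s} le′)) ]′
                (proj₂ (ih k))

  Fits : ∀ {n m} → Vec (Fin n) m → Subset n → Set
  Fits {n} π s = ∀ k → k ℕ.< n → #≥ k π ℕ.+ (occupied k s ℕ.+ k) ℕ.≤ n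

  -- `Fits` is the invariant of the process: the cars still to come and those already parked fit
  -- together behind every k. A car that does not jump over k leaves this total unchanged. If it
  -- does jump over k, the total at k grows, but all spots from its preference i to k are occupied,
  -- so the new bound at k follows from the old bound at i.
  fits⇔parkAll : ∀ {n m} (π : Vec (Fin n) m) s → Fits π s ⇔ Is-just (parkAll π s)
  fits⇔parkAll []      s = mk⇔ (λ _ → just _) (λ _ k k<n → occupied-≤ k s (ℕ.<⇒≤ k<n))
  fits⇔parkAll {n} (i ∷ π) s with parkFrom i s | parkFrom-parked i s
  ... | nothing | n≤ = mk⇔ (λ fits → contradiction (overflow fits) ℕ.1+n≰n) λ ()
    where
    -- The invariant fails at the preferred spot itself: everything from there on is occupied and
    -- this car asks for one more.
    overflow : Fits (i ∷ π) s → suc n ℕ.≤ n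
    overflow fits = ℕ.≤-trans
      (ℕ.+-mono-≤ (ℕ.≤-trans (ℕ.≤-reflexive (sym (bit-≤ (ℕ.≤-refl {toℕ i})))) (ℕ.m≤m+n _ (#≥ (toℕ i) π))) n≤)
      (fits (toℕ i) (Fin.toℕ<n i))
  ... | just s′ | parked = mk⇔
    (λ fits → Equivalence.to (fits⇔parkAll π s′) (λ k k<n → forward fits k k<n (proj₂ (parked k))))
    (λ isJust k k<n → backward k (Equivalence.from (fits⇔parkAll π s′) isJust k k<n))
    where
    open ℕ.≤-Reasoning
    c : ℕ → ℕ
    c k = bit (k ℕ.<ᵇ suc (toℕ i))
    shuffle : ∀ c x o k → x ℕ.+ (c ℕ.+ o ℕ.+ k) ≡ c ℕ.+ x ℕ.+ (o ℕ.+ k)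
    shuffle = ℕ-solve-∀
    backward : ∀ k → #≥ k π ℕ.+ (occupied k s′ ℕ.+ k) ℕ.≤ n → c k ℕ.+ #≥ k π ℕ.+ (occupied k s ℕ.+ k) ℕ.≤ n
    backward k le = begin
      c k ℕ.+ #≥ k π ℕ.+ (occupied k s ℕ.+ k)  ≡⟨ shuffle (c k) (#≥ k π) (occupied k s) k ⟨
      #≥ k π ℕ.+ (c k ℕ.+ occupied k s ℕ.+ k)  ≤⟨ ℕ.+-monoʳ-≤ (#≥ k π) (ℕ.+-monoˡ-≤ k (proj₁ (parked k))) ⟩
      #≥ k π ℕ.+ (occupied k s′ ℕ.+ k)         ≤⟨ le ⟩
      n                                        ∎
    forward : Fits (i ∷ π) s → ∀ k → k ℕ.< n → _ → #≥ k π ℕ.+ (occupied k s′ ℕ.+ k) ℕ.≤ n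
    forward fits k k<n (inj₁ le) = begin
      #≥ k π ℕ.+ (occupied k s′ ℕ.+ k)         ≤⟨ ℕ.+-monoʳ-≤ (#≥ k π) (ℕ.+-monoˡ-≤ k le) ⟩
      #≥ k π ℕ.+ (c k ℕ.+ occupied k s ℕ.+ k)  ≡⟨ shuffle (c k) (#≥ k π) (occupied k s) k ⟩
      c k ℕ.+ #≥ k π ℕ.+ (occupied k s ℕ.+ k)  ≤⟨ fits k k<n ⟩
      n                                        ∎
    forward fits k k<n (inj₂ (i≤k , le , le′)) = begin
      #≥ k π ℕ.+ (occupied k s′ ℕ.+ k)         ≤⟨ ℕ.+-monoʳ-≤ (#≥ k π) (ℕ.+-monoˡ-≤ k le) ⟩
      #≥ k π ℕ.+ (1 ℕ.+ occupied k s ℕ.+ k)    ≡⟨ shuffle 1 (#≥ k π) (occupied k s) k ⟩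
      1 ℕ.+ #≥ k π ℕ.+ (occupied k s ℕ.+ k)    ≤⟨ ℕ.+-mono-≤ (ℕ.+-mono-≤ (ℕ.≤-reflexive (sym (bit-≤ (ℕ.≤-refl {toℕ i})))) (#≥-antitone π i≤k)) le′ ⟩
      c (toℕ i) ℕ.+ #≥ (toℕ i) π ℕ.+ (occupied (toℕ i) s ℕ.+ toℕ i) ≤⟨ fits (toℕ i) (Fin.toℕ<n i) ⟩
      n                                        ∎

good⇔parking : ∀ {n m} (π : Vec (Fin n) m) → Good n π ⇔ IsParkingFunction π
good⇔parking {n} π = mk⇔
  (λ good → Equivalence.to (fits⇔parkAll π ⊥) (λ k k<n → subst (λ o → #≥ k π ℕ.+ (o ℕ.+ k) ℕ.≤ n) (sym (occupied-⊥ {n} k)) (good k k<n)))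
  (λ pf k k<n → subst (λ o → #≥ k π ℕ.+ (o ℕ.+ k) ℕ.≤ n) (occupied-⊥ {n} k) (Equivalence.from (fits⇔parkAll π ⊥) pf k k<n))

-- Indicators and sums over parking functions

χ : ∀ {P : Set} → Dec P → ℚ
χ (yes _) = 1ℚ
χ (no  _) = 0ℚ

χ-yes : ∀ {P : Set} (d : Dec P) → P → χ d ≡ 1ℚ
χ-yes (yes _) p = refl
χ-yes (no ¬p) p = contradiction p ¬p

χ-no : ∀ {P : Set} (d : Dec P) → ¬ P → χ d ≡ 0ℚ
χ-no (yes p) ¬p = contradiction p ¬p
χ-no (no _)  ¬p = refl

0≤χ : ∀ {P : Set} (d : Dec P) → 0ℚ ≤ χ d
0≤χ (yes _) = 0≤1
0≤χ (no _)  = ≤-refl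

χ≤1 : ∀ {P : Set} (d : Dec P) → χ d ≤ 1ℚ
χ≤1 (yes _) = ≤-refl
χ≤1 (no _)  = 0≤1

χ-⇔ : ∀ {P Q : Set} (d : Dec P) (e : Dec Q) → P ⇔ Q → χ d ≡ χ e
χ-⇔ (yes p) e P⇔Q = sym (χ-yes e (Equivalence.to P⇔Q p))
χ-⇔ (no ¬p) e P⇔Q = sym (χ-no e (¬p ∘ Equivalence.from P⇔Q))

good? : ∀ n {m} (π : Vec (Fin n) m) → Dec (Good n π)
good? n π = map′ (λ good k → good {k}) (λ good {k} → good k) (ℕ.allUpTo? (λ k → #≥ k π ℕ.+ k ℕ.≤? n) n)

∑PF : ∀ n m → (Vec (Fin n) m → ℚ) → ℚ
∑PF n m X = ⟨ ∑ᶠ n ⊗ m ⟩ (λ π → χ (good? n π) * X π)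

#PF : ℕ → ℕ → ℚ
#PF n m = ⟨ ∑ᶠ n ⊗ m ⟩ (λ π → χ (good? n π))

-- Sums over lists

sumList : List ℚ → ℚ
sumList = foldr _+_ 0ℚ

sumList-filter : ∀ {A : Set} {P : A → Set} (P? : Decidable P) (f : A → ℚ) xs →
  sumList (List.map f (filter P? xs)) ≡ sumList (List.map (λ x → χ (P? x) * f x) xs)
sumList-filter P? f []       = refl
sumList-filter P? f (x ∷ xs) with P? x
... | yes _ = cong₂ _+_ (sym (*-identityˡ (f x))) (sumList-filter P? f xs)
... | no  _ = trans (sumList-filter P? f xs) (trans (sym (+-identityˡ _)) (cong (_+ sumList (List.map (λ x → χ (P? x) * f x) xs)) (sym (*-zeroˡ (f x)))))

sumList-map-++ : ∀ {A : Set} (f : A → ℚ) xs ys →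
  sumList (List.map f (xs List.++ ys)) ≡ sumList (List.map f xs) + sumList (List.map f ys)
sumList-map-++ f []       ys = sym (+-identityˡ _)
sumList-map-++ f (x ∷ xs) ys = trans (cong (_+_ (f x)) (sumList-map-++ f xs ys)) (sym (+-assoc (f x) _ _))

sumList-cartesianProductWith : ∀ {A B C : Set} (c : A → B → C) (f : C → ℚ) xs ys →
  sumList (List.map f (cartesianProductWith c xs ys)) ≡ sumList (List.map (λ x → sumList (List.map (λ y → f (c x y)) ys)) xs)
sumList-cartesianProductWith c f []       ys = refl
sumList-cartesianProductWith c f (x ∷ xs) ys = trans
  (sumList-map-++ f (List.map (c x) ys) (cartesianProductWith c xs ys))
  (cong₂ _+_ (cong sumList (sym (List.map-∘ ys))) (sumList-cartesianProductWith c f xs ys))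

sumList-tabulate : ∀ {A : Set} {n} (f : A → ℚ) (g : Fin n → A) → sumList (List.map f (List.tabulate g)) ≡ ∑ℚ (f ∘ g)
sumList-tabulate {n = zero}  f g = refl
sumList-tabulate {n = suc n} f g = cong (_+_ (f (g zero))) (sumList-tabulate f (g ∘ suc))

sumList-sequences : ∀ m n (f : Vec (Fin n) m → ℚ) → sumList (List.map f (sequences m n)) ≡ ⟨ ∑ᶠ n ⊗ m ⟩ f
sumList-sequences zero    n f = +-identityʳ (f [])
sumList-sequences (suc m) n f = begin
  sumList (List.map f (sequences (suc m) n))
    ≡⟨ sumList-cartesianProductWith _∷_ f (allFin n) (sequences m n) ⟩
  sumList (List.map (λ v → sumList (List.map (λ π → f (v ∷ π)) (sequences m n))) (allFin n))
    ≡⟨ sumList-tabulate (λ v → sumList (List.map (λ π → f (v ∷ π)) (sequences m n))) (λ v → v) ⟩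
  ∑ℚ (λ v → sumList (List.map (λ π → f (v ∷ π)) (sequences m n)))
    ≡⟨ ∑ℚ-cong (λ v → sumList-sequences m n (λ π → f (v ∷ π))) ⟩
  ⟨ ∑ᶠ n ⊗ suc m ⟩ f ∎
  where open ≡-Reasoning

sumList-PF : ∀ m n (f : Vec (Fin n) m → ℚ) → sumList (List.map f (PF m n)) ≡ ∑PF n m f
sumList-PF m n f = begin
  sumList (List.map f (PF m n))
    ≡⟨ sumList-filter isParkingFunction? f (sequences m n) ⟩
  sumList (List.map (λ π → χ (isParkingFunction? π) * f π) (sequences m n))
    ≡⟨ sumList-sequences m n (λ π → χ (isParkingFunction? π) * f π) ⟩
  ⟨ ∑ᶠ n ⊗ m ⟩ (λ π → χ (isParkingFunction? π) * f π)
    ≡⟨ ⟨⟩-cong (∑ᶠ n ⊗ m) (λ π → cong (_* f π) (sym (χ-⇔ (good? n π) (isParkingFunction? π) (good⇔parking π)))) ⟩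
  ∑PF n m f ∎
  where open ≡-Reasoning

fromℕ-length : ∀ {A : Set} (xs : List A) → fromℕ (length xs) ≡ sumList (List.map (λ _ → 1ℚ) xs)
fromℕ-length []       = refl
fromℕ-length (x ∷ xs) = trans (fromℕ-suc (length xs)) (cong (_+_ 1ℚ) (fromℕ-length xs))

average-* : ∀ xs → average xs * fromℕ (length xs) ≡ sumList xs
average-* []           = refl
average-* xs@(_ ∷ _) = begin
  sumList xs * (+ 1 / length xs) * fromℕ (length xs)   ≡⟨ *-assoc (sumList xs) (+ 1 / length xs) (fromℕ (length xs)) ⟩
  sumList xs * ((+ 1 / length xs) * fromℕ (length xs)) ≡⟨ cong (sumList xs *_) (/-*-cancel 1 (length xs)) ⟩
  sumList xs * 1ℚ                                      ≡⟨ *-identityʳ (sumList xs) ⟩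
  sumList xs                                           ∎
  where open ≡-Reasoning

𝔼-* : ∀ m n X → 𝔼 m n X * #PF n m ≡ ∑PF n m X
𝔼-* m n X = begin
  𝔼 m n X * #PF n m                                 ≡⟨ cong (𝔼 m n X *_) length≡ ⟨
  𝔼 m n X * fromℕ (length (List.map X (PF m n)))    ≡⟨ average-* (List.map X (PF m n)) ⟩
  sumList (List.map X (PF m n))                     ≡⟨ sumList-PF m n X ⟩
  ∑PF n m X                                         ∎
  where
  open ≡-Reasoning
  length≡ : fromℕ (length (List.map X (PF m n))) ≡ #PF n m
  length≡ = begin
    fromℕ (length (List.map X (PF m n)))     ≡⟨ cong fromℕ (List.length-map X (PF m n)) ⟩
    fromℕ (length (PF m n))                  ≡⟨ fromℕ-length (PF m n) ⟩
    sumList (List.map (λ _ → 1ℚ) (PF m n))   ≡⟨ sumList-PF m n (λ _ → 1ℚ) ⟩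
    ∑PF n m (λ _ → 1ℚ)                       ≡⟨ ⟨⟩-cong (∑ᶠ n ⊗ m) (λ π → *-identityʳ (χ (good? n π))) ⟩
    #PF n m                                  ∎

-- Counting parking functions

-- The sum of C(k, j) u(j) over j, built by Pascal's rule; this matches deciding car by car whether
-- it prefers the first spot.
binomialTransform : (ℕ → ℚ) → ℕ → ℚ
binomialTransform u zero    = u 0
binomialTransform u (suc k) = binomialTransform u k + binomialTransform (u ∘ suc) k

binomialTransform-cong : ∀ {u w} k → (∀ j → j ℕ.≤ k → u j ≡ w j) → binomialTransform u k ≡ binomialTransform w k
binomialTransform-cong zero    u≡w = u≡w 0 z≤n
binomialTransform-cong (suc k) u≡w = cong₂ _+_
  (binomialTransform-cong k (λ j j≤k → u≡w j (ℕ.m≤n⇒m≤1+n j≤k)))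
  (binomialTransform-cong k (λ j j≤k → u≡w (suc j) (s≤s j≤k)))

binomialTransform-+ : ∀ u w k → binomialTransform (λ j → u j + w j) k ≡ binomialTransform u k + binomialTransform w k
binomialTransform-+ u w zero    = refl
binomialTransform-+ u w (suc k) = trans
  (cong₂ _+_ (binomialTransform-+ u w k) (binomialTransform-+ (u ∘ suc) (w ∘ suc) k))
  (ring (binomialTransform u k) (binomialTransform w k) (binomialTransform (u ∘ suc) k) (binomialTransform (w ∘ suc) k))
  where
  ring : ∀ a b c d → a + b + (c + d) ≡ a + c + (b + d)
  ring = solve-∀ ℚ-ring

binomialTransform-* : ∀ c u k → binomialTransform (λ j → c * u j) k ≡ c * binomialTransform u k
binomialTransform-* c u zero    = refl
binomialTransform-* c u (suc k) = trans
  (cong₂ _+_ (binomialTransform-* c u k) (binomialTransform-* c (u ∘ suc) k)) (sym (*-distribˡ-+ c _ _))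

⟨⟩-binomialTransform : ∀ {A} (F : Functional A) (u : A → ℕ → ℚ) k →
  ⟨ F ⟩ (λ a → binomialTransform (u a) k) ≡ binomialTransform (λ j → ⟨ F ⟩ (λ a → u a j)) k
⟨⟩-binomialTransform F u zero    = refl
⟨⟩-binomialTransform F u (suc k) = trans (⟨⟩-+ F _ _)
  (cong₂ _+_ (⟨⟩-binomialTransform F u k) (⟨⟩-binomialTransform F (λ a → u a ∘ suc) k))

binomialTransform-^ : ∀ x k → binomialTransform (x ^_) k ≡ (1ℚ + x) ^ k
binomialTransform-^ x zero    = refl
binomialTransform-^ x (suc k) = begin
  binomialTransform (x ^_) k + binomialTransform (λ j → x * x ^ j) k ≡⟨ cong (_+_ (binomialTransform (x ^_) k)) (binomialTransform-* x (x ^_) k) ⟩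
  binomialTransform (x ^_) k + x * binomialTransform (x ^_) k        ≡⟨ cong (λ b → b + x * b) (binomialTransform-^ x k) ⟩
  (1ℚ + x) ^ k + x * (1ℚ + x) ^ k                                    ≡⟨ ring x ((1ℚ + x) ^ k) ⟩
  (1ℚ + x) * (1ℚ + x) ^ k                                            ∎
  where
  open ≡-Reasoning
  ring : ∀ x b → b + x * b ≡ (1ℚ + x) * b
  ring = solve-∀ ℚ-ring

-- j xʲ⁻¹ by the product rule, which gives a meaning to j = 0. With y = n + 1, the count (n + 1 -
-- m)(n + 1)ᵐ⁻¹ is yᵐ minus the derivative of yᵐ.
derivative-^ : ℚ → ℕ → ℚ
derivative-^ x zero    = 0ℚ
derivative-^ x (suc j) = x ^ j + x * derivative-^ x j

derivative-^-suc : ∀ x j → derivative-^ x (suc j) ≡ fromℕ (suc j) * x ^ j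
derivative-^-suc x zero    = ring x
  where
  ring : ∀ x → 1ℚ + x * 0ℚ ≡ 1ℚ * 1ℚ
  ring = solve-∀ ℚ-ring
derivative-^-suc x (suc j) = begin
  x * x ^ j + x * derivative-^ x (suc j)     ≡⟨ cong (λ d → x * x ^ j + x * d) (derivative-^-suc x j) ⟩
  x * x ^ j + x * (fromℕ (suc j) * x ^ j)    ≡⟨ ring x (x ^ j) (fromℕ (suc j)) ⟩
  (1ℚ + fromℕ (suc j)) * (x * x ^ j)         ≡⟨ cong (_* (x * x ^ j)) (fromℕ-suc (suc j)) ⟨
  fromℕ (suc (suc j)) * (x * x ^ j)          ∎
  where
  open ≡-Reasoning
  ring : ∀ x a s → x * a + x * (s * a) ≡ (1ℚ + s) * (x * a)
  ring = solve-∀ ℚ-ring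

*-derivative-^ : ∀ x j → x * derivative-^ x j ≡ fromℕ j * x ^ j
*-derivative-^ x zero    = trans (*-zeroʳ x) (sym (*-zeroˡ 1ℚ))
*-derivative-^ x (suc j) = trans (cong (x *_) (derivative-^-suc x j)) (ring x (fromℕ (suc j)) (x ^ j))
  where
  ring : ∀ x s a → x * (s * a) ≡ s * (x * a)
  ring = solve-∀ ℚ-ring

-- The binomial theorem differentiated in x.
binomialTransform-derivative-^ : ∀ x k → binomialTransform (derivative-^ x) k ≡ derivative-^ (1ℚ + x) k
binomialTransform-derivative-^ x zero    = refl
binomialTransform-derivative-^ x (suc k) = begin
  B (derivative-^ x) k + B (λ j → x ^ j + x * derivative-^ x j) k
    ≡⟨ cong (_+_ (B (derivative-^ x) k)) (trans (binomialTransform-+ (x ^_) _ k)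
         (cong₂ _+_ (binomialTransform-^ x k) (binomialTransform-* x (derivative-^ x) k))) ⟩
  B (derivative-^ x) k + ((1ℚ + x) ^ k + x * B (derivative-^ x) k)
    ≡⟨ cong (λ d → d + ((1ℚ + x) ^ k + x * d)) (binomialTransform-derivative-^ x k) ⟩
  derivative-^ (1ℚ + x) k + ((1ℚ + x) ^ k + x * derivative-^ (1ℚ + x) k)
    ≡⟨ ring x (derivative-^ (1ℚ + x) k) ((1ℚ + x) ^ k) ⟩
  (1ℚ + x) ^ k + (1ℚ + x) * derivative-^ (1ℚ + x) k ∎
  where
  open ≡-Reasoning
  B = binomialTransform
  ring : ∀ x d a → d + (a + x * d) ≡ a + (1ℚ + x) * d
  ring = solve-∀ ℚ-ring

behindFirst : ∀ {n m} → Vec (Fin (suc n)) m → ∃[ j ] Vec (Fin n) j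
behindFirst []          = 0 , []
behindFirst (zero ∷ π)  = behindFirst π
behindFirst (suc v ∷ π) = suc (proj₁ (behindFirst π)) , v ∷ proj₂ (behindFirst π)

#≥-behindFirst : ∀ {n m} k (π : Vec (Fin (suc n)) m) → #≥ (suc k) π ≡ #≥ k (proj₂ (behindFirst π))
#≥-behindFirst k []          = refl
#≥-behindFirst k (zero ∷ π)  = trans (cong (ℕ._+ #≥ (suc k) π) (bit-> {suc k} (s≤s z≤n))) (#≥-behindFirst k π)
#≥-behindFirst k (suc v ∷ π) = cong (bit (k ℕ.<ᵇ suc (toℕ v)) ℕ.+_) (#≥-behindFirst k π)

-- Sequences are sorted by the set of cars preferring the first spot; the other j cars can be chosen
-- in C(k, j) ways and then range freely over the remaining n spots.
∑-behindFirst : ∀ n k (H : ∀ {j} → Vec (Fin n) j → ℚ) →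
  ⟨ ∑ᶠ (suc n) ⊗ k ⟩ (λ π → H (proj₂ (behindFirst π))) ≡ binomialTransform (λ j → ⟨ ∑ᶠ n ⊗ j ⟩ H) k
∑-behindFirst n zero    H = refl
∑-behindFirst n (suc k) H = cong₂ _+_ (∑-behindFirst n k H)
  (trans (∑ℚ-cong (λ v → ∑-behindFirst n k (λ π → H (v ∷ π))))
         (⟨⟩-binomialTransform (∑ᶠ n) (λ v j → ⟨ ∑ᶠ n ⊗ j ⟩ (λ π → H (v ∷ π))) k))

-- The condition at k = 0 counts all cars; those at k + 1 ignore the first spot and are the
-- conditions of the shorter street.
good-suc⇔ : ∀ {n m} (π : Vec (Fin (suc n)) m) → Good (suc n) π ⇔ (m ℕ.≤ suc n × Good n (proj₂ (behindFirst π)))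
good-suc⇔ {n} {m} π = mk⇔
  (λ good → ℕ.≤-trans (ℕ.≤-reflexive (trans (sym (#≥-zero π)) (sym (ℕ.+-identityʳ (#≥ 0 π))))) (good 0 (s≤s z≤n)) ,
            λ k k<n → ℕ.s≤s⁻¹ (ℕ.≤-trans (ℕ.≤-reflexive (sym (shift k))) (good (suc k) (s≤s k<n))))
  λ where
    (m≤ , good) zero    _         → ℕ.≤-trans (ℕ.≤-reflexive (trans (ℕ.+-identityʳ (#≥ 0 π)) (#≥-zero π))) m≤
    (m≤ , good) (suc k) (s≤s k<n) → ℕ.≤-trans (ℕ.≤-reflexive (shift k)) (s≤s (good k k<n))
  where
  shift : ∀ k → #≥ (suc k) π ℕ.+ suc k ≡ suc (#≥ k (proj₂ (behindFirst π)) ℕ.+ k)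
  shift k = trans (ℕ.+-suc (#≥ (suc k) π) k) (cong (λ c → suc (c ℕ.+ k)) (#≥-behindFirst k π))

-- Removing the cars that prefer the first spot makes #PF (suc n) the binomial transform of #PF n.
#PF-formula : ∀ n m → m ℕ.≤ suc n → #PF n m ≡ fromℕ (suc n) ^ m - derivative-^ (fromℕ (suc n)) m
#PF-formula zero    zero          _ = χ-yes (good? 0 []) (λ _ ())
#PF-formula zero    (suc zero)    _ = refl
#PF-formula zero    (suc (suc m)) (s≤s ())
#PF-formula (suc n) m m≤2+n with ℕ.m≤n⇒m<n∨m≡n m≤2+n
... | inj₁ (s≤s m≤1+n) = begin
  #PF (suc n) m
    ≡⟨ ⟨⟩-cong (∑ᶠ (suc n) ⊗ m) (λ π → χ-⇔ (good? (suc n) π) (good? n (proj₂ (behindFirst π)))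
         (mk⇔ (proj₂ ∘ Equivalence.to (good-suc⇔ π)) (λ good → Equivalence.from (good-suc⇔ π) (m≤1+n , good)))) ⟩
  ⟨ ∑ᶠ (suc n) ⊗ m ⟩ (λ π → χ (good? n (proj₂ (behindFirst π))))
    ≡⟨ ∑-behindFirst n m (λ π → χ (good? n π)) ⟩
  binomialTransform (#PF n) m
    ≡⟨ binomialTransform-cong m (λ j j≤m → trans (#PF-formula n j (ℕ.≤-trans j≤m m≤1+n)) (ring (x ^ j) (derivative-^ x j))) ⟩
  binomialTransform (λ j → x ^ j + (- 1ℚ) * derivative-^ x j) m
    ≡⟨ trans (binomialTransform-+ (x ^_) _ m) (cong₂ _+_ (binomialTransform-^ x m)
         (trans (binomialTransform-* (- 1ℚ) (derivative-^ x) m) (cong ((- 1ℚ) *_) (binomialTransform-derivative-^ x m)))) ⟩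
  (1ℚ + x) ^ m + (- 1ℚ) * derivative-^ (1ℚ + x) m
    ≡⟨ ring ((1ℚ + x) ^ m) (derivative-^ (1ℚ + x) m) ⟨
  (1ℚ + x) ^ m - derivative-^ (1ℚ + x) m
    ≡⟨ cong (λ y → y ^ m - derivative-^ y m) (fromℕ-suc (suc n)) ⟨
  fromℕ (suc (suc n)) ^ m - derivative-^ (fromℕ (suc (suc n))) m ∎
  where
  open ≡-Reasoning
  x = fromℕ (suc n)
  ring : ∀ a b → a - b ≡ a + (- 1ℚ) * b
  ring = solve-∀ ℚ-ring
-- One car more than spots: nothing parks, and yᵐ equals its derivative at y = m. The case belongs
-- to the induction, since a full street of n + 1 cars may have all of them behind the first spot.
... | inj₂ refl = trans
  (trans (⟨⟩-cong (∑ᶠ (suc n) ⊗ m) (λ π → χ-no (good? (suc n) π) (λ good → ℕ.1+n≰n (proj₁ (Equivalence.to (good-suc⇔ π) good)))))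
         (⟨⟩-0 (∑ᶠ (suc n) ⊗ m)))
  (sym (trans (cong (λ d → fromℕ m ^ m - d) (derivative-^-suc (fromℕ m) (suc n))) (+-inverseʳ (fromℕ m ^ m))))

-- Multiplying by n + 1 clears the exponent m - 1, which would be negative for m = 0.
#PF-* : ∀ n m → m ℕ.≤ suc n → #PF n m * fromℕ (suc n) ≡ fromℕ (suc n) ^ m * (fromℕ (suc n) - fromℕ m)
#PF-* n m m≤1+n = begin
  #PF n m * x                             ≡⟨ cong (_* x) (#PF-formula n m m≤1+n) ⟩
  (x ^ m - derivative-^ x m) * x          ≡⟨ ring₁ x (x ^ m) (derivative-^ x m) ⟩
  x ^ m * x - x * derivative-^ x m        ≡⟨ cong (λ d → x ^ m * x - d) (*-derivative-^ x m) ⟩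
  x ^ m * x - fromℕ m * x ^ m             ≡⟨ ring₂ x (x ^ m) (fromℕ m) ⟩
  x ^ m * (x - fromℕ m)                   ∎
  where
  open ≡-Reasoning
  x = fromℕ (suc n)
  ring₁ : ∀ x a d → (a - d) * x ≡ a * x - x * d
  ring₁ = solve-∀ ℚ-ring
  ring₂ : ∀ x a m → a * x - m * a ≡ a * (x - m)
  ring₂ = solve-∀ ℚ-ring

first : ∀ {P : ℕ → Set} → Decidable P → ℕ → ℕ
first P? zero    = 0
first P? (suc n) with P? 0
... | yes _ = 0
... | no  _ = suc (first (λ k → P? (suc k)) n)

first-≤ : ∀ {P : ℕ → Set} (P? : Decidable P) n → first P? n ℕ.≤ n
first-≤ P? zero    = z≤n
first-≤ P? (suc n) with P? 0
... | yes _ = z≤n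
... | no  _ = s≤s (first-≤ (λ k → P? (suc k)) n)

first-minimal : ∀ {P : ℕ → Set} (P? : Decidable P) n {k} → k ℕ.< first P? n → ¬ P k
first-minimal P? (suc n) {k} k< with P? 0
first-minimal P? (suc n) {zero}  _        | no ¬p = ¬p
first-minimal P? (suc n) {suc k} (s≤s k<) | no _  = first-minimal (λ k → P? (suc k)) n k<

first-holds : ∀ {P : ℕ → Set} (P? : Decidable P) n → first P? n ℕ.< n → P (first P? n)
first-holds P? (suc n) <n with P? 0
... | yes p = p
first-holds P? (suc n) (s≤s <n) | no _ = first-holds (λ k → P? (suc k)) n <n

-- A union bound: the index found is the default n or some k < n satisfying P, and all other terms
-- are nonnegative. It reduces a moment of the barrier to the probabilities of single events.
≤-∑-first : ∀ {P : ℕ → Set} (P? : Decidable P) n (f : ℕ → ℚ) → (∀ k → 0ℚ ≤ f k) →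
  f (first P? n) ≤ f n + ∑< n (λ k → f k * χ (P? k))
≤-∑-first P? zero    f 0≤f = ≤-reflexive (sym (+-identityʳ (f 0)))
≤-∑-first P? (suc n) f 0≤f with P? 0
... | yes _ = ≤-by (f (suc n) + S) (0≤+ (0≤f (suc n)) (∑ℚ-nonNeg {n} (λ k → 0≤* (0≤f (suc (toℕ k))) (0≤χ (P? (suc (toℕ k)))))))
                (ring (f 0) (f (suc n)) S)
  where
  S = ∑< n (λ k → f (suc k) * χ (P? (suc k)))
  ring : ∀ a b S → a + (b + S) ≡ b + (a * 1ℚ + S)
  ring = solve-∀ ℚ-ring
... | no  _ = ≤-trans (≤-∑-first (λ k → P? (suc k)) n (f ∘ suc) (0≤f ∘ suc)) (≤-reflexive (ring (f 0) (f (suc n)) S))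
  where
  S = ∑< n (λ k → f (suc k) * χ (P? (suc k)))
  ring : ∀ a b S → b + S ≡ b + (a * 0ℚ + S)
  ring = solve-∀ ℚ-ring

∑<-truncate : ∀ n L → L ℕ.≤ n → ∀ (f : ℕ → ℚ) → ∑< n (λ v → f v * χ (v ℕ.<? L)) ≡ ∑< L f
∑<-truncate n       zero    _         f = trans
  (∑ℚ-cong {n} (λ v → trans (cong (f (toℕ v) *_) (χ-no (toℕ v ℕ.<? 0) λ ())) (trans (*-zeroʳ (f (toℕ v))) (sym (*-zeroˡ 0ℚ)))))
  (trans (∑ℚ-* {n} 0ℚ (λ _ → 0ℚ)) (*-zeroˡ (∑ℚ {n} (λ _ → 0ℚ))))
∑<-truncate (suc n) (suc L) (s≤s L≤n) f = cong₂ _+_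
  (*-identityʳ (f 0))
  (trans (∑ℚ-cong {n} (λ v → cong (f (suc (toℕ v)) *_)
           (χ-⇔ (suc (toℕ v) ℕ.<? suc L) (toℕ v ℕ.<? L) (mk⇔ ℕ.s≤s⁻¹ s≤s))))
         (∑<-truncate n L L≤n (f ∘ suc)))

-- Adding cars to a parking function

-- The first spot, counted from 0, from which on fewer than l spots stay free.
barrier : ∀ {n m} → ℕ → Vec (Fin n) m → ℕ
barrier {n} l π = first (λ k → n ℕ.<? #≥ k π ℕ.+ k ℕ.+ l) n

barrier-≤ : ∀ {n m} l (π : Vec (Fin n) m) → barrier l π ℕ.≤ n
barrier-≤ {n} l π = first-≤ (λ k → n ℕ.<? #≥ k π ℕ.+ k ℕ.+ l) n

<-barrier : ∀ {n m} l (π : Vec (Fin n) m) {k} → k ℕ.< barrier l π → #≥ k π ℕ.+ k ℕ.+ l ℕ.≤ n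
<-barrier {n} l π k< = ℕ.≮⇒≥ (first-minimal (λ k → n ℕ.<? #≥ k π ℕ.+ k ℕ.+ l) n k<)

barrier-holds : ∀ {n m} l (π : Vec (Fin n) m) → let b = barrier l π in b ℕ.< n → n ℕ.< #≥ b π ℕ.+ b ℕ.+ l
barrier-holds {n} l π = first-holds (λ k → n ℕ.<? #≥ k π ℕ.+ k ℕ.+ l) n

barrier-antitone : ∀ {n m l l′} (π : Vec (Fin n) m) → l ℕ.≤ l′ → barrier l′ π ℕ.≤ barrier l π
barrier-antitone {n} {l = l} {l′} π l≤l′ = ℕ.≮⇒≥ λ b<b′ → ℕ.<⇒≱
  (barrier-holds l π (ℕ.<-≤-trans b<b′ (barrier-≤ l′ π)))
  (ℕ.≤-trans (ℕ.+-monoʳ-≤ (#≥ (barrier l π) π ℕ.+ barrier l π) l≤l′) (<-barrier l′ π b<b′))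

module _ {n l m} (a : Vec (Fin n) l) (π : Vec (Fin n) m) where

  private
    shuffle : ∀ c x k → c ℕ.+ x ℕ.+ k ≡ x ℕ.+ k ℕ.+ c
    shuffle = ℕ-solve-∀

    #≥-++′ : ∀ k → #≥ k (a ++ π) ℕ.+ k ≡ #≥ k π ℕ.+ k ℕ.+ #≥ k a
    #≥-++′ k = trans (cong (ℕ._+ k) (#≥-++ k a π)) (shuffle (#≥ k a) (#≥ k π) k)

  good-++⇒good : Good n (a ++ π) → Good n π
  good-++⇒good good k k<n =
    ℕ.≤-trans (ℕ.m≤m+n (#≥ k π ℕ.+ k) (#≥ k a)) (ℕ.≤-trans (ℕ.≤-reflexive (sym (#≥-++′ k))) (good k k<n))

  -- At the barrier the count for π alone already reaches n, so one more preference at or behind it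
  -- breaks the condition there.
  good-++⇒<barrier : Good n (a ++ π) → ∀ i → toℕ (lookup a i) ℕ.< barrier 1 π
  good-++⇒<barrier good i = ℕ.≰⇒> λ b≤aᵢ →
    let b<n = ℕ.≤-<-trans b≤aᵢ (Fin.toℕ<n (lookup a i)) in
    ℕ.<⇒≱ (barrier-holds 1 π b<n)
      (ℕ.≤-trans (ℕ.+-monoʳ-≤ (#≥ b π ℕ.+ b) (#≥-lookup a i b≤aᵢ)) (ℕ.≤-trans (ℕ.≤-reflexive (sym (#≥-++′ b))) (good b b<n)))
    where b = barrier 1 π

  -- Before `barrier l π` the condition has slack l, enough for the whole prefix. Behind it at most
  -- one prefix car is counted; if there is one, its own position lies before `barrier 1 π`, and so
  -- does k, where slack 1 remains.
  <barrier⇒good-++ : Good n π → #≥ (barrier l π) a ℕ.≤ 1 → (∀ i → toℕ (lookup a i) ℕ.< barrier 1 π) → Good n (a ++ π)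
  <barrier⇒good-++ good #≤1 a<b k k<n = ℕ.≤-trans (ℕ.≤-reflexive (#≥-++′ k)) (fits (k ℕ.<? barrier l π))
    where
    fits : Dec (k ℕ.< barrier l π) → #≥ k π ℕ.+ k ℕ.+ #≥ k a ℕ.≤ n
    fits (yes k<bₗ) = ℕ.≤-trans (ℕ.+-monoʳ-≤ (#≥ k π ℕ.+ k) (#≥-≤ k a)) (<-barrier l π k<bₗ)
    fits (no  k≮bₗ) with #≥ k a in eq | ℕ.≤-trans (#≥-antitone a (ℕ.≮⇒≥ k≮bₗ)) #≤1
    ... | zero  | _         = ℕ.≤-trans (ℕ.≤-reflexive (ℕ.+-identityʳ (#≥ k π ℕ.+ k))) (good k k<n)
    ... | suc _ | s≤s z≤n   with #≥-witness k a (ℕ.≤-reflexive (sym eq))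
    ...   | i , k≤aᵢ = <-barrier 1 π (ℕ.≤-<-trans k≤aᵢ (a<b i))

∏-χ : ∀ {l} {P : Fin l → Set} (d : ∀ i → Dec (P i)) (e : Dec (∀ i → P i)) → ∏ℚ (λ i → χ (d i)) ≡ χ e
∏-χ {zero}  d e = sym (χ-yes e λ ())
∏-χ {suc l} d e with d zero
... | no ¬p = trans (*-zeroˡ (∏ℚ (λ i → χ (d (suc i))))) (sym (χ-no e (λ ps → ¬p (ps zero))))
... | yes p = trans (*-identityˡ (∏ℚ (λ i → χ (d (suc i))))) (trans (∏-χ (λ i → d (suc i)) e′)
    (χ-⇔ e′ e (mk⇔ (λ { ps zero → p ; ps (suc i) → ps i }) (λ ps i → ps (suc i)))))
  where e′ = map′ (λ ps i → ps (suc i)) (λ { ps zero → p ; ps (suc i) → ps i }) e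

∏-≤1 : ∀ {l} {f : Fin l → ℚ} → (∀ i → 0ℚ ≤ f i) → (∀ i → f i ≤ 1ℚ) → 0ℚ ≤ ∏ℚ f × ∏ℚ f ≤ 1ℚ
∏-≤1 {zero}  0≤f f≤1 = 0≤1 , ≤-refl
∏-≤1 {suc l} 0≤f f≤1 with ∏-≤1 (λ i → 0≤f (suc i)) (λ i → f≤1 (suc i))
... | 0≤∏ , ∏≤1 = 0≤* (0≤f zero) 0≤∏ , *-mono-≤ (0≤f zero) 0≤1 (f≤1 zero) ∏≤1

-- The number of pairs of entries that are both at least b. It dominates the event of two such
-- entries, and its mean is quadratic in the probability of one.
pairs≥ : ∀ {n l} → ℕ → Vec (Fin n) l → ℚ
pairs≥ b []      = 0ℚ
pairs≥ b (v ∷ a) = χ (b ℕ.≤? toℕ v) * fromℕ (#≥ b a) + pairs≥ b a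

0≤pairs≥ : ∀ {n l} b (a : Vec (Fin n) l) → 0ℚ ≤ pairs≥ b a
0≤pairs≥ b []      = ≤-refl
0≤pairs≥ b (v ∷ a) = 0≤+ (0≤* (0≤χ (b ℕ.≤? toℕ v)) (0≤fromℕ (#≥ b a))) (0≤pairs≥ b a)

1≤pairs≥ : ∀ {n l} b (a : Vec (Fin n) l) → 2 ℕ.≤ #≥ b a → 1ℚ ≤ pairs≥ b a
1≤pairs≥ b (v ∷ a) 2≤ with b ℕ.≤? toℕ v
... | yes b≤v rewrite bit-≤ b≤v = ≤-trans (fromℕ-mono-≤ (ℕ.s≤s⁻¹ 2≤)) (≤-by (pairs≥ b a) (0≤pairs≥ b a)
    (cong (_+ pairs≥ b a) (sym (*-identityˡ (fromℕ (#≥ b a))))))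
... | no b≰v rewrite bit-> (ℕ.≰⇒> b≰v) = ≤-trans (1≤pairs≥ b a 2≤)
    (≤-reflexive (sym (trans (cong (_+ pairs≥ b a) (*-zeroˡ (fromℕ (#≥ b a)))) (+-identityˡ (pairs≥ b a)))))

-- With at most one entry behind `barrier l π` the two indicators agree. Otherwise they differ by at
-- most 1, and there is at least one pair.
∣χ-good-++∣≤ : ∀ {n l m} (a : Vec (Fin n) l) (π : Vec (Fin n) m) → Good n π →
  ∣ χ (good? n (a ++ π)) - ∏ℚ (λ i → χ (toℕ (lookup a i) ℕ.<? barrier 1 π)) ∣ ≤ pairs≥ (barrier l π) a
∣χ-good-++∣≤ {n} {l} a π good with #≥ (barrier l π) a ℕ.≤? 1
... | yes #≤1 = subst (_≤ pairs≥ (barrier l π) a) (sym (cong ∣_∣ (trans (cong (_- ∏χ) χ≡∏χ) (+-inverseʳ ∏χ))))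
                  (0≤pairs≥ (barrier l π) a)
  where
  ∏χ = ∏ℚ (λ i → χ (toℕ (lookup a i) ℕ.<? barrier 1 π))
  χ≡∏χ : χ (good? n (a ++ π)) ≡ ∏χ
  χ≡∏χ = trans
    (χ-⇔ (good? n (a ++ π)) all? (mk⇔ (good-++⇒<barrier a π) (<barrier⇒good-++ a π good #≤1)))
    (sym (∏-χ (λ i → toℕ (lookup a i) ℕ.<? barrier 1 π) all?))
    where
    all? = map′ (good-++⇒<barrier a π) (<barrier⇒good-++ a π good #≤1) (good? n (a ++ π))
... | no #≰1 = ≤-trans (∣-∣≤1 (0≤χ g) (χ≤1 g) (proj₁ ∏-bounds) (proj₂ ∏-bounds)) (1≤pairs≥ (barrier l π) a (ℕ.≰⇒> #≰1))
  where
  g = good? n (a ++ π)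
  ∏-bounds = ∏-≤1 (λ i → 0≤χ (toℕ (lookup a i) ℕ.<? barrier 1 π)) (λ i → χ≤1 (toℕ (lookup a i) ℕ.<? barrier 1 π))
  neg : ∀ a b → - (b - a) ≡ a - b
  neg = solve-∀ ℚ-ring
  cancel : ∀ a b → a - b + b ≡ a
  cancel = solve-∀ ℚ-ring
  -≤1 : ∀ {a b} → a ≤ 1ℚ → 0ℚ ≤ b → a - b ≤ 1ℚ
  -≤1 {a} {b} a≤1 0≤b = ≤-trans (≤-by b 0≤b (cancel a b)) a≤1
  ∣-∣≤1 : ∀ {a b} → 0ℚ ≤ a → a ≤ 1ℚ → 0ℚ ≤ b → b ≤ 1ℚ → ∣ a - b ∣ ≤ 1ℚ
  ∣-∣≤1 {a} {b} 0≤a a≤1 0≤b b≤1 with ≤-total b a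
  ... | inj₁ b≤a = 0≤⇒∣∣≤ (≤⇒0≤- b≤a) (-≤1 a≤1 0≤b)
  ... | inj₂ a≤b = subst (λ d → ∣ d ∣ ≤ 1ℚ) (neg a b) (∣-∣≤ (b - a) (0≤⇒∣∣≤ (≤⇒0≤- a≤b) (-≤1 b≤1 0≤a)))

-- Averages over a uniform prefix, with x = 1/n

mean : ∀ n x → 0ℚ ≤ x → Functional (Fin n)
mean n x 0≤x = scale x 0≤x (∑ᶠ n)

-- The binomial coefficient C(l, 2).
pairCount : ℕ → ℕ
pairCount zero    = 0
pairCount (suc l) = l ℕ.+ pairCount l

module _ {n : ℕ} {x : ℚ} (0≤x : 0ℚ ≤ x) (xn≡1 : x * fromℕ n ≡ 1ℚ) where

  private
    μ : Functional (Fin n)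
    μ = mean n x 0≤x

  mean-1 : ⟨ μ ⟩ (λ _ → 1ℚ) ≡ 1ℚ
  mean-1 = trans (cong (x *_) (trans (∑ℚ-const n 1ℚ) (*-identityʳ (fromℕ n)))) xn≡1

  mean-< : ∀ b → b ℕ.≤ n → ⟨ μ ⟩ (λ v → χ (toℕ v ℕ.<? b)) ≡ fromℕ b * x
  mean-< b b≤n = begin
    x * ∑< n (λ v → χ (v ℕ.<? b))         ≡⟨ cong (x *_) (∑ℚ-cong {n} (λ v → sym (*-identityˡ (χ (toℕ v ℕ.<? b))))) ⟩
    x * ∑< n (λ v → 1ℚ * χ (v ℕ.<? b))    ≡⟨ cong (x *_) (∑<-truncate n b b≤n (λ _ → 1ℚ)) ⟩
    x * ∑< b (λ _ → 1ℚ)                   ≡⟨ cong (x *_) (∑ℚ-const b 1ℚ) ⟩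
    x * (fromℕ b * 1ℚ)                    ≡⟨ ring x (fromℕ b) ⟩
    fromℕ b * x                           ∎
    where
    open ≡-Reasoning
    ring : ∀ x b → x * (b * 1ℚ) ≡ b * x
    ring = solve-∀ ℚ-ring

  partition : ∀ b → b ℕ.≤ n → fromℕ b * x + fromℕ (n ℕ.∸ b) * x ≡ 1ℚ
  partition b b≤n = begin
    fromℕ b * x + fromℕ (n ℕ.∸ b) * x    ≡⟨ *-distribʳ-+ x (fromℕ b) (fromℕ (n ℕ.∸ b)) ⟨
    (fromℕ b + fromℕ (n ℕ.∸ b)) * x      ≡⟨ cong (_* x) (fromℕ-+ b (n ℕ.∸ b)) ⟨
    fromℕ (b ℕ.+ (n ℕ.∸ b)) * x          ≡⟨ cong (λ k → fromℕ k * x) (ℕ.m+[n∸m]≡n b≤n) ⟩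
    fromℕ n * x                          ≡⟨ *-comm (fromℕ n) x ⟩
    x * fromℕ n                          ≡⟨ xn≡1 ⟩
    1ℚ                                   ∎
    where open ≡-Reasoning

  mean-≥ : ∀ b → b ℕ.≤ n → ⟨ μ ⟩ (λ v → χ (b ℕ.≤? toℕ v)) ≡ fromℕ (n ℕ.∸ b) * x
  mean-≥ b b≤n = begin
    ⟨ μ ⟩ (λ v → χ (b ℕ.≤? toℕ v))                             ≡⟨ ⟨⟩-cong μ (λ v → complement (toℕ v)) ⟩
    ⟨ μ ⟩ (λ v → 1ℚ - χ (toℕ v ℕ.<? b))                        ≡⟨ ⟨⟩-- μ (λ _ → 1ℚ) (λ v → χ (toℕ v ℕ.<? b)) ⟩
    ⟨ μ ⟩ (λ _ → 1ℚ) - ⟨ μ ⟩ (λ v → χ (toℕ v ℕ.<? b))          ≡⟨ cong₂ _-_ mean-1 (mean-< b b≤n) ⟩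
    1ℚ - fromℕ b * x                                           ≡⟨ cong (_- fromℕ b * x) (partition b b≤n) ⟨
    fromℕ b * x + fromℕ (n ℕ.∸ b) * x - fromℕ b * x            ≡⟨ ring (fromℕ b * x) (fromℕ (n ℕ.∸ b) * x) ⟩
    fromℕ (n ℕ.∸ b) * x                                        ∎
    where
    open ≡-Reasoning
    ring : ∀ a b → a + b - a ≡ b
    ring = solve-∀ ℚ-ring
    complement : ∀ v → χ (b ℕ.≤? v) ≡ 1ℚ - χ (v ℕ.<? b)
    complement v with v ℕ.<? b
    ... | yes v<b = χ-no (b ℕ.≤? v) (ℕ.<⇒≱ v<b)
    ... | no  v≮b = χ-yes (b ℕ.≤? v) (ℕ.≮⇒≥ v≮b)

  module _ (b : ℕ) (b≤n : b ℕ.≤ n) where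

    private
      κ : ℚ
      κ = fromℕ (n ℕ.∸ b) * x

    mean-#≥ : ∀ l → ⟨ μ ⊗ l ⟩ (λ a → fromℕ (#≥ b a)) ≡ fromℕ l * κ
    mean-#≥ zero    = sym (*-zeroˡ κ)
    mean-#≥ (suc l) = begin
      ⟨ μ ⟩ (λ v → ⟨ μ ⊗ l ⟩ (λ a → fromℕ (bit (b ℕ.<ᵇ suc (toℕ v)) ℕ.+ #≥ b a)))
        ≡⟨ ⟨⟩-cong μ (λ v → trans (⟨⟩-cong (μ ⊗ l) (λ a → trans (fromℕ-+ (bit (b ℕ.<ᵇ suc (toℕ v))) (#≥ b a)) (cong (_+ fromℕ (#≥ b a)) (fromℕ-bit (toℕ v)))))
             (trans (⟨⟩-+ (μ ⊗ l) _ _) (cong₂ _+_ (⊗-const μ mean-1 l (χ (b ℕ.≤? toℕ v))) (mean-#≥ l)))) ⟩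
      ⟨ μ ⟩ (λ v → χ (b ℕ.≤? toℕ v) + fromℕ l * κ)
        ≡⟨ trans (⟨⟩-+ μ _ _) (cong₂ _+_ (mean-≥ b b≤n) (⊗-const μ mean-1 1 (fromℕ l * κ))) ⟩
      κ + fromℕ l * κ
        ≡⟨ ring κ (fromℕ l) ⟩
      (1ℚ + fromℕ l) * κ
        ≡⟨ cong (_* κ) (fromℕ-suc l) ⟨
      fromℕ (suc l) * κ ∎
      where
      open ≡-Reasoning
      ring : ∀ k l → k + l * k ≡ (1ℚ + l) * k
      ring = solve-∀ ℚ-ring
      fromℕ-bit : ∀ v → fromℕ (bit (b ℕ.<ᵇ suc v)) ≡ χ (b ℕ.≤? v)
      fromℕ-bit v with b ℕ.≤? v
      ... | yes b≤v rewrite bit-≤ b≤v = refl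
      ... | no  b≰v rewrite bit-> (ℕ.≰⇒> b≰v) = refl

    -- Two different cars are independent, and each lands at or behind b with probability κ.
    mean-pairs≥ : ∀ l → ⟨ μ ⊗ l ⟩ (pairs≥ b) ≡ fromℕ (pairCount l) * (κ * κ)
    mean-pairs≥ zero    = sym (*-zeroˡ (κ * κ))
    mean-pairs≥ (suc l) = begin
      ⟨ μ ⟩ (λ v → ⟨ μ ⊗ l ⟩ (λ a → χ (b ℕ.≤? toℕ v) * fromℕ (#≥ b a) + pairs≥ b a))
        ≡⟨ ⟨⟩-cong μ (λ v → trans (⟨⟩-+ (μ ⊗ l) _ _)
             (cong₂ _+_ (trans (⟨⟩-* (μ ⊗ l) (χ (b ℕ.≤? toℕ v)) _) (cong (χ (b ℕ.≤? toℕ v) *_) (mean-#≥ l))) (mean-pairs≥ l))) ⟩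
      ⟨ μ ⟩ (λ v → χ (b ℕ.≤? toℕ v) * (fromℕ l * κ) + fromℕ (pairCount l) * (κ * κ))
        ≡⟨ trans (⟨⟩-+ μ _ _) (cong₂ _+_
             (trans (⟨⟩-*ʳ μ (λ v → χ (b ℕ.≤? toℕ v)) (fromℕ l * κ)) (cong (_* (fromℕ l * κ)) (mean-≥ b b≤n)))
             (⊗-const μ mean-1 1 (fromℕ (pairCount l) * (κ * κ)))) ⟩
      κ * (fromℕ l * κ) + fromℕ (pairCount l) * (κ * κ)
        ≡⟨ ring κ (fromℕ l) (fromℕ (pairCount l)) ⟩
      (fromℕ l + fromℕ (pairCount l)) * (κ * κ)
        ≡⟨ cong (_* (κ * κ)) (fromℕ-+ l (pairCount l)) ⟨
      fromℕ (pairCount (suc l)) * (κ * κ) ∎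
      where
      open ≡-Reasoning
      ring : ∀ k l p → k * (l * k) + p * (k * k) ≡ (l + p) * (k * k)
      ring = solve-∀ ℚ-ring

  -- Once the parking indicator is replaced by the product of the single-car conditions, the
  -- integrand is a product over independent cars and its mean factorises. As the weights are in
  -- [0, 1], the replacement costs at most the mean number of pairs.
  mean-prefix : ∀ {l m} (w : Fin l → ℕ → ℚ) → (∀ i (v : Fin n) → 0ℚ ≤ w i (toℕ v) × w i (toℕ v) ≤ 1ℚ) →
    (π : Vec (Fin n) m) → Good n π →
    ∣ ⟨ μ ⊗ l ⟩ (λ a → ∏ℚ (λ i → w i (toℕ (lookup a i))) * χ (good? n (a ++ π)))
      - ∏ℚ (λ i → x * ∑< (barrier 1 π) (w i)) ∣
    ≤ fromℕ (pairCount l) * (fromℕ (n ℕ.∸ barrier l π) * x * (fromℕ (n ℕ.∸ barrier l π) * x))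
  mean-prefix {l} w w-bounds π good = subst₂ _≤_
    (cong ∣_∣ (trans (⟨⟩-- (μ ⊗ l) _ _) (cong (λ p → ⟨ μ ⊗ l ⟩ (λ a → W a * χ (good? n (a ++ π))) - p) (trans (⊗-∏ μ u) (∏-cong u-mean)))))
    (mean-pairs≥ (barrier l π) (barrier-≤ l π) l)
    (∣⟨⟩∣≤ (μ ⊗ l) pointwise)
    where
    b = barrier 1 π
    W : Vec (Fin n) l → ℚ
    W a = ∏ℚ (λ i → w i (toℕ (lookup a i)))
    u : Fin l → Fin n → ℚ
    u i v = w i (toℕ v) * χ (toℕ v ℕ.<? b)
    u-mean : ∀ i → ⟨ μ ⟩ (u i) ≡ x * ∑< b (w i)
    u-mean i = cong (x *_) (∑<-truncate n b (barrier-≤ 1 π) (w i))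
    pointwise : ∀ a → ∣ W a * χ (good? n (a ++ π)) - ∏ℚ (λ i → u i (lookup a i)) ∣ ≤ pairs≥ (barrier l π) a
    pointwise a = subst₂ _≤_
      (cong ∣_∣ (trans (ring (W a) (χ (good? n (a ++ π))) (∏ℚ (λ i → χ (toℕ (lookup a i) ℕ.<? b))))
        (cong (λ p → W a * χ (good? n (a ++ π)) - p) (sym (∏-distrib-* (λ i → w i (toℕ (lookup a i))) (λ i → χ (toℕ (lookup a i) ℕ.<? b)))))))
      (*-identityˡ (pairs≥ (barrier l π) a))
      (∣*∣≤ (0≤⇒∣∣≤ (proj₁ W-bounds) (proj₂ W-bounds)) (∣χ-good-++∣≤ a π good))
      where
      W-bounds = ∏-≤1 (λ i → proj₁ (w-bounds i (lookup a i))) (λ i → proj₂ (w-bounds i (lookup a i)))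
      ring : ∀ w g p → w * (g - p) ≡ w * g - w * p
      ring = solve-∀ ℚ-ring

-- The tail bound

inverse : ∀ a → 0ℚ < a → ∃[ b ] 0ℚ ≤ b × a * b ≡ 1ℚ
inverse a 0<a = 1/ a , nonNegative⁻¹ (1/ a) {{pos⇒nonNeg (1/ a) {{1/pos⇒pos a}}}} , *-inverseʳ a
  where instance
    pos = positive 0<a
    nz  = pos⇒nonZero a

module Tail (c : ℚ) (0≤c : 0ℚ ≤ c) (c<1 : c < 1ℚ) where

  -- ξ = 1 + ε is the base of the Chernoff bound. The decay rate it yields is at least (1 + δ)³, and
  -- two of these three factors absorb the t² of the second moment.
  ε δ ξ η σ D : ℚ
  ε = ½ * (1ℚ - c)
  δ = ½ * (½ * (½ * (ε * ε)))
  ξ = 1ℚ + ε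

  0<1-c : 0ℚ < 1ℚ - c
  0<1-c = subst (_< 1ℚ - c) (+-inverseʳ c) (+-monoˡ-< (- c) c<1)

  0<½ : 0ℚ < ½
  0<½ = positive⁻¹ ½

  0<ε : 0ℚ < ε
  0<ε = 0<-* 0<½ 0<1-c

  0<δ : 0ℚ < δ
  0<δ = 0<-* 0<½ (0<-* 0<½ (0<-* 0<½ (0<-* 0<ε 0<ε)))

  0≤ε = <⇒≤ 0<ε
  0≤δ = <⇒≤ 0<δ

  1≤1+ : ∀ {a} → 0ℚ ≤ a → 1ℚ ≤ 1ℚ + a
  1≤1+ {a} 0≤a = ≤-by a 0≤a refl

  0<1+ : ∀ {a} → 0ℚ ≤ a → 0ℚ < 1ℚ + a
  0<1+ 0≤a = <-≤-trans 0<1 (1≤1+ 0≤a)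

  η = proj₁ (inverse ξ (0<1+ 0≤ε))
  σ = proj₁ (inverse (1ℚ + δ) (0<1+ 0≤δ))
  D = proj₁ (inverse δ 0<δ)

  0≤η : 0ℚ ≤ η
  0≤η = proj₁ (proj₂ (inverse ξ (0<1+ 0≤ε)))
  0≤σ : 0ℚ ≤ σ
  0≤σ = proj₁ (proj₂ (inverse (1ℚ + δ) (0<1+ 0≤δ)))
  0≤D : 0ℚ ≤ D
  0≤D = proj₁ (proj₂ (inverse δ 0<δ))
  ξη≡1 : ξ * η ≡ 1ℚ
  ξη≡1 = proj₂ (proj₂ (inverse ξ (0<1+ 0≤ε)))
  [1+δ]σ≡1 : (1ℚ + δ) * σ ≡ 1ℚ
  [1+δ]σ≡1 = proj₂ (proj₂ (inverse (1ℚ + δ) (0<1+ 0≤δ)))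
  δD≡1 : δ * D ≡ 1ℚ
  δD≡1 = proj₂ (proj₂ (inverse δ 0<δ))

  0≤ξ : 0ℚ ≤ ξ
  0≤ξ = 0≤+ 0≤1 0≤ε

  ε≤1 : ε ≤ 1ℚ
  ε≤1 = ≤-by (½ + ½ * c) (0≤+ 0≤½ (0≤* 0≤½ 0≤c)) (ring c)
    where
    ring : ∀ c → ½ * (1ℚ - c) + (½ + ½ * c) ≡ 1ℚ
    ring = solve-∀ ℚ-ring

  ε²≤1 : ε * ε ≤ 1ℚ
  ε²≤1 = *-mono-≤ 0≤ε 0≤1 ε≤1 ε≤1

  δ≤1 : δ ≤ 1ℚ
  δ≤1 = ≤-trans (*-monoˡ-≤ 0≤½ (*-monoˡ-≤ 0≤½ (*-monoˡ-≤ 0≤½ ε²≤1)))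
    (≤-by (½ + ½ * (½ + ½ * ½)) (0≤+ 0≤½ (0≤* 0≤½ (0≤+ 0≤½ (0≤* 0≤½ 0≤½)))) refl)

  -- The origin of both constants: 1 - c = 2ε gives (1 - cε)(1 + ε) = 1 + (2 - c)ε², which exceeds 1
  -- + ε² = 1 + 8δ, and (1 + δ)³ ≤ 1 + 8δ because δ ≤ 1.
  [1+δ]³≤ : (1ℚ + δ) * ((1ℚ + δ) * (1ℚ + δ)) ≤ (1ℚ - c * ε) * ξ
  [1+δ]³≤ = ≤-trans
    (≤-by (fromℕ 3 * (δ * (1ℚ - δ)) + δ * ((1ℚ - δ) * (1ℚ + δ)) + δ)
      (0≤+ (0≤+ (0≤* (0≤fromℕ 3) (0≤* 0≤δ 0≤1-δ)) (0≤* 0≤δ (0≤* 0≤1-δ (0≤+ 0≤1 0≤δ)))) 0≤δ)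
      (ring₁ δ))
    (≤-by ((1ℚ - c) * (ε * ε)) (0≤* (<⇒≤ 0<1-c) (0≤* 0≤ε 0≤ε)) (ring₂ c))
    where
    0≤1-δ = ≤⇒0≤- δ≤1
    ring₁ : ∀ δ → (1ℚ + δ) * ((1ℚ + δ) * (1ℚ + δ)) + (fromℕ 3 * (δ * (1ℚ - δ)) + δ * ((1ℚ - δ) * (1ℚ + δ)) + δ)
            ≡ 1ℚ + fromℕ 8 * δ
    ring₁ = solve-∀ ℚ-ring
    ring₂ : ∀ c → let ε = ½ * (1ℚ - c) in
      1ℚ + fromℕ 8 * (½ * (½ * (½ * (ε * ε)))) + (1ℚ - c) * (ε * ε) ≡ (1ℚ - c * ε) * (1ℚ + ε)
    ring₂ = solve-∀ ℚ-ring

  -- Bernoulli gives tδ ≤ (1 + δ)ᵗ, and σ, D are the inverses of 1 + δ and δ.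
  t*σᵗ≤D : ∀ t → fromℕ t * σ ^ t ≤ D
  t*σᵗ≤D t = begin
    fromℕ t * σ ^ t                            ≡⟨ ring₁ (fromℕ t) (σ ^ t) ⟩
    fromℕ t * 1ℚ * σ ^ t                       ≡⟨ cong (λ u → fromℕ t * u * σ ^ t) δD≡1 ⟨
    fromℕ t * (δ * D) * σ ^ t                  ≡⟨ ring₂ (fromℕ t) δ D (σ ^ t) ⟩
    fromℕ t * δ * (D * σ ^ t)                  ≤⟨ *-monoʳ-≤ (0≤* 0≤D (0≤-^ t 0≤σ)) (≤-by {fromℕ t * δ} 1ℚ 0≤1 (+-comm (fromℕ t * δ) 1ℚ)) ⟩
    (1ℚ + fromℕ t * δ) * (D * σ ^ t)           ≤⟨ *-monoʳ-≤ (0≤* 0≤D (0≤-^ t 0≤σ)) (bernoulli t (≤-trans (≤-by 1ℚ 0≤1 refl) 0≤δ)) ⟩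
    (1ℚ + δ) ^ t * (D * σ ^ t)                 ≡⟨ ring₃ ((1ℚ + δ) ^ t) D (σ ^ t) ⟩
    D * ((1ℚ + δ) ^ t * σ ^ t)                 ≡⟨ cong (D *_) (^-distrib-* (1ℚ + δ) σ t) ⟨
    D * ((1ℚ + δ) * σ) ^ t                     ≡⟨ cong (λ u → D * u ^ t) [1+δ]σ≡1 ⟩
    D * 1ℚ ^ t                                 ≡⟨ trans (cong (D *_) (1^k≡1 t)) (*-identityʳ D) ⟩
    D                                          ∎
    where
    open ≤-Reasoning
    ring₁ : ∀ t s → t * s ≡ t * 1ℚ * s
    ring₁ = solve-∀ ℚ-ring
    ring₂ : ∀ t d e s → t * (d * e) * s ≡ t * d * (e * s)
    ring₂ = solve-∀ ℚ-ring
    ring₃ : ∀ a d s → a * (d * s) ≡ d * (a * s)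
    ring₃ = solve-∀ ℚ-ring

  -- The finite geometric series in exact form; the step is (1 + δ)σ = 1.
  geometric : ∀ n → δ * ∑< n (λ k → σ ^ (n ℕ.∸ k)) + σ ^ n ≡ 1ℚ
  geometric zero    = ring δ
    where
    ring : ∀ δ → δ * 0ℚ + 1ℚ ≡ 1ℚ
    ring = solve-∀ ℚ-ring
  geometric (suc n) = begin
    δ * (σ * σ ^ n + S) + σ * σ ^ n          ≡⟨ ring δ σ (σ ^ n) S ⟩
    δ * S + (1ℚ + δ) * σ * σ ^ n             ≡⟨ cong (λ u → δ * S + u * σ ^ n) [1+δ]σ≡1 ⟩
    δ * S + 1ℚ * σ ^ n                       ≡⟨ cong (_+_ (δ * S)) (*-identityˡ (σ ^ n)) ⟩
    δ * S + σ ^ n                            ≡⟨ geometric n ⟩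
    1ℚ                                       ∎
    where
    open ≡-Reasoning
    S = ∑< n (λ k → σ ^ (n ℕ.∸ k))
    ring : ∀ d s a S → d * (s * a + S) + s * a ≡ d * S + (1ℚ + d) * s * a
    ring = solve-∀ ℚ-ring

  ∑σ≤D : ∀ n → ∑< n (λ k → σ ^ (n ℕ.∸ k)) ≤ D
  ∑σ≤D n = *-cancelˡ-≤ 0<δ (≤-trans (≤-by (σ ^ n) (0≤-^ n 0≤σ) (geometric n)) (≤-reflexive (sym δD≡1)))

  -- Markov's exponential inequality before averaging: the indicator of t ≤ e is at most ξ to the
  -- power e - t, with η = 1/ξ carrying the negative part.
  χ≤exponential : ∀ {e t} (d : Dec (t ℕ.≤ e)) → χ d ≤ ξ ^ e * η ^ t
  χ≤exponential {e} {t} (no _)    = 0≤* (0≤-^ e 0≤ξ) (0≤-^ t 0≤η)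
  χ≤exponential {e} {t} (yes t≤e) = begin
    1ℚ                                   ≤⟨ 1≤-^ (e ℕ.∸ t) (1≤1+ 0≤ε) ⟩
    ξ ^ (e ℕ.∸ t)                        ≡⟨ *-identityʳ (ξ ^ (e ℕ.∸ t)) ⟨
    ξ ^ (e ℕ.∸ t) * 1ℚ                   ≡⟨ cong (ξ ^ (e ℕ.∸ t) *_) (trans (cong (_^ t) ξη≡1) (1^k≡1 t)) ⟨
    ξ ^ (e ℕ.∸ t) * (ξ * η) ^ t          ≡⟨ cong (ξ ^ (e ℕ.∸ t) *_) (^-distrib-* ξ η t) ⟩
    ξ ^ (e ℕ.∸ t) * (ξ ^ t * η ^ t)      ≡⟨ *-assoc (ξ ^ (e ℕ.∸ t)) (ξ ^ t) (η ^ t) ⟨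
    ξ ^ (e ℕ.∸ t) * ξ ^ t * η ^ t        ≡⟨ cong (_* η ^ t) (^-homo-* ξ (e ℕ.∸ t) t) ⟨
    ξ ^ (e ℕ.∸ t ℕ.+ t) * η ^ t          ≡⟨ cong (λ k → ξ ^ k * η ^ t) (ℕ.m∸n+n≡m t≤e) ⟩
    ξ ^ e * η ^ t                        ∎
    where open ≤-Reasoning

  module _ {n : ℕ} {x : ℚ} (0≤x : 0ℚ ≤ x) (x≤1 : x ≤ 1ℚ) (xn≡1 : x * fromℕ n ≡ 1ℚ) where

    μ : Functional (Fin n)
    μ = mean n x 0≤x

    -- The generating function of a binomial variable: each of the m cars independently prefers a
    -- spot from k on with probability (n - k)/n.
    mean-ξ^#≥ : ∀ k → k ℕ.≤ n → ∀ m → ⟨ μ ⊗ m ⟩ (λ π → ξ ^ #≥ k π) ≡ (1ℚ + fromℕ (n ℕ.∸ k) * (ε * x)) ^ m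
    mean-ξ^#≥ k k≤n zero    = refl
    mean-ξ^#≥ k k≤n (suc m) = begin
      ⟨ μ ⟩ (λ v → ⟨ μ ⊗ m ⟩ (λ π → ξ ^ (bit (k ℕ.<ᵇ suc (toℕ v)) ℕ.+ #≥ k π)))
        ≡⟨ ⟨⟩-cong μ (λ v → trans (⟨⟩-cong (μ ⊗ m) (λ π → trans (^-homo-* ξ (bit (k ℕ.<ᵇ suc (toℕ v))) (#≥ k π))
                                       (cong (_* ξ ^ #≥ k π) (ξ^bit (toℕ v)))))
             (trans (⟨⟩-* (μ ⊗ m) (1ℚ + ε * χ (k ℕ.≤? toℕ v)) (λ π → ξ ^ #≥ k π)) (cong ((1ℚ + ε * χ (k ℕ.≤? toℕ v)) *_) (mean-ξ^#≥ k k≤n m)))) ⟩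
      ⟨ μ ⟩ (λ v → (1ℚ + ε * χ (k ℕ.≤? toℕ v)) * q ^ m)
        ≡⟨ ⟨⟩-*ʳ μ (λ v → 1ℚ + ε * χ (k ℕ.≤? toℕ v)) (q ^ m) ⟩
      ⟨ μ ⟩ (λ v → 1ℚ + ε * χ (k ℕ.≤? toℕ v)) * q ^ m
        ≡⟨ cong (_* q ^ m) (trans (⟨⟩-+ μ (λ _ → 1ℚ) (λ v → ε * χ (k ℕ.≤? toℕ v)))
             (cong₂ _+_ (mean-1 {n} 0≤x xn≡1) (trans (⟨⟩-* μ ε (λ v → χ (k ℕ.≤? toℕ v))) (cong (ε *_) (mean-≥ 0≤x xn≡1 k k≤n))))) ⟩
      (1ℚ + ε * (fromℕ (n ℕ.∸ k) * x)) * q ^ m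
        ≡⟨ cong (λ u → (1ℚ + u) * q ^ m) (ring ε (fromℕ (n ℕ.∸ k)) x) ⟩
      q * q ^ m ∎
      where
      open ≡-Reasoning
      q = 1ℚ + fromℕ (n ℕ.∸ k) * (ε * x)
      ring : ∀ e t x → e * (t * x) ≡ t * (e * x)
      ring = solve-∀ ℚ-ring
      ring₁ : ∀ e → (1ℚ + e) * 1ℚ ≡ 1ℚ + e * 1ℚ
      ring₁ = solve-∀ ℚ-ring
      ring₂ : ∀ e → 1ℚ ≡ 1ℚ + e * 0ℚ
      ring₂ = solve-∀ ℚ-ring
      ξ^bit : ∀ v → ξ ^ bit (k ℕ.<ᵇ suc v) ≡ 1ℚ + ε * χ (k ℕ.≤? v)
      ξ^bit v with k ℕ.≤? v
      ... | yes k≤v rewrite bit-≤ k≤v = ring₁ ε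
      ... | no  k≰v rewrite bit-> (ℕ.≰⇒> k≰v) = ring₂ ε

    module _ (m : ℕ) (mx≤c : fromℕ m * x ≤ c) where

      Y : ℚ
      Y = (1ℚ + ε * x) ^ m

      0≤εx : 0ℚ ≤ ε * x
      0≤εx = 0≤* 0≤ε 0≤x

      εx≤1 : ε * x ≤ 1ℚ
      εx≤1 = *-mono-≤ 0≤ε 0≤1 ε≤1 x≤1

      0≤Y : 0ℚ ≤ Y
      0≤Y = 0≤-^ m (0≤+ 0≤1 0≤εx)

      -- An upper bound on Y, roughly the exponential of cε, through its reciprocal: Bernoulli gives
      -- 1 - cε ≤ (1 - εx)ᵐ, and (1 + εx)(1 - εx) ≤ 1.
      Y[1-cε]≤1 : Y * (1ℚ - c * ε) ≤ 1ℚ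
      Y[1-cε]≤1 = begin
        Y * (1ℚ - c * ε)                         ≤⟨ *-monoˡ-≤ 0≤Y (≤-by ((c - fromℕ m * x) * ε) (0≤* (≤⇒0≤- mx≤c) 0≤ε) (ring₁ c (fromℕ m) x ε)) ⟩
        Y * (1ℚ + fromℕ m * - (ε * x))           ≤⟨ *-monoˡ-≤ 0≤Y (bernoulli m (neg-antimono-≤ εx≤1)) ⟩
        Y * (1ℚ + - (ε * x)) ^ m                 ≡⟨ ^-distrib-* (1ℚ + ε * x) (1ℚ + - (ε * x)) m ⟨
        ((1ℚ + ε * x) * (1ℚ + - (ε * x))) ^ m    ≤⟨ ^-≤1 m (0≤* (0≤+ 0≤1 0≤εx) (≤⇒0≤- εx≤1))
                                                        (≤-by (ε * x * (ε * x)) (0≤* 0≤εx 0≤εx) (ring₂ (ε * x))) ⟩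
        1ℚ                                       ∎
        where
        open ≤-Reasoning
        ring₁ : ∀ c m x e → 1ℚ - c * e + (c - m * x) * e ≡ 1ℚ + m * - (e * x)
        ring₁ = solve-∀ ℚ-ring
        ring₂ : ∀ u → (1ℚ + u) * (1ℚ + - u) + u * u ≡ 1ℚ
        ring₂ = solve-∀ ℚ-ring

      -- The decay gained per spot: Yη is at most the inverse of (1 - cε)ξ, and `[1+δ]³≤` bounds
      -- that product from below.
      Yη≤σ³ : Y * η ≤ σ * (σ * σ)
      Yη≤σ³ = begin
        Y * η                                                           ≡⟨ trans (ring₀ (Y * η)) (cong (λ u → Y * η * (u * (u * u))) (sym [1+δ]σ≡1)) ⟩
        Y * η * ((1ℚ + δ) * σ * ((1ℚ + δ) * σ * ((1ℚ + δ) * σ)))        ≡⟨ ring₁ (Y * η) (1ℚ + δ) σ ⟩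
        Y * η * ((1ℚ + δ) * ((1ℚ + δ) * (1ℚ + δ))) * (σ * (σ * σ))      ≤⟨ *-monoʳ-≤ 0≤σ³ (*-monoˡ-≤ (0≤* 0≤Y 0≤η) [1+δ]³≤) ⟩
        Y * η * ((1ℚ - c * ε) * ξ) * (σ * (σ * σ))                      ≡⟨ ring₂ Y η (1ℚ - c * ε) ξ (σ * (σ * σ)) ⟩
        Y * (1ℚ - c * ε) * (ξ * η) * (σ * (σ * σ))                      ≡⟨ cong (λ u → Y * (1ℚ - c * ε) * u * (σ * (σ * σ))) ξη≡1 ⟩
        Y * (1ℚ - c * ε) * 1ℚ * (σ * (σ * σ))                           ≤⟨ *-monoʳ-≤ 0≤σ³ (*-monoʳ-≤ 0≤1 Y[1-cε]≤1) ⟩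
        1ℚ * (σ * (σ * σ))                                              ≡⟨ *-identityˡ (σ * (σ * σ)) ⟩
        σ * (σ * σ)                                                     ∎
        where
        open ≤-Reasoning
        0≤σ³ = 0≤* 0≤σ (0≤* 0≤σ 0≤σ)
        ring₀ : ∀ a → a ≡ a * (1ℚ * (1ℚ * 1ℚ))
        ring₀ = solve-∀ ℚ-ring
        ring₁ : ∀ a d s → a * (d * s * (d * s * (d * s))) ≡ a * (d * (d * d)) * (s * (s * s))
        ring₁ = solve-∀ ℚ-ring
        ring₂ : ∀ y h u k s → y * h * (u * k) * s ≡ y * u * (k * h) * s
        ring₂ = solve-∀ ℚ-ring

      -- The event forces t ≤ `#≥ k π` + l, so the exponential bound is ξˡηᵗ times the generating
      -- function (1 + tεx)ᵐ. Bernoulli bounds the latter by (1 + εx) to the power tm, that is Yᵗ,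
      -- and everything but ξˡ becomes a t-th power with base Yη.
      tail-probability : ∀ l k → k ℕ.≤ n → let t = n ℕ.∸ k in
        ⟨ μ ⊗ m ⟩ (λ π → χ (n ℕ.<? #≥ k π ℕ.+ k ℕ.+ l)) ≤ ξ ^ l * (σ ^ t * (σ ^ t * σ ^ t))
      tail-probability l k k≤n = begin
        ⟨ μ ⊗ m ⟩ (λ π → χ (n ℕ.<? #≥ k π ℕ.+ k ℕ.+ l))
          ≤⟨ ⟨⟩-mono-≤ (μ ⊗ m) chernoff ⟩
        ⟨ μ ⊗ m ⟩ (λ π → ξ ^ l * η ^ t * ξ ^ #≥ k π)
          ≡⟨ trans (⟨⟩-* (μ ⊗ m) (ξ ^ l * η ^ t) (λ π → ξ ^ #≥ k π)) (cong (ξ ^ l * η ^ t *_) (mean-ξ^#≥ k k≤n m)) ⟩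
        ξ ^ l * η ^ t * (1ℚ + fromℕ t * (ε * x)) ^ m
          ≤⟨ *-monoˡ-≤ (0≤* (0≤-^ l 0≤ξ) (0≤-^ t 0≤η)) (^-monoˡ-≤ m (0≤+ 0≤1 (0≤* (0≤fromℕ t) 0≤εx))
               (bernoulli t (≤-trans (≤-by 1ℚ 0≤1 refl) 0≤εx))) ⟩
        ξ ^ l * η ^ t * ((1ℚ + ε * x) ^ t) ^ m
          ≡⟨ cong (ξ ^ l * η ^ t *_) (trans (^-assocʳ (1ℚ + ε * x) t m) (trans (cong ((1ℚ + ε * x) ^_) (ℕ.*-comm t m)) (sym (^-assocʳ (1ℚ + ε * x) m t)))) ⟩
        ξ ^ l * η ^ t * Y ^ t
          ≡⟨ trans (ring (ξ ^ l) (η ^ t) (Y ^ t)) (cong (ξ ^ l *_) (sym (^-distrib-* Y η t))) ⟩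
        ξ ^ l * (Y * η) ^ t
          ≤⟨ *-monoˡ-≤ (0≤-^ l 0≤ξ) (^-monoˡ-≤ t (0≤* 0≤Y 0≤η) Yη≤σ³) ⟩
        ξ ^ l * (σ * (σ * σ)) ^ t
          ≡⟨ cong (ξ ^ l *_) (trans (^-distrib-* σ (σ * σ) t) (cong (σ ^ t *_) (^-distrib-* σ σ t))) ⟩
        ξ ^ l * (σ ^ t * (σ ^ t * σ ^ t)) ∎
        where
        open ≤-Reasoning
        t = n ℕ.∸ k
        ring : ∀ a h y → a * h * y ≡ a * (y * h)
        ring = solve-∀ ℚ-ring
        ring₂ : ∀ a b h → a * b * h ≡ b * h * a
        ring₂ = solve-∀ ℚ-ring
        swap-+ : ∀ a k l → a ℕ.+ k ℕ.+ l ≡ a ℕ.+ l ℕ.+ k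
        swap-+ = ℕ-solve-∀
        chernoff : ∀ π → χ (n ℕ.<? #≥ k π ℕ.+ k ℕ.+ l) ≤ ξ ^ l * η ^ t * ξ ^ #≥ k π
        chernoff π = begin
          χ (n ℕ.<? #≥ k π ℕ.+ k ℕ.+ l)          ≤⟨ χ-mono (n ℕ.<? #≥ k π ℕ.+ k ℕ.+ l) (t ℕ.≤? #≥ k π ℕ.+ l)
                                                       (λ n< → ℕ.m≤n+o⇒m∸n≤o n k
                                                         (ℕ.≤-trans (ℕ.<⇒≤ n<) (ℕ.≤-reflexive (trans (swap-+ (#≥ k π) k l) (ℕ.+-comm (#≥ k π ℕ.+ l) k))))) ⟩
          χ (t ℕ.≤? #≥ k π ℕ.+ l)                ≤⟨ χ≤exponential (t ℕ.≤? #≥ k π ℕ.+ l) ⟩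
          ξ ^ (#≥ k π ℕ.+ l) * η ^ t             ≡⟨ cong (_* η ^ t) (^-homo-* ξ (#≥ k π) l) ⟩
          ξ ^ #≥ k π * ξ ^ l * η ^ t             ≡⟨ ring₂ (ξ ^ #≥ k π) (ξ ^ l) (η ^ t) ⟩
          ξ ^ l * η ^ t * ξ ^ #≥ k π             ∎
          where
          χ-mono : ∀ {P Q : Set} (d : Dec P) (e : Dec Q) → (P → Q) → χ d ≤ χ e
          χ-mono (yes p) e f = ≤-reflexive (sym (χ-yes e (f p)))
          χ-mono (no _)  e f = 0≤χ e

      -- The default barrier n has gap 0 and contributes nothing; each k < n is charged its tail
      -- probability. Once t² is absorbed, a geometric series remains. The bound depends on c and l
      -- alone.
      second-moment : ∀ l → let K = λ (π : Vec (Fin n) m) → fromℕ (n ℕ.∸ barrier l π) in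
        ⟨ μ ⊗ m ⟩ (λ π → K π * K π) ≤ ξ ^ l * (D * D * D)
      second-moment l = begin
        ⟨ μ ⊗ m ⟩ (λ π → f (barrier l π))
          ≤⟨ ⟨⟩-mono-≤ (μ ⊗ m) (λ π → ≤-∑-first (λ k → n ℕ.<? #≥ k π ℕ.+ k ℕ.+ l) n f 0≤f) ⟩
        ⟨ μ ⊗ m ⟩ (λ π → f n + ∑< n (λ k → f k * χ (n ℕ.<? #≥ k π ℕ.+ k ℕ.+ l)))
          ≡⟨ ⟨⟩-cong (μ ⊗ m) (λ π → trans (cong (_+ ∑< n (λ k → f k * χ (n ℕ.<? #≥ k π ℕ.+ k ℕ.+ l))) f-n) (+-identityˡ _)) ⟩
        ⟨ μ ⊗ m ⟩ (λ π → ∑< n (λ k → f k * χ (n ℕ.<? #≥ k π ℕ.+ k ℕ.+ l)))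
          ≡⟨ ⟨⟩-∑ℚ-comm (μ ⊗ m) {n} (λ π k → f (toℕ k) * χ (n ℕ.<? #≥ (toℕ k) π ℕ.+ toℕ k ℕ.+ l)) ⟩
        ∑ℚ {n} (λ k → ⟨ μ ⊗ m ⟩ (λ π → f (toℕ k) * χ (n ℕ.<? #≥ (toℕ k) π ℕ.+ toℕ k ℕ.+ l)))
          ≤⟨ ⟨⟩-mono-≤ (∑ᶠ n) (λ k → ≤-trans
               (≤-reflexive (⟨⟩-* (μ ⊗ m) (f (toℕ k)) (λ π → χ (n ℕ.<? #≥ (toℕ k) π ℕ.+ toℕ k ℕ.+ l))))
               (bound (toℕ k) (ℕ.<⇒≤ (Fin.toℕ<n k)))) ⟩
        ∑< n (λ k → ξ ^ l * (D * D) * σ ^ (n ℕ.∸ k))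
          ≡⟨ ∑ℚ-* {n} (ξ ^ l * (D * D)) (λ k → σ ^ (n ℕ.∸ toℕ k)) ⟩
        ξ ^ l * (D * D) * ∑< n (λ k → σ ^ (n ℕ.∸ k))
          ≤⟨ *-monoˡ-≤ (0≤* (0≤-^ l 0≤ξ) (0≤* 0≤D 0≤D)) (∑σ≤D n) ⟩
        ξ ^ l * (D * D) * D
          ≡⟨ *-assoc (ξ ^ l) (D * D) D ⟩
        ξ ^ l * (D * D * D) ∎
        where
        open ≤-Reasoning
        f : ℕ → ℚ
        f k = fromℕ (n ℕ.∸ k) * fromℕ (n ℕ.∸ k)
        0≤f : ∀ k → 0ℚ ≤ f k
        0≤f k = 0≤* (0≤fromℕ (n ℕ.∸ k)) (0≤fromℕ (n ℕ.∸ k))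
        f-n : f n ≡ 0ℚ
        f-n = trans (cong (λ d → fromℕ d * fromℕ d) (ℕ.n∸n≡0 n)) (*-zeroˡ 0ℚ)
        ring : ∀ t a s → t * t * (a * (s * (s * s))) ≡ a * (t * s * (t * s)) * s
        ring = solve-∀ ℚ-ring
        bound : ∀ k → k ℕ.≤ n → f k * ⟨ μ ⊗ m ⟩ (λ π → χ (n ℕ.<? #≥ k π ℕ.+ k ℕ.+ l)) ≤ ξ ^ l * (D * D) * σ ^ (n ℕ.∸ k)
        bound k k≤n = let t = n ℕ.∸ k ; 0≤tσ = 0≤* (0≤fromℕ t) (0≤-^ t 0≤σ) in begin
          f k * ⟨ μ ⊗ m ⟩ (λ π → χ (n ℕ.<? #≥ k π ℕ.+ k ℕ.+ l))    ≤⟨ *-monoˡ-≤ (0≤f k) (tail-probability l k k≤n) ⟩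
          f k * (ξ ^ l * (σ ^ t * (σ ^ t * σ ^ t)))                ≡⟨ ring (fromℕ t) (ξ ^ l) (σ ^ t) ⟩
          ξ ^ l * (fromℕ t * σ ^ t * (fromℕ t * σ ^ t)) * σ ^ t    ≤⟨ *-monoʳ-≤ (0≤-^ t 0≤σ) (*-monoˡ-≤ (0≤-^ l 0≤ξ) (*-mono-≤ 0≤tσ 0≤D (t*σᵗ≤D t) (t*σᵗ≤D t))) ⟩
          ξ ^ l * (D * D) * σ ^ t                                  ∎

-- The mean gap behind the barrier

*-cancelʳ-≡ : ∀ {a b r} → 0ℚ < r → a * r ≡ b * r → a ≡ b
*-cancelʳ-≡ {r = r} 0<r ar≡br = ≤-antisym
  (*-cancelʳ-≤-pos r {{positive 0<r}} (≤-reflexive ar≡br))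
  (*-cancelʳ-≤-pos r {{positive 0<r}} (≤-reflexive (sym ar≡br)))

-- For a single added car the criterion is exact, as one car never forms a pair.
good-∷ : ∀ {n m} (v : Fin n) (π : Vec (Fin n) m) →
  χ (good? n (v ∷ π)) ≡ χ (good? n π) * χ (toℕ v ℕ.<? barrier 1 π)
good-∷ {n} v π with good? n π
... | no ¬good = trans (χ-no (good? n (v ∷ π)) (¬good ∘ good-++⇒good (v ∷ []) π)) (sym (*-zeroˡ (χ (toℕ v ℕ.<? barrier 1 π))))
... | yes good = trans
  (χ-⇔ (good? n (v ∷ π)) (toℕ v ℕ.<? barrier 1 π) (mk⇔
    (λ g → good-++⇒<barrier (v ∷ []) π g zero)
    (λ v< → <barrier⇒good-++ (v ∷ []) π good (#≥-≤ (barrier 1 π) (v ∷ [])) λ { zero → v< })))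
  (sym (*-identityˡ (χ (toℕ v ℕ.<? barrier 1 π))))

-- Double counting: a parking function of m + 1 cars is one of m cars together with an admissible
-- preference for the extra car, and `barrier 1 π` is the number of these.
∑PF-barrier : ∀ n m → ∑PF n m (λ π → fromℕ (barrier 1 π)) ≡ #PF n (suc m)
∑PF-barrier n m = sym (begin
  ∑ℚ (λ v → ⟨ ∑ᶠ n ⊗ m ⟩ (λ π → χ (good? n (v ∷ π))))
    ≡⟨ ⟨⟩-∑ℚ-comm (∑ᶠ n ⊗ m) (λ π v → χ (good? n (v ∷ π))) ⟨
  ⟨ ∑ᶠ n ⊗ m ⟩ (λ π → ∑ℚ (λ v → χ (good? n (v ∷ π))))
    ≡⟨ ⟨⟩-cong (∑ᶠ n ⊗ m) (λ π → trans (∑ℚ-cong {n} (λ v → good-∷ v π))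
         (trans (∑ℚ-* {n} (χ (good? n π)) (λ v → χ (toℕ v ℕ.<? barrier 1 π))) (cong (χ (good? n π) *_) (count π)))) ⟩
  ∑PF n m (λ π → fromℕ (barrier 1 π)) ∎)
  where
  open ≡-Reasoning
  count : ∀ π → ∑< n (λ v → χ (v ℕ.<? barrier 1 π)) ≡ fromℕ (barrier 1 π)
  count π = trans (∑ℚ-cong {n} (λ v → sym (*-identityˡ (χ (toℕ v ℕ.<? barrier 1 π)))))
    (trans (∑<-truncate n (barrier 1 π) (barrier-≤ 1 π) (λ _ → 1ℚ))
      (trans (∑ℚ-const (barrier 1 π) 1ℚ) (*-identityʳ (fromℕ (barrier 1 π)))))

-- The mean barrier is the ratio of consecutive counts, (n + 1)(n - m)/(n + 1 - m); subtracting it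
-- from n leaves m/(n + 1 - m).
∑PF-gap : ∀ n m → m ℕ.≤ n →
  ∑PF n m (λ π → fromℕ (n ℕ.∸ barrier 1 π)) * (fromℕ (suc n) - fromℕ m) ≡ fromℕ m * #PF n m
∑PF-gap n m m≤n = *-cancelʳ-≡ {r = y} 0<y (begin
  ∑PF n m (λ π → fromℕ (n ℕ.∸ barrier 1 π)) * (y - fromℕ m) * y
    ≡⟨ cong (λ g → g * (y - fromℕ m) * y) gap ⟩
  (fromℕ n * #PF n m - #PF n (suc m)) * (y - fromℕ m) * y
    ≡⟨ ring₁ (fromℕ n) (#PF n m) (#PF n (suc m)) (y - fromℕ m) y ⟩
  (fromℕ n * (#PF n m * y) - #PF n (suc m) * y) * (y - fromℕ m)
    ≡⟨ cong₂ (λ a b → (fromℕ n * a - b) * (y - fromℕ m)) (#PF-* n m (ℕ.m≤n⇒m≤1+n m≤n)) (#PF-* n (suc m) (s≤s m≤n)) ⟩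
  (fromℕ n * (y ^ m * (y - fromℕ m)) - y * y ^ m * (y - fromℕ (suc m))) * (y - fromℕ m)
    ≡⟨ cong₂ (λ y′ m′ → (fromℕ n * (y ^ m * (y - fromℕ m)) - y′ * y ^ m * (y′ - m′)) * (y - fromℕ m)) (fromℕ-suc n) (fromℕ-suc m) ⟩
  (fromℕ n * (y ^ m * (y - fromℕ m)) - (1ℚ + fromℕ n) * y ^ m * (1ℚ + fromℕ n - (1ℚ + fromℕ m))) * (y - fromℕ m)
    ≡⟨ cong (λ y′ → (fromℕ n * (y ^ m * (y′ - fromℕ m)) - (1ℚ + fromℕ n) * y ^ m * (1ℚ + fromℕ n - (1ℚ + fromℕ m))) * (y - fromℕ m)) (fromℕ-suc n) ⟩
  (fromℕ n * (y ^ m * (1ℚ + fromℕ n - fromℕ m)) - (1ℚ + fromℕ n) * y ^ m * (1ℚ + fromℕ n - (1ℚ + fromℕ m))) * (y - fromℕ m)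
    ≡⟨ ring₂ (fromℕ n) (fromℕ m) (y ^ m) (y - fromℕ m) ⟩
  fromℕ m * (y ^ m * (y - fromℕ m))
    ≡⟨ cong (fromℕ m *_) (#PF-* n m (ℕ.m≤n⇒m≤1+n m≤n)) ⟨
  fromℕ m * (#PF n m * y)
    ≡⟨ *-assoc (fromℕ m) (#PF n m) y ⟨
  fromℕ m * #PF n m * y ∎)
  where
  open ≡-Reasoning
  y = fromℕ (suc n)
  0<y : 0ℚ < y
  0<y = <-≤-trans 0<1 (fromℕ-mono-≤ {1} {suc n} (s≤s z≤n))
  ring₁ : ∀ n a b d y → (n * a - b) * d * y ≡ (n * (a * y) - b * y) * d
  ring₁ = solve-∀ ℚ-ring
  ring₂ : ∀ n m a d → (n * (a * (1ℚ + n - m)) - (1ℚ + n) * a * (1ℚ + n - (1ℚ + m))) * d ≡ m * (a * d)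
  ring₂ = solve-∀ ℚ-ring
  ring₃ : ∀ g n b → g * (n - b) ≡ n * g - g * b
  ring₃ = solve-∀ ℚ-ring
  ring₄ : ∀ a b → b ≡ a + b - a
  ring₄ = solve-∀ ℚ-ring
  fromℕ-∸ : ∀ b → b ℕ.≤ n → fromℕ (n ℕ.∸ b) ≡ fromℕ n - fromℕ b
  fromℕ-∸ b b≤n = trans (ring₄ (fromℕ b) (fromℕ (n ℕ.∸ b)))
    (cong (_- fromℕ b) (trans (sym (fromℕ-+ b (n ℕ.∸ b))) (cong fromℕ (ℕ.m+[n∸m]≡n b≤n))))
  gap : ∑PF n m (λ π → fromℕ (n ℕ.∸ barrier 1 π)) ≡ fromℕ n * #PF n m - #PF n (suc m)
  gap = begin
    ∑PF n m (λ π → fromℕ (n ℕ.∸ barrier 1 π))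
      ≡⟨ ⟨⟩-cong (∑ᶠ n ⊗ m) (λ π → trans (cong (χ (good? n π) *_) (fromℕ-∸ (barrier 1 π) (barrier-≤ 1 π)))
           (ring₃ (χ (good? n π)) (fromℕ n) (fromℕ (barrier 1 π)))) ⟩
    ⟨ ∑ᶠ n ⊗ m ⟩ (λ π → fromℕ n * χ (good? n π) - χ (good? n π) * fromℕ (barrier 1 π))
      ≡⟨ trans (⟨⟩-- (∑ᶠ n ⊗ m) _ _) (cong₂ _-_ (⟨⟩-* (∑ᶠ n ⊗ m) (fromℕ n) (λ π → χ (good? n π))) (∑PF-barrier n m)) ⟩
    fromℕ n * #PF n m - #PF n (suc m) ∎

lookup-++-inject≤ : ∀ {n l m} (a : Vec (Fin n) l) (π : Vec (Fin n) m) (l≤ : l ℕ.≤ l ℕ.+ m) i →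
  lookup (a ++ π) (inject≤ i l≤) ≡ lookup a i
lookup-++-inject≤ (v ∷ a) π l≤ zero    = refl
lookup-++-inject≤ (v ∷ a) π l≤ (suc i) = lookup-++-inject≤ a π (ℕ.s≤s⁻¹ l≤) i

fromℕ-∏ : ∀ {l} (f : Fin l → ℕ) → fromℕ (∏[ i < l ] f i) ≡ ∏ℚ (λ i → fromℕ (f i))
fromℕ-∏ {zero}  f = refl
fromℕ-∏ {suc l} f = trans (fromℕ-* (f zero) (∏[ i < l ] f (suc i))) (cong (fromℕ (f zero) *_) (fromℕ-∏ (f ∘ suc)))

∏-^ : ∀ {l} x (p : Fin l → ℕ) → ∏ℚ (λ i → x ^ p i) ≡ x ^ (∑[ i < l ] p i)
∏-^ {zero}  x p = refl
∏-^ {suc l} x p = trans (cong (x ^ p zero *_) (∏-^ x (p ∘ suc))) (sym (^-homo-* x (p zero) (∑[ i < l ] p (suc i))))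

∑-fromℕ-suc : ∀ {l} (p : Fin l → ℕ) → ∑ℚ (λ i → fromℕ (suc (p i))) ≡ fromℕ (∑[ i < l ] p i) + fromℕ l
∑-fromℕ-suc {zero}  p = refl
∑-fromℕ-suc {suc l} p = begin
  fromℕ (suc (p zero)) + ∑ℚ (λ i → fromℕ (suc (p (suc i))))
    ≡⟨ cong₂ _+_ (fromℕ-suc (p zero)) (∑-fromℕ-suc (p ∘ suc)) ⟩
  1ℚ + fromℕ (p zero) + (fromℕ P + fromℕ l)
    ≡⟨ ring (fromℕ (p zero)) (fromℕ P) (fromℕ l) ⟩
  fromℕ (p zero) + fromℕ P + (1ℚ + fromℕ l)
    ≡⟨ cong₂ _+_ (fromℕ-+ (p zero) P) (fromℕ-suc l) ⟨
  fromℕ (p zero ℕ.+ P) + fromℕ (suc l) ∎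
  where
  open ≡-Reasoning
  P = ∑[ i < l ] p (suc i)
  ring : ∀ a b c → 1ℚ + a + (b + c) ≡ a + b + (1ℚ + c)
  ring = solve-∀ ℚ-ring

∑ℚ-*ʳ : ∀ {n} (f : Fin n → ℚ) c → ∑ℚ (λ v → f v * c) ≡ ∑ℚ f * c
∑ℚ-*ʳ {n} = ⟨⟩-*ʳ (∑ᶠ n)

-- The index of a uniform expansion: L will be the barrier of a particular parking function, on
-- which the constants must not depend.
record Truncation : Set where
  field
    x         : ℚ
    L K       : ℕ
    0≤x       : 0ℚ ≤ x
    x≤1       : x ≤ 1ℚ
    Lx+Kx≡1 : fromℕ L * x + fromℕ K * x ≡ 1ℚ

∏-powerSum-expansion : ∀ {l} (p : Fin l → ℕ) → (∀ i → 1 ℕ.≤ p i) → let open Truncation in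
  Expansion (λ i → (1ℚ + fromℕ (K i)) * x i)
            (λ i → ∏ℚ (λ j → powerSum (x i) (p j) (L i)))
            (λ i → ∑ℚ (λ j → fromℕ (suc (p j))) * (½ * x i - fromℕ (K i) * x i))
∏-powerSum-expansion {l} p 1≤p =
  expansion-cong (λ _ → refl) (λ i → ∑ℚ-*ʳ (λ j → fromℕ (suc (p j))) (½ * x i - fromℕ (K i) * x i))
    (expansion-∏ (λ i → 0≤* (0≤+ 0≤1 (0≤fromℕ (K i))) (0≤x i)) y≤2 (λ j → factor (p j) (1≤p j)))
  where
  open Truncation
  ring : ∀ k x → x + k * x ≡ (1ℚ + k) * x
  ring = solve-∀ ℚ-ring
  y≤2 : ∀ i → (1ℚ + fromℕ (K i)) * x i ≤ 1ℚ + 1ℚ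
  y≤2 i = ≤-trans (≤-reflexive (sym (ring (fromℕ (K i)) (x i)))) (+-mono-≤ (x≤1 i)
    (≤-by (fromℕ (L i) * x i) (0≤* (0≤fromℕ (L i)) (0≤x i)) (trans (+-comm (fromℕ (K i) * x i) (fromℕ (L i) * x i)) (Lx+Kx≡1 i))))
  factor : ∀ p → 1 ℕ.≤ p → Expansion (λ i → (1ℚ + fromℕ (K i)) * x i) (λ i → powerSum (x i) p (L i))
    (λ i → fromℕ (suc p) * (½ * x i - fromℕ (K i) * x i))
  factor (suc q) _ = powerSum-expansion x L K 0≤x x≤1 Lx+Kx≡1 q

#PF-pos : ∀ n m → m ℕ.≤ n → 0ℚ < #PF n m
#PF-pos n m m≤n = *-cancelʳ-<-nonNeg y {{nonNegative (<⇒≤ 0<y)}} (subst₂ _<_ (sym (*-zeroˡ y)) (sym (#PF-* n m (ℕ.m≤n⇒m≤1+n m≤n)))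
  (0<-* (0<-^ m 0<y) 0<y-m))
  where
  y = fromℕ (suc n)
  0<y : 0ℚ < y
  0<y = <-≤-trans 0<1 (fromℕ-mono-≤ {1} {suc n} (s≤s z≤n))
  ring : ∀ m → 1ℚ ≡ 1ℚ + m - m
  ring = solve-∀ ℚ-ring
  0<y-m : 0ℚ < y - fromℕ m
  0<y-m = <-≤-trans 0<1 (≤-trans (≤-reflexive (trans (ring (fromℕ m)) (cong (_- fromℕ m) (sym (fromℕ-suc m)))))
    (+-monoˡ-≤ (- fromℕ m) (fromℕ-mono-≤ (s≤s m≤n))))

-- The expectation

module Asymptotics {l : ℕ} (1≤l : 1 ℕ.≤ l) (p : Fin l → ℕ) (1≤p : ∀ i → 1 ℕ.≤ p i)
                   (c : ℚ) (0<c : 0ℚ < c) (c<1 : c < 1ℚ) where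

  open Tail c (<⇒≤ 0<c) c<1 using (second-moment; 0<1-c; ξ; D; 0≤ξ; 0≤D)

  0≤c : 0ℚ ≤ c
  0≤c = <⇒≤ 0<c

  ω : ℚ
  ω = proj₁ (inverse (1ℚ - c) 0<1-c)
  0≤ω : 0ℚ ≤ ω
  0≤ω = proj₁ (proj₂ (inverse (1ℚ - c) 0<1-c))
  [1-c]ω≡1 : (1ℚ - c) * ω ≡ 1ℚ
  [1-c]ω≡1 = proj₂ (proj₂ (inverse (1ℚ - c) 0<1-c))

  P : ℕ
  P = ∑[ i < l ] p i

  ℓ Q Π : ℚ
  ℓ = fromℕ l
  Q  = ∑ℚ (λ j → fromℕ (suc (p j)))
  Π  = ∏ℚ (λ j → fromℕ (suc (p j)))

  0≤Q : 0ℚ ≤ Q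
  0≤Q = ∑ℚ-nonNeg (λ j → 0≤fromℕ (suc (p j)))

  0≤Π : 0ℚ ≤ Π
  0≤Π = subst (0ℚ ≤_) (fromℕ-∏ (λ j → suc (p j))) (0≤fromℕ (∏[ j < l ] suc (p j)))

  expansion₀ = ∏-powerSum-expansion p 1≤p

  -- C₀ comes from the power sums and C₁ adds the pairs of blocking cars. T bounds the second moment
  -- of Kₗ. In C₂ the 2 is from (1 + K)² ≤ 2(1 + K²), and ω = 1/(1 - c) passes from all sequences to
  -- parking ones.
  C₀ C₁ T C₂ : ℚ
  C₀ = Expansion.C expansion₀
  C₁ = Π * fromℕ (pairCount l) + C₀
  T  = ξ ^ l * (D * D * D)
  C₂ = C₁ * ((1ℚ + 1ℚ) * (1ℚ + T * ω))

  0≤C₀ : 0ℚ ≤ C₀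
  0≤C₀ = Expansion.0≤C expansion₀
  0≤C₁ : 0ℚ ≤ C₁
  0≤C₁ = 0≤+ (0≤* 0≤Π (0≤fromℕ (pairCount l))) 0≤C₀
  0≤T : 0ℚ ≤ T
  0≤T = 0≤* (0≤-^ l 0≤ξ) (0≤* (0≤* 0≤D 0≤D) 0≤D)
  0≤C₂ : 0ℚ ≤ C₂
  0≤C₂ = 0≤* 0≤C₁ (0≤* (0≤fromℕ 2) (0≤+ 0≤1 (0≤* 0≤T 0≤ω)))

  -- The index of the final expansion: everything that varies once c, l and p are fixed.
  record Street : Set where
    field
      n M  : ℕ
      x    : ℚ
      0<x  : 0ℚ < x
      x≤1  : x ≤ 1ℚ
      xn≡1 : x * fromℕ n ≡ 1ℚ
      m≡cn : fromℕ (l ℕ.+ M) ≡ c * fromℕ n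

  module Scaled (street : Street) where
    open Street street

    m : ℕ
    m = l ℕ.+ M

    0≤x : 0ℚ ≤ x
    0≤x = <⇒≤ 0<x

    y : ℚ
    y = fromℕ (suc n)

    0<y : 0ℚ < y
    0<y = <-≤-trans 0<1 (fromℕ-mono-≤ {1} {suc n} (s≤s z≤n))

    M≡m-l : fromℕ M ≡ fromℕ m - ℓ
    M≡m-l = trans (ring (fromℕ l) (fromℕ M)) (cong (_- ℓ) (sym (fromℕ-+ l M)))
      where
      ring : ∀ a b → b ≡ a + b - a
      ring = solve-∀ ℚ-ring

    m≤n : m ℕ.≤ n
    m≤n = fromℕ-cancel-≤ (≤-trans (≤-reflexive m≡cn)
      (≤-trans (*-monoʳ-≤ (0≤fromℕ n) (<⇒≤ c<1)) (≤-reflexive (*-identityˡ (fromℕ n)))))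

    M≤n : M ℕ.≤ n
    M≤n = ℕ.≤-trans (ℕ.m≤n+m M l) m≤n

    mx≡c : fromℕ m * x ≡ c
    mx≡c = trans (cong (_* x) m≡cn) (trans (ring c (fromℕ n) x) (trans (cong (c *_) xn≡1) (*-identityʳ c)))
      where
      ring : ∀ c n x → c * n * x ≡ c * (x * n)
      ring = solve-∀ ℚ-ring

    Mx≤c : fromℕ M * x ≤ c
    Mx≤c = ≤-trans (*-monoʳ-≤ 0≤x (fromℕ-mono-≤ (ℕ.m≤n+m M l))) (≤-reflexive mx≡c)

    xy≡1+x : x * y ≡ 1ℚ + x
    xy≡1+x = trans (cong (x *_) (fromℕ-suc n)) (trans (ring x (fromℕ n)) (cong (_+ x) xn≡1))
      where
      ring : ∀ x n → x * (1ℚ + n) ≡ x * n + x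
      ring = solve-∀ ℚ-ring

    x[y-m] : x * (y - fromℕ m) ≡ 1ℚ - c + x
    x[y-m] = trans (ring₁ x y (fromℕ m)) (trans (cong₂ _-_ xy≡1+x mx≡c) (ring₂ x c))
      where
      ring₁ : ∀ x y m → x * (y - m) ≡ x * y - m * x
      ring₁ = solve-∀ ℚ-ring
      ring₂ : ∀ x c → 1ℚ + x - c ≡ 1ℚ - c + x
      ring₂ = solve-∀ ℚ-ring

    y-M : y - fromℕ M ≡ y - fromℕ m + ℓ
    y-M = trans (cong (λ k → y - k) M≡m-l) (ring y (fromℕ m) ℓ)
      where
      ring : ∀ y m l → y - (m - l) ≡ y - m + l
      ring = solve-∀ ℚ-ring

    0<y-m : 0ℚ < y - fromℕ m
    0<y-m = <-≤-trans 0<1 (≤-trans (≤-reflexive (trans (ring (fromℕ m)) (cong (_- fromℕ m) (sym (fromℕ-suc m)))))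
      (+-monoˡ-≤ (- fromℕ m) (fromℕ-mono-≤ (s≤s m≤n))))
      where
      ring : ∀ m → 1ℚ ≡ 1ℚ + m - m
      ring = solve-∀ ℚ-ring

    0<y-M : 0ℚ < y - fromℕ M
    0<y-M = <-≤-trans 0<y-m (≤-by ℓ (0≤fromℕ l) (sym y-M))

    -- s = 1/(n + 1 - m), κ = M/(n + 1 - M) is the mean of K₁, and u = n/(n + 1).
    s κ u : ℚ
    s = proj₁ (inverse (y - fromℕ m) 0<y-m)
    κ = fromℕ M * proj₁ (inverse (y - fromℕ M) 0<y-M)
    0<1+x : 0ℚ < 1ℚ + x
    0<1+x = <-≤-trans 0<1 (≤-by x 0≤x refl)
    u = proj₁ (inverse (1ℚ + x) 0<1+x)

    0≤s : 0ℚ ≤ s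
    0≤s = proj₁ (proj₂ (inverse (y - fromℕ m) 0<y-m))
    0≤κ : 0ℚ ≤ κ
    0≤κ = 0≤* (0≤fromℕ M) (proj₁ (proj₂ (inverse (y - fromℕ M) 0<y-M)))
    0≤u : 0ℚ ≤ u
    0≤u = proj₁ (proj₂ (inverse (1ℚ + x) 0<1+x))
    [y-m]s≡1 : (y - fromℕ m) * s ≡ 1ℚ
    [y-m]s≡1 = proj₂ (proj₂ (inverse (y - fromℕ m) 0<y-m))
    κ[y-M]≡M : κ * (y - fromℕ M) ≡ fromℕ M
    κ[y-M]≡M = trans (ring (fromℕ M) (proj₁ (inverse (y - fromℕ M) 0<y-M)) (y - fromℕ M))
      (trans (cong (fromℕ M *_) (proj₂ (proj₂ (inverse (y - fromℕ M) 0<y-M)))) (*-identityʳ (fromℕ M)))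
      where
      ring : ∀ m v d → m * v * d ≡ m * (d * v)
      ring = solve-∀ ℚ-ring
    [1+x]u≡1 : (1ℚ + x) * u ≡ 1ℚ
    [1+x]u≡1 = proj₂ (proj₂ (inverse (1ℚ + x) 0<1+x))

    -- By `x[y-m]`, s is x/(1 - c + x), while ωx is x/(1 - c); the difference is of second order.
    ωx-s : ω * x - s ≡ ω * (s * x)
    ωx-s = begin
      ω * x - s                                 ≡⟨ ring₁ ω x s ⟩
      ω * (x * 1ℚ) - s * 1ℚ                     ≡⟨ cong₂ (λ a b → ω * (x * a) - s * b) [y-m]s≡1 [1-c]ω≡1 ⟨
      ω * (x * ((y - fromℕ m) * s)) - s * ((1ℚ - c) * ω)
                                                ≡⟨ ring₂ ω x (y - fromℕ m) s (1ℚ - c) ⟩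
      ω * (s * (x * (y - fromℕ m))) - ω * (s * (1ℚ - c))
                                                ≡⟨ cong (λ a → ω * (s * a) - ω * (s * (1ℚ - c))) x[y-m] ⟩
      ω * (s * (1ℚ - c + x)) - ω * (s * (1ℚ - c)) ≡⟨ ring₃ ω s (1ℚ - c) x ⟩
      ω * (s * x)                               ∎
      where
      open ≡-Reasoning
      ring₁ : ∀ w x s → w * x - s ≡ w * (x * 1ℚ) - s * 1ℚ
      ring₁ = solve-∀ ℚ-ring
      ring₂ : ∀ w x d s c → w * (x * (d * s)) - s * (c * w) ≡ w * (s * (x * d)) - w * (s * c)
      ring₂ = solve-∀ ℚ-ring
      ring₃ : ∀ w s c x → w * (s * (c + x)) - w * (s * c) ≡ w * (s * x)
      ring₃ = solve-∀ ℚ-ring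

    s≤ωx : s ≤ ω * x
    s≤ωx = 0≤-⇒≤ (subst (0ℚ ≤_) (sym ωx-s) (0≤* 0≤ω (0≤* 0≤s 0≤x)))

    -- Multiplied by x, the equation for κ reads κ(1 - c + (1 + ℓ)x) = c - ℓx. So κ is within O(x)
    -- of its limit cω, which suffices because it enters with a factor x.
    cω-κ : c * ω - κ ≡ x * (ω * (ℓ + κ * (1ℚ + ℓ)))
    cω-κ = begin
      c * ω - κ                                            ≡⟨ ring₁ (c * ω) κ ⟩
      c * ω - κ * 1ℚ                                       ≡⟨ cong (λ a → c * ω - κ * a) [1-c]ω≡1 ⟨
      c * ω - κ * ((1ℚ - c) * ω)                           ≡⟨ ring₂ c ω κ x ℓ ⟩
      (c - κ * (1ℚ - c + x + ℓ * x) + κ * (1ℚ + ℓ) * x) * ω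
                                                           ≡⟨ cong (λ a → (c - a + κ * (1ℚ + ℓ) * x) * ω) κ-scaled ⟩
      (c - (c - ℓ * x) + κ * (1ℚ + ℓ) * x) * ω           ≡⟨ ring₃ c ℓ x κ ω ⟩
      x * (ω * (ℓ + κ * (1ℚ + ℓ)))                       ∎
      where
      open ≡-Reasoning
      ring₁ : ∀ a k → a - k ≡ a - k * 1ℚ
      ring₁ = solve-∀ ℚ-ring
      ring₂ : ∀ c w k x l → c * w - k * ((1ℚ - c) * w) ≡ (c - k * (1ℚ - c + x + l * x) + k * (1ℚ + l) * x) * w
      ring₂ = solve-∀ ℚ-ring
      ring₃ : ∀ c l x k w → (c - (c - l * x) + k * (1ℚ + l) * x) * w ≡ x * (w * (l + k * (1ℚ + l)))
      ring₃ = solve-∀ ℚ-ring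
      ring₄ : ∀ d l x → x * d + l * x ≡ x * (d + l)
      ring₄ = solve-∀ ℚ-ring
      ring₅ : ∀ k x d → k * (x * d) ≡ k * d * x
      ring₅ = solve-∀ ℚ-ring
      ring₆ : ∀ m l x → (m - l) * x ≡ m * x - l * x
      ring₆ = solve-∀ ℚ-ring
      κ-scaled : κ * (1ℚ - c + x + ℓ * x) ≡ c - ℓ * x
      κ-scaled = begin
        κ * (1ℚ - c + x + ℓ * x)               ≡⟨ cong (λ a → κ * (a + ℓ * x)) x[y-m] ⟨
        κ * (x * (y - fromℕ m) + ℓ * x)        ≡⟨ cong (κ *_) (ring₄ (y - fromℕ m) ℓ x) ⟩
        κ * (x * (y - fromℕ m + ℓ))            ≡⟨ cong (λ a → κ * (x * a)) y-M ⟨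
        κ * (x * (y - fromℕ M))                 ≡⟨ ring₅ κ x (y - fromℕ M) ⟩
        κ * (y - fromℕ M) * x                   ≡⟨ cong (_* x) κ[y-M]≡M ⟩
        fromℕ M * x                             ≡⟨ cong (_* x) M≡m-l ⟩
        (fromℕ m - ℓ) * x                      ≡⟨ ring₆ (fromℕ m) ℓ x ⟩
        fromℕ m * x - ℓ * x                    ≡⟨ cong (_- ℓ * x) mx≡c ⟩
        c - ℓ * x                              ∎

    0≤cω-κ : 0ℚ ≤ c * ω - κ
    0≤cω-κ = subst (0ℚ ≤_) (sym cω-κ) (0≤* 0≤x (0≤* 0≤ω (0≤+ (0≤fromℕ l) (0≤* 0≤κ (0≤+ 0≤1 (0≤fromℕ l))))))

    cω-κ≤ : c * ω - κ ≤ x * (ω * (ℓ + c * ω * (1ℚ + ℓ)))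
    cω-κ≤ = ≤-trans (≤-reflexive cω-κ) (*-monoˡ-≤ 0≤x (*-monoˡ-≤ 0≤ω (+-monoʳ-≤ ℓ
      (*-monoʳ-≤ {1ℚ + ℓ} {κ} {c * ω} (0≤+ 0≤1 (0≤fromℕ l)) (0≤-⇒≤ {κ} {c * ω} 0≤cω-κ)))))

    μ : Functional (Fin n)
    μ = mean n x 0≤x

    w : Fin l → ℕ → ℚ
    w j v = (fromℕ (suc v) * x) ^ p j

    prefix : Vec (Fin n) M → ℚ
    prefix π = ⟨ μ ⊗ l ⟩ (λ a → ∏ℚ (λ j → w j (toℕ (lookup a j))) * χ (good? n (a ++ π)))

    K : ℕ → Vec (Fin n) M → ℚ
    K k π = fromℕ (n ℕ.∸ barrier k π)

    0≤K : ∀ k π → 0ℚ ≤ K k π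
    0≤K k π = 0≤fromℕ (n ℕ.∸ barrier k π)

    first-order : Vec (Fin n) M → ℚ
    first-order π = 1ℚ + Q * (½ * x - K 1 π * x)

    -- The factor Π clears the denominators pⱼ + 1. The pair error and the power sum error are both
    -- at most a constant times ((1 + Kₗ)x)², since K₁ ≤ Kₗ for l ≥ 1.
    ∣Πprefix-first-order∣≤ : ∀ π → Good n π →
      ∣ Π * prefix π - first-order π ∣ ≤ C₁ * ((1ℚ + 1ℚ) * (x * x) * (1ℚ + K l π * K l π))
    ∣Πprefix-first-order∣≤ π good = begin
      ∣ Π * prefix π - first-order π ∣
        ≡⟨ cong ∣_∣ (trans (ring₁ Π (prefix π) (∏ℚ (λ j → x * ∑< b (w j))) (first-order π))
             (cong (λ a → Π * (prefix π - ∏ℚ (λ j → x * ∑< b (w j))) + (a - first-order π))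
               (sym (∏-distrib-* (λ j → fromℕ (suc (p j))) (λ j → x * ∑< b (w j)))))) ⟩
      ∣ Π * (prefix π - ∏ℚ (λ j → x * ∑< b (w j))) + (∏ℚ (λ j → powerSum x (p j) b) - first-order π) ∣
        ≤⟨ ∣+∣≤ (∣*∣≤ (0≤⇒∣∣≤ 0≤Π ≤-refl) (mean-prefix {n} 0≤x xn≡1 w w-bounds π good))
                (Expansion.error expansion₀ truncation) ⟩
      Π * (fromℕ (pairCount l) * (K l π * x * (K l π * x))) + C₀ * ((1ℚ + K 1 π) * x * ((1ℚ + K 1 π) * x))
        ≤⟨ +-mono-≤ (*-monoˡ-≤ 0≤Π (*-monoˡ-≤ (0≤fromℕ (pairCount l)) (*-mono-≤ 0≤Kx 0≤Y Kx≤Y Kx≤Y)))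
                    (*-monoˡ-≤ 0≤C₀ (*-mono-≤ (0≤* (0≤+ 0≤1 (0≤K 1 π)) 0≤x) 0≤Y K₁≤Y K₁≤Y)) ⟩
      Π * (fromℕ (pairCount l) * (Y * Y)) + C₀ * (Y * Y)
        ≡⟨ ring₂ Π (fromℕ (pairCount l)) C₀ (Y * Y) ⟩
      C₁ * (Y * Y)
        ≤⟨ *-monoˡ-≤ 0≤C₁ (≤-by (x * x * ((1ℚ - K l π) * (1ℚ - K l π))) (0≤* (0≤* 0≤x 0≤x) (0≤² (1ℚ - K l π))) (ring₃ (K l π) x)) ⟩
      C₁ * ((1ℚ + 1ℚ) * (x * x) * (1ℚ + K l π * K l π)) ∎
      where
      open ≤-Reasoning
      b = barrier 1 π
      Y = (1ℚ + K l π) * x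
      ring₁ : ∀ a f g h → a * f - h ≡ a * (f - g) + (a * g - h)
      ring₁ = solve-∀ ℚ-ring
      ring₂ : ∀ a q c y → a * (q * y) + c * y ≡ (a * q + c) * y
      ring₂ = solve-∀ ℚ-ring
      ring₃ : ∀ k x → (1ℚ + k) * x * ((1ℚ + k) * x) + x * x * ((1ℚ - k) * (1ℚ - k)) ≡ (1ℚ + 1ℚ) * (x * x) * (1ℚ + k * k)
      ring₃ = solve-∀ ℚ-ring
      ring₄ : ∀ k x → k * x + x ≡ (1ℚ + k) * x
      ring₄ = solve-∀ ℚ-ring
      0≤Kx : 0ℚ ≤ K l π * x
      0≤Kx = 0≤* (0≤K l π) 0≤x
      Kx≤Y : K l π * x ≤ Y
      Kx≤Y = ≤-by x 0≤x (ring₄ (K l π) x)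
      0≤Y : 0ℚ ≤ Y
      0≤Y = ≤-trans 0≤Kx Kx≤Y
      K₁≤Y : (1ℚ + K 1 π) * x ≤ Y
      K₁≤Y = *-monoʳ-≤ 0≤x (+-monoʳ-≤ 1ℚ (fromℕ-mono-≤ (ℕ.∸-monoʳ-≤ n (barrier-antitone π 1≤l))))
      truncation : Truncation
      truncation = record { x = x ; L = b ; K = n ℕ.∸ b ; 0≤x = 0≤x ; x≤1 = x≤1 ; Lx+Kx≡1 = partition {n} 0≤x xn≡1 b (barrier-≤ 1 π) }
      w-bounds : ∀ j (v : Fin n) → 0ℚ ≤ w j (toℕ v) × w j (toℕ v) ≤ 1ℚ
      w-bounds j v = 0≤-^ (p j) 0≤vx , ^-≤1 (p j) 0≤vx (≤-trans (*-monoʳ-≤ 0≤x (fromℕ-mono-≤ (Fin.toℕ<n v)))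
                                                           (≤-reflexive (trans (*-comm (fromℕ n) x) xn≡1)))
        where 0≤vx = 0≤* (0≤fromℕ (suc (toℕ v))) 0≤x

    A N : ℚ
    A = ⟨ μ ⊗ M ⟩ (λ π → χ (good? n π))
    N = ⟨ μ ⊗ M ⟩ (λ π → χ (good? n π) * (Π * prefix π))

    A≡ : A ≡ x ^ M * #PF n M
    A≡ = ⊗-scale x 0≤x (∑ᶠ n) M (λ π → χ (good? n π))

    -- A, the probability that M uniform cars park, equals (1 + x)ᴹ(1 - M/(n + 1)), and M ≤ c(n +
    -- 1).
    1-c≤A : 1ℚ - c ≤ A
    1-c≤A = *-cancelˡ-≤ 0<y (begin
      y * (1ℚ - c)                               ≤⟨ ≤-by (c * y - fromℕ M) (≤⇒0≤- M≤cy) (ring₁ y c (fromℕ M)) ⟩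
      y - fromℕ M                                ≡⟨ *-identityˡ (y - fromℕ M) ⟨
      1ℚ * (y - fromℕ M)                         ≤⟨ *-monoʳ-≤ (<⇒≤ 0<y-M) (1≤-^ M (≤-trans (≤-by x 0≤x refl) (≤-reflexive (sym xy≡1+x)))) ⟩
      (x * y) ^ M * (y - fromℕ M)                ≡⟨ cong (_* (y - fromℕ M)) (^-distrib-* x y M) ⟩
      x ^ M * y ^ M * (y - fromℕ M)              ≡⟨ *-assoc (x ^ M) (y ^ M) (y - fromℕ M) ⟩
      x ^ M * (y ^ M * (y - fromℕ M))            ≡⟨ cong (x ^ M *_) (#PF-* n M (ℕ.m≤n⇒m≤1+n M≤n)) ⟨
      x ^ M * (#PF n M * y)                      ≡⟨ ring₂ (x ^ M) (#PF n M) y ⟩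
      y * (x ^ M * #PF n M)                      ≡⟨ cong (y *_) A≡ ⟨
      y * A                                      ∎)
      where
      open ≤-Reasoning
      ring₁ : ∀ y c m → y * (1ℚ - c) + (c * y - m) ≡ y - m
      ring₁ = solve-∀ ℚ-ring
      ring₂ : ∀ a b y → a * (b * y) ≡ y * (a * b)
      ring₂ = solve-∀ ℚ-ring
      M≤cy : fromℕ M ≤ c * y
      M≤cy = ≤-trans (fromℕ-mono-≤ (ℕ.m≤n+m M l)) (≤-trans (≤-reflexive m≡cn) (*-monoˡ-≤ 0≤c (fromℕ-mono-≤ (ℕ.n≤1+n n))))

    0<A : 0ℚ < A
    0<A = <-≤-trans 0<1-c 1-c≤A

    mean-gap : ⟨ μ ⊗ M ⟩ (λ π → χ (good? n π) * K 1 π) ≡ κ * A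
    mean-gap = *-cancelʳ-≡ 0<y-M (begin
      ⟨ μ ⊗ M ⟩ (λ π → χ (good? n π) * K 1 π) * (y - fromℕ M)   ≡⟨ cong (_* (y - fromℕ M)) (⊗-scale x 0≤x (∑ᶠ n) M (λ π → χ (good? n π) * K 1 π)) ⟩
      x ^ M * ∑PF n M (K 1) * (y - fromℕ M)                     ≡⟨ *-assoc (x ^ M) (∑PF n M (K 1)) (y - fromℕ M) ⟩
      x ^ M * (∑PF n M (K 1) * (y - fromℕ M))                   ≡⟨ cong (x ^ M *_) (∑PF-gap n M M≤n) ⟩
      x ^ M * (fromℕ M * #PF n M)                               ≡⟨ cong (λ k → x ^ M * (k * #PF n M)) κ[y-M]≡M ⟨
      x ^ M * (κ * (y - fromℕ M) * #PF n M)                     ≡⟨ ring (x ^ M) κ (y - fromℕ M) (#PF n M) ⟩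
      κ * (x ^ M * #PF n M) * (y - fromℕ M)                     ≡⟨ cong (λ a → κ * a * (y - fromℕ M)) A≡ ⟨
      κ * A * (y - fromℕ M)                                     ∎)
      where
      open ≡-Reasoning
      ring : ∀ a k d b → a * (k * d * b) ≡ k * (a * b) * d
      ring = solve-∀ ℚ-ring

    mean-first-order : ⟨ μ ⊗ M ⟩ (λ π → χ (good? n π) * first-order π) ≡ A * (1ℚ + Q * (½ * x - κ * x))
    mean-first-order = begin
      ⟨ μ ⊗ M ⟩ (λ π → χ (good? n π) * first-order π)
        ≡⟨ ⟨⟩-cong (μ ⊗ M) (λ π → ring₁ (χ (good? n π)) Q x (K 1 π)) ⟩
      ⟨ μ ⊗ M ⟩ (λ π → (1ℚ + Q * (½ * x)) * χ (good? n π) - Q * x * (χ (good? n π) * K 1 π))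
        ≡⟨ trans (⟨⟩-- (μ ⊗ M) _ _) (cong₂ _-_ (⟨⟩-* (μ ⊗ M) (1ℚ + Q * (½ * x)) _)
             (trans (⟨⟩-* (μ ⊗ M) (Q * x) _) (cong (Q * x *_) mean-gap))) ⟩
      (1ℚ + Q * (½ * x)) * A - Q * x * (κ * A)
        ≡⟨ ring₂ Q x κ A ⟩
      A * (1ℚ + Q * (½ * x - κ * x)) ∎
      where
      open ≡-Reasoning
      ring₁ : ∀ g q x k → g * (1ℚ + q * (½ * x - k * x)) ≡ (1ℚ + q * (½ * x)) * g - q * x * (g * k)
      ring₁ = solve-∀ ℚ-ring
      ring₂ : ∀ q x k a → (1ℚ + q * (½ * x)) * a - q * x * (k * a) ≡ a * (1ℚ + q * (½ * x - k * x))
      ring₂ = solve-∀ ℚ-ring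

    -- The pointwise bound is integrated over parking functions, except that K² is integrated over
    -- all sequences, where `second-moment` applies. Since ωA ≥ 1, the bound T turns into a multiple
    -- of A.
    ∣N-A∣≤ : ∣ N - A * (1ℚ + Q * (½ * x - κ * x)) ∣ ≤ C₂ * (x * x) * A
    ∣N-A∣≤ = begin
      ∣ N - A * (1ℚ + Q * (½ * x - κ * x)) ∣
        ≡⟨ cong ∣_∣ (trans (cong (λ a → N - a) (sym mean-first-order)) (sym (⟨⟩-- (μ ⊗ M) _ _))) ⟩
      ∣ ⟨ μ ⊗ M ⟩ (λ π → χ (good? n π) * (Π * prefix π) - χ (good? n π) * first-order π) ∣
        ≤⟨ ∣⟨⟩∣≤ (μ ⊗ M) (λ π → pointwise π (good? n π)) ⟩
      ⟨ μ ⊗ M ⟩ (λ π → z * (χ (good? n π) + K l π * K l π))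
        ≡⟨ trans (⟨⟩-* (μ ⊗ M) z _) (cong (z *_) (⟨⟩-+ (μ ⊗ M) _ _)) ⟩
      z * (A + ⟨ μ ⊗ M ⟩ (λ π → K l π * K l π))
        ≤⟨ *-monoˡ-≤ 0≤z (+-monoʳ-≤ A second-moment′) ⟩
      z * (A + T)
        ≤⟨ *-monoˡ-≤ 0≤z (+-monoʳ-≤ A T≤TωA) ⟩
      z * (A + T * (ω * A))
        ≡⟨ ring C₁ x A T ω ⟩
      C₂ * (x * x) * A ∎
      where
      open ≤-Reasoning
      z = C₁ * ((1ℚ + 1ℚ) * (x * x))
      0≤z = 0≤* 0≤C₁ (0≤* (0≤fromℕ 2) (0≤* 0≤x 0≤x))
      ring : ∀ c x a t w → c * ((1ℚ + 1ℚ) * (x * x)) * (a + t * (w * a)) ≡ c * ((1ℚ + 1ℚ) * (1ℚ + t * w)) * (x * x) * a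
      ring = solve-∀ ℚ-ring
      second-moment′ : ⟨ μ ⊗ M ⟩ (λ π → K l π * K l π) ≤ T
      second-moment′ = second-moment {n} 0≤x x≤1 xn≡1 M Mx≤c l
      T≤TωA : T ≤ T * (ω * A)
      T≤TωA = ≤-trans (≤-reflexive (trans (sym (*-identityʳ T)) (cong (T *_) (trans (sym [1-c]ω≡1) (*-comm (1ℚ - c) ω)))))
        (*-monoˡ-≤ 0≤T (*-monoˡ-≤ 0≤ω 1-c≤A))
      ring₁ : ∀ a b → a - b ≡ 1ℚ * a - 1ℚ * b
      ring₁ = solve-∀ ℚ-ring
      ring₂ : ∀ a b → 0ℚ ≡ 0ℚ * a - 0ℚ * b
      ring₂ = solve-∀ ℚ-ring
      pointwise : ∀ π (d : Dec (Good n π)) → ∣ χ d * (Π * prefix π) - χ d * first-order π ∣ ≤ z * (χ d + K l π * K l π)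
      pointwise π (yes good) = subst₂ _≤_ (cong ∣_∣ (ring₁ (Π * prefix π) (first-order π)))
        (sym (*-assoc C₁ ((1ℚ + 1ℚ) * (x * x)) (1ℚ + K l π * K l π))) (∣Πprefix-first-order∣≤ π good)
      pointwise π (no _) = subst (λ a → ∣ a ∣ ≤ z * (0ℚ + K l π * K l π)) (ring₂ (Π * prefix π) (first-order π))
        (0≤* 0≤z (0≤+ ≤-refl (0≤* (0≤K l π) (0≤K l π))))

    -- f is the mean of Π times `prefix` over parking sequences of M cars. g is
    -- nˡ|PF(M,n)|/|PF(m,n)|, which converts this into a mean over PF(m,n).
    f g : ℚ
    f = N * proj₁ (inverse A 0<A)
    g = (1ℚ + ℓ * s) * u ^ l

    A⁻¹ = proj₁ (inverse A 0<A)
    0≤A⁻¹ : 0ℚ ≤ A⁻¹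
    0≤A⁻¹ = proj₁ (proj₂ (inverse A 0<A))
    AA⁻¹≡1 : A * A⁻¹ ≡ 1ℚ
    AA⁻¹≡1 = proj₂ (proj₂ (inverse A 0<A))

    fA≡N : f * A ≡ N
    fA≡N = trans (ring N A⁻¹ A) (trans (cong (N *_) AA⁻¹≡1) (*-identityʳ N))
      where
      ring : ∀ n v a → n * v * a ≡ n * (a * v)
      ring = solve-∀ ℚ-ring

    ∣f-1∣≤ : ∣ f - (1ℚ + Q * (½ * x - κ * x)) ∣ ≤ C₂ * (x * x)
    ∣f-1∣≤ = begin
      ∣ f - h ∣                          ≡⟨ cong (λ a → ∣ f - a ∣) (trans (sym (*-identityʳ h)) (cong (h *_) (sym AA⁻¹≡1))) ⟩
      ∣ N * A⁻¹ - h * (A * A⁻¹) ∣        ≡⟨ cong ∣_∣ (ring₁ N A⁻¹ h A) ⟩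
      ∣ (N - A * h) * A⁻¹ ∣              ≤⟨ ∣*∣≤ ∣N-A∣≤ (0≤⇒∣∣≤ 0≤A⁻¹ ≤-refl) ⟩
      C₂ * (x * x) * A * A⁻¹             ≡⟨ trans (*-assoc (C₂ * (x * x)) A A⁻¹) (trans (cong (C₂ * (x * x) *_) AA⁻¹≡1) (*-identityʳ (C₂ * (x * x)))) ⟩
      C₂ * (x * x)                       ∎
      where
      open ≤-Reasoning
      h = 1ℚ + Q * (½ * x - κ * x)
      ring₁ : ∀ n v h a → n * v - h * (a * v) ≡ (n - a * h) * v
      ring₁ = solve-∀ ℚ-ring

    -- The counts give (n + 1 - M)/(n + 1 - m) = 1 + ℓs, and the l surplus powers of n + 1 against
    -- those of n give uˡ.
    #PF-ratio : #PF n M ≡ g * (x ^ l * #PF n m)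
    #PF-ratio = *-cancelʳ-≡ 0<y (begin
      #PF n M * y                                                   ≡⟨ #PF-* n M (ℕ.m≤n⇒m≤1+n M≤n) ⟩
      y ^ M * (y - fromℕ M)                                         ≡⟨ cong (y ^ M *_) (trans y-M (trans (ring₁ (y - fromℕ m) ℓ) (cong (λ a → y - fromℕ m + ℓ * a) (sym [y-m]s≡1)))) ⟩
      y ^ M * (y - fromℕ m + ℓ * ((y - fromℕ m) * s))              ≡⟨ ring₂ (y ^ M) (y - fromℕ m) ℓ s ⟩
      (1ℚ + ℓ * s) * 1ℚ * y ^ M * (y - fromℕ m)                    ≡⟨ cong (λ a → (1ℚ + ℓ * s) * a * y ^ M * (y - fromℕ m)) u^l ⟨
      (1ℚ + ℓ * s) * (u ^ l * (x ^ l * y ^ l)) * y ^ M * (y - fromℕ m) ≡⟨ ring₃ (1ℚ + ℓ * s) (u ^ l) (x ^ l) (y ^ l) (y ^ M) (y - fromℕ m) ⟩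
      g * (x ^ l * (y ^ l * y ^ M * (y - fromℕ m)))                 ≡⟨ cong (λ a → g * (x ^ l * (a * (y - fromℕ m)))) (^-homo-* y l M) ⟨
      g * (x ^ l * (y ^ m * (y - fromℕ m)))                         ≡⟨ cong (λ a → g * (x ^ l * a)) (#PF-* n m (ℕ.m≤n⇒m≤1+n m≤n)) ⟨
      g * (x ^ l * (#PF n m * y))                                   ≡⟨ ring₄ g (x ^ l) (#PF n m) y ⟩
      g * (x ^ l * #PF n m) * y                                     ∎)
      where
      open ≡-Reasoning
      ring₁ : ∀ d l → d + l ≡ d + l * 1ℚ
      ring₁ = solve-∀ ℚ-ring
      ring₂ : ∀ a d l s → a * (d + l * (d * s)) ≡ (1ℚ + l * s) * 1ℚ * a * d
      ring₂ = solve-∀ ℚ-ring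
      ring₃ : ∀ t u x y y′ d → t * (u * (x * y)) * y′ * d ≡ t * u * (x * (y * y′ * d))
      ring₃ = solve-∀ ℚ-ring
      ring₄ : ∀ g x a y → g * (x * (a * y)) ≡ g * (x * a) * y
      ring₄ = solve-∀ ℚ-ring
      u^l : u ^ l * (x ^ l * y ^ l) ≡ 1ℚ
      u^l = begin
        u ^ l * (x ^ l * y ^ l)      ≡⟨ cong (u ^ l *_) (^-distrib-* x y l) ⟨
        u ^ l * (x * y) ^ l          ≡⟨ ^-distrib-* u (x * y) l ⟨
        (u * (x * y)) ^ l            ≡⟨ cong (λ a → (u * a) ^ l) xy≡1+x ⟩
        (u * (1ℚ + x)) ^ l           ≡⟨ cong (_^ l) (trans (*-comm u (1ℚ + x)) [1+x]u≡1) ⟩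
        1ℚ ^ l                       ≡⟨ 1^k≡1 l ⟩
        1ℚ                           ∎

    module _ (l≤m : l ℕ.≤ m) where

      X : Vec (Fin n) m → ℚ
      X π = fromℕ (monomial p l≤m π)

      x^P*X : ∀ (a : Vec (Fin n) l) (π : Vec (Fin n) M) → ∏ℚ (λ j → w j (toℕ (lookup a j))) ≡ x ^ P * X (a ++ π)
      x^P*X a π = begin
        ∏ℚ (λ j → (fromℕ (spot (lookup a j)) * x) ^ p j)
          ≡⟨ ∏-cong (λ j → ^-distrib-* (fromℕ (spot (lookup a j))) x (p j)) ⟩
        ∏ℚ (λ j → fromℕ (spot (lookup a j)) ^ p j * x ^ p j)
          ≡⟨ ∏-distrib-* (λ j → fromℕ (spot (lookup a j)) ^ p j) (λ j → x ^ p j) ⟩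
        ∏ℚ (λ j → fromℕ (spot (lookup a j)) ^ p j) * ∏ℚ (λ j → x ^ p j)
          ≡⟨ cong₂ _*_ (∏-cong (λ j → trans (cong (λ v → fromℕ (spot v) ^ p j) (sym (lookup-++-inject≤ a π l≤m j)))
               (sym (fromℕ-^ (spot (lookup (a ++ π) (inject≤ j l≤m))) (p j))))) (∏-^ x p) ⟩
        ∏ℚ (λ j → fromℕ (spot (lookup (a ++ π) (inject≤ j l≤m)) ℕ.^ p j)) * x ^ P
          ≡⟨ cong (_* x ^ P) (fromℕ-∏ (λ j → spot (lookup (a ++ π) (inject≤ j l≤m)) ℕ.^ p j)) ⟨
        X (a ++ π) * x ^ P
          ≡⟨ *-comm (X (a ++ π)) (x ^ P) ⟩
        x ^ P * X (a ++ π) ∎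
        where open ≡-Reasoning

      -- The sums over prefix and remaining cars are merged. A remainder that does not park
      -- contributes 0 on both sides, as no prefix can repair it.
      N≡ : N ≡ x ^ M * (Π * (x ^ l * x ^ P) * ∑PF n m X)
      N≡ = begin
        N
          ≡⟨ ⊗-scale x 0≤x (∑ᶠ n) M (λ π → χ (good? n π) * (Π * prefix π)) ⟩
        x ^ M * ⟨ ∑ᶠ n ⊗ M ⟩ (λ π → χ (good? n π) * (Π * prefix π))
          ≡⟨ cong (x ^ M *_) (⟨⟩-cong (∑ᶠ n ⊗ M) pointwise) ⟩
        x ^ M * ⟨ ∑ᶠ n ⊗ M ⟩ (λ π → Π * (x ^ l * x ^ P) * ⟨ ∑ᶠ n ⊗ l ⟩ (λ a → χ (good? n (a ++ π)) * X (a ++ π)))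
          ≡⟨ cong (x ^ M *_) (⟨⟩-* (∑ᶠ n ⊗ M) (Π * (x ^ l * x ^ P)) _) ⟩
        x ^ M * (Π * (x ^ l * x ^ P) * ⟨ ∑ᶠ n ⊗ M ⟩ (λ π → ⟨ ∑ᶠ n ⊗ l ⟩ (λ a → χ (good? n (a ++ π)) * X (a ++ π))))
          ≡⟨ cong (λ t → x ^ M * (Π * (x ^ l * x ^ P) * t)) (trans
               (sym (⟨⟩-⊗-comm (∑ᶠ n ⊗ l) n M (λ a π → χ (good? n (a ++ π)) * X (a ++ π))))
               (sym (⊗-++ (∑ᶠ n) l M (λ π → χ (good? n π) * X π)))) ⟩
        x ^ M * (Π * (x ^ l * x ^ P) * ∑PF n m X) ∎
        where
        open ≡-Reasoning
        ring₁ : ∀ a b e g → a * (b * (e * g)) ≡ a * (b * e) * g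
        ring₁ = solve-∀ ℚ-ring
        ring₂ : ∀ e v g → e * v * g ≡ e * (g * v)
        ring₂ = solve-∀ ℚ-ring
        ring₃ : ∀ v → 1ℚ * v ≡ v
        ring₃ = solve-∀ ℚ-ring
        Πprefix : ∀ π → Π * prefix π ≡ Π * (x ^ l * x ^ P) * ⟨ ∑ᶠ n ⊗ l ⟩ (λ a → χ (good? n (a ++ π)) * X (a ++ π))
        Πprefix π = trans (cong (Π *_) (trans (⊗-scale x 0≤x (∑ᶠ n) l _)
            (cong (x ^ l *_) (trans
              (⟨⟩-cong (∑ᶠ n ⊗ l) (λ a → trans (cong (_* χ (good? n (a ++ π))) (x^P*X a π)) (ring₂ (x ^ P) (X (a ++ π)) (χ (good? n (a ++ π))))))
              (⟨⟩-* (∑ᶠ n ⊗ l) (x ^ P) _)))))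
          (ring₁ Π (x ^ l) (x ^ P) _)
        pointwise : ∀ π → χ (good? n π) * (Π * prefix π)
          ≡ Π * (x ^ l * x ^ P) * ⟨ ∑ᶠ n ⊗ l ⟩ (λ a → χ (good? n (a ++ π)) * X (a ++ π))
        pointwise π with good? n π
        ... | yes _    = trans (ring₃ (Π * prefix π)) (Πprefix π)
        ... | no ¬good = trans (*-zeroˡ (Π * prefix π)) (sym (trans
          (cong (Π * (x ^ l * x ^ P) *_) (trans
            (⟨⟩-cong (∑ᶠ n ⊗ l) (λ a → trans (cong (_* X (a ++ π)) (χ-no (good? n (a ++ π)) (¬good ∘ good-++⇒good a π))) (*-zeroˡ (X (a ++ π)))))
            (⟨⟩-0 (∑ᶠ n ⊗ l))))
          (*-zeroʳ (Π * (x ^ l * x ^ P)))))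

      -- Exact, before any estimate. Π xᴾ is the reciprocal of the leading term nᴾ/∏(pⱼ + 1).
      𝔼-fg : 𝔼 m n X * (Π * x ^ P) ≡ f * g
      𝔼-fg = *-cancelʳ-≡ (0<-* (0<-* (0<-^ M 0<x) (0<-^ l 0<x)) (#PF-pos n m m≤n)) (begin
        𝔼 m n X * (Π * x ^ P) * (x ^ M * x ^ l * #PF n m)    ≡⟨ ring₁ (𝔼 m n X) Π (x ^ P) (x ^ M) (x ^ l) (#PF n m) ⟩
        x ^ M * (Π * (x ^ l * x ^ P) * (𝔼 m n X * #PF n m))  ≡⟨ cong (λ a → x ^ M * (Π * (x ^ l * x ^ P) * a)) (𝔼-* m n X) ⟩
        x ^ M * (Π * (x ^ l * x ^ P) * ∑PF n m X)            ≡⟨ N≡ ⟨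
        N                                                    ≡⟨ fA≡N ⟨
        f * A                                                ≡⟨ cong (f *_) (trans A≡ (cong (x ^ M *_) #PF-ratio)) ⟩
        f * (x ^ M * (g * (x ^ l * #PF n m)))                ≡⟨ ring₂ f (x ^ M) g (x ^ l) (#PF n m) ⟩
        f * g * (x ^ M * x ^ l * #PF n m)                    ∎)
        where
        open ≡-Reasoning
        ring₁ : ∀ e a q b c d → e * (a * q) * (b * c * d) ≡ b * (a * (c * q) * (e * d))
        ring₁ = solve-∀ ℚ-ring
        ring₂ : ∀ f a g b d → f * (a * (g * (b * d))) ≡ f * g * (a * b * d)
        ring₂ = solve-∀ ℚ-ring

-- The expansion in powers of 1/n

module FinalExpansion {l : ℕ} (1≤l : 1 ℕ.≤ l) (p : Fin l → ℕ) (1≤p : ∀ i → 1 ℕ.≤ p i)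
                      (c : ℚ) (0<c : 0ℚ < c) (c<1 : c < 1ℚ) where

  open Asymptotics 1≤l p 1≤p c 0<c c<1
  open Street using (x)
  open Scaled

  -- κ is replaced by its limit cω, at the cost of another term of order x².
  expansion-f : Expansion x f (λ i → x i * (Q * (½ - c * ω)))
  expansion-f = record
    { B = ∣ Q * (½ - c * ω) ∣ ; C = C₂ + Q * Cκ ; 0≤B = 0≤∣p∣ (Q * (½ - c * ω))
    ; 0≤C = 0≤+ 0≤C₂ (0≤* 0≤Q (0≤* 0≤ω (0≤+ (0≤fromℕ l) (0≤* (0≤* 0≤c 0≤ω) (0≤+ 0≤1 (0≤fromℕ l))))))
    ; linear = λ i → ≤-trans (∣*∣≤ {x i} {Q * (½ - c * ω)} (0≤⇒∣∣≤ (0≤x i) ≤-refl) ≤-refl)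
                       (≤-reflexive (*-comm (x i) ∣ Q * (½ - c * ω) ∣))
    ; error = λ i → subst₂ _≤_
        (cong ∣_∣ (ring₁ (f i) Q (x i) (κ i) (c * ω)))
        (ring₂ C₂ Q Cκ (x i))
        (∣+∣≤ (∣f-1∣≤ i) (0≤⇒∣∣≤ (0≤* (0≤* 0≤Q (0≤x i)) (0≤cω-κ i)) (*-monoˡ-≤ (0≤* 0≤Q (0≤x i)) (cω-κ≤ i)))) }
    where
    Cκ = ω * (ℓ + c * ω * (1ℚ + ℓ))
    ring₁ : ∀ f q x k d → f - (1ℚ + q * (½ * x - k * x)) + q * x * (d - k) ≡ f - (1ℚ + x * (q * (½ - d)))
    ring₁ = solve-∀ ℚ-ring
    ring₂ : ∀ c q k x → c * (x * x) + q * x * (x * k) ≡ (c + q * k) * (x * x)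
    ring₂ = solve-∀ ℚ-ring

  expansion-s : Expansion x (λ i → 1ℚ + ℓ * s i) (λ i → ℓ * ω * x i)
  expansion-s = record
    { B = ℓ * ω ; C = ℓ * (ω * ω) ; 0≤B = 0≤λω ; 0≤C = 0≤* (0≤fromℕ l) (0≤* 0≤ω 0≤ω)
    ; linear = λ i → 0≤⇒∣∣≤ (0≤* 0≤λω (0≤x i)) ≤-refl
    ; error  = λ i → subst (λ a → ∣ a ∣ ≤ ℓ * (ω * ω) * (x i * x i))
        (trans (cong (λ a → - (ℓ * a)) (sym (ωx-s i))) (ring₁ ℓ ω (x i) (s i)))
        (∣-∣≤ (ℓ * (ω * (s i * x i))) (0≤⇒∣∣≤ (0≤* (0≤fromℕ l) (0≤* 0≤ω (0≤* (0≤s i) (0≤x i))))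
          (≤-trans (*-monoˡ-≤ (0≤fromℕ l) (*-monoˡ-≤ 0≤ω (*-monoʳ-≤ (0≤x i) (s≤ωx i)))) (≤-reflexive (ring₂ ℓ ω (x i)))))) }
    where
    0≤λω = 0≤* (0≤fromℕ l) 0≤ω
    ring₁ : ∀ l w x s → - (l * (w * x - s)) ≡ 1ℚ + l * s - (1ℚ + l * w * x)
    ring₁ = solve-∀ ℚ-ring
    ring₂ : ∀ l w x → l * (w * (w * x * x)) ≡ l * (w * w) * (x * x)
    ring₂ = solve-∀ ℚ-ring

  -- The remainder is exactly ux², and u ≤ 1.
  expansion-u : Expansion x u (λ i → - x i)
  expansion-u = record
    { B = 1ℚ ; C = 1ℚ ; 0≤B = 0≤1 ; 0≤C = 0≤1
    ; linear = λ i → ∣-∣≤ (x i) (0≤⇒∣∣≤ (0≤x i) (≤-reflexive (sym (*-identityˡ (x i)))))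
    ; error  = λ i → subst (λ a → ∣ a ∣ ≤ 1ℚ * (x i * x i)) (u-1+x i)
        (0≤⇒∣∣≤ (0≤* (0≤u i) (0≤* (0≤x i) (0≤x i))) (*-monoʳ-≤ (0≤* (0≤x i) (0≤x i)) (u≤1 i))) }
    where
    ring₀ : ∀ u x → u + x * u ≡ (1ℚ + x) * u
    ring₀ = solve-∀ ℚ-ring
    ring₁ : ∀ u x → u * (x * x) ≡ u - ((1ℚ + x) * u + - (x * ((1ℚ + x) * u)))
    ring₁ = solve-∀ ℚ-ring
    u≤1 : ∀ i → u i ≤ 1ℚ
    u≤1 i = ≤-by (x i * u i) (0≤* (0≤x i) (0≤u i)) (trans (ring₀ (u i) (x i)) ([1+x]u≡1 i))
    u-1+x : ∀ i → u i * (x i * x i) ≡ u i - (1ℚ + - x i)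
    u-1+x i = trans (ring₁ (u i) (x i)) (trans (cong (λ a → u i - (a + - (x i * a))) ([1+x]u≡1 i))
      (cong (λ a → u i - (1ℚ + - a)) (*-identityʳ (x i))))

  coefficient : ℚ
  coefficient = ½ * (fromℕ P + ℓ) - c * fromℕ P * ω

  -- f contributes (P + l)(½ - cω) and g contributes lω - l = lcω, by (1 - c)ω = 1. The terms lcω
  -- cancel, so that l survives only in the half (P + l)/2.
  expansion-fg : Expansion x (λ i → f i * g i) (λ i → x i * coefficient)
  expansion-fg = expansion-cong (λ _ → refl) coefficients
    (expansion-* 0≤x x≤2 expansion-f (expansion-* 0≤x x≤2 expansion-s (expansion-^ 0≤x x≤2 l expansion-u)))
    where
    x≤2 : ∀ i → x i ≤ 1ℚ + 1ℚ
    x≤2 i = ≤-trans (Street.x≤1 i) (≤-by 1ℚ 0≤1 refl)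
    ring₁ : ∀ x p l c w → x * ((p + l) * (½ - c * w)) + (l * w * x + l * - (x * ((1ℚ - c) * w)))
      ≡ x * (½ * (p + l) - c * p * w)
    ring₁ = solve-∀ ℚ-ring
    coefficients : ∀ i → x i * (Q * (½ - c * ω)) + (ℓ * ω * x i + ℓ * - x i) ≡ x i * coefficient
    coefficients i = trans
      (cong₂ (λ q a → x i * (q * (½ - c * ω)) + (ℓ * ω * x i + ℓ * - a)) (∑-fromℕ-suc p)
        (trans (sym (*-identityʳ (x i))) (cong (x i *_) (sym [1-c]ω≡1))))
      (ring₁ (x i) (fromℕ P) ℓ c ω)

-- The denominator of c serves as d, for then the product is the numerator, a positive integer.
1≤multiple : ∀ c → 0ℚ < c → ∃[ d ] 1ℚ ≤ c * fromℕ d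
1≤multiple c@(mkℚ (+ 0) _ _)      0<c with () ← positive 0<c
1≤multiple c@(mkℚ -[1+ _ ] _ _)   0<c with () ← positive 0<c
1≤multiple c@(mkℚ +[1+ k ] d-1 _) 0<c = suc d-1 , ≤-trans (fromℕ-mono-≤ {1} {suc k} (s≤s z≤n))
  (≤-reflexive (sym (trans (cong (_* fromℕ (suc d-1)) (sym (↥p/↧p≡p c))) (/-*-cancel (suc k) (suc d-1)))))

theorem3p3 : (l : ℕ) → 1 ℕ.≤ l →
    (p : Fin l → ℕ) → (∀ i → 1 ℕ.≤ p i) →
    (c : ℚ) → 0ℚ < c → (c<1 : c < 1ℚ) →
    let P = ∑[ i < l ] p i in
    ∃[ C ] ∃[ N ] ((n : ℕ) .{{_ : ℕ.NonZero n}} → N ℕ.≤ n →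
    (m : ℕ) → fromℕ m ≡ c * fromℕ n →
    Σ[ l≤m ∈ l ℕ.≤ m ] Σ[ r ∈ ℚ ]
    (∣ r ∣ ≤ C * (+ 1 / n) * (+ 1 / n)) ×
    (𝔼 m n (λ π → fromℕ (monomial p l≤m π))
    ≡ (_/_ (+ (n ℕ.^ P)) (∏[ i < l ] suc (p i)) {{∏suc-nonZero p}})
    * (1ℚ
    + (+ 1 / n)
    * ((+ (P ℕ.+ l) / 2)
    - _÷_ (c * fromℕ P) (1ℚ - c) {{1-c-nonZero c<1}})
    + r)))
theorem3p3 l 1≤l p 1≤p c 0<c c<1 = C , l ℕ.* d , λ n ld≤n m m≡cn →
    l≤m n ld≤n m m≡cn , expectation n m m≡cn (l≤m n ld≤n m m≡cn) (sym (ℕ.m+[n∸m]≡n (l≤m n ld≤n m m≡cn)))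
  where
  open FinalExpansion 1≤l p 1≤p c 0<c c<1
  open Asymptotics 1≤l p 1≤p c 0<c c<1
  open Expansion expansion-fg using (C; error)
  -- As cd ≥ 1, the threshold n ≥ ld forces m = cn ≥ l, so the l cars of the monomial exist.
  d : ℕ
  d = proj₁ (1≤multiple c 0<c)

  coefficient≡ : coefficient ≡ (+ (P ℕ.+ l) / 2) - _÷_ (c * fromℕ P) (1ℚ - c) {{1-c-nonZero c<1}}
  coefficient≡ = cong (_- c * fromℕ P * ω) (begin
    ½ * (fromℕ P + fromℕ l)            ≡⟨ cong (½ *_) (fromℕ-+ P l) ⟨
    ½ * fromℕ (P ℕ.+ l)                ≡⟨ cong (½ *_) (/-*-cancel (P ℕ.+ l) 2) ⟨
    ½ * ((+ (P ℕ.+ l) / 2) * fromℕ 2)  ≡⟨ ring (+ (P ℕ.+ l) / 2) ⟩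
    + (P ℕ.+ l) / 2                    ∎)
    where
    open ≡-Reasoning
    ring : ∀ a → ½ * (a * fromℕ 2) ≡ a
    ring = solve-∀ ℚ-ring

  l≤m : ∀ n → l ℕ.* d ℕ.≤ n → ∀ m → fromℕ m ≡ c * fromℕ n → l ℕ.≤ m
  l≤m n ld≤n m m≡cn = fromℕ-cancel-≤ (begin
    fromℕ l                       ≡⟨ *-identityʳ (fromℕ l) ⟨
    fromℕ l * 1ℚ                  ≤⟨ *-monoˡ-≤ (0≤fromℕ l) (proj₂ (1≤multiple c 0<c)) ⟩
    fromℕ l * (c * fromℕ d)       ≡⟨ ring (fromℕ l) c (fromℕ d) ⟩
    c * (fromℕ l * fromℕ d)       ≡⟨ cong (c *_) (fromℕ-* l d) ⟨
    c * fromℕ (l ℕ.* d)           ≤⟨ *-monoˡ-≤ (<⇒≤ 0<c) (fromℕ-mono-≤ ld≤n) ⟩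
    c * fromℕ n                   ≡⟨ m≡cn ⟨
    fromℕ m                       ∎)
    where
    open ≤-Reasoning
    ring : ∀ l c d → l * (c * d) ≡ c * (l * d)
    ring = solve-∀ ℚ-ring

  module _ (n : ℕ) .{{_ : ℕ.NonZero n}} where

    0≤1/n : 0ℚ ≤ + 1 / n
    0≤1/n = nonNegative⁻¹ (+ 1 / n) {{normalize-nonNeg 1 n}}

    1/n≤1 : + 1 / n ≤ 1ℚ
    1/n≤1 = ≤-trans (≤-reflexive (sym (*-identityʳ (+ 1 / n))))
      (≤-trans (*-monoˡ-≤ 0≤1/n (fromℕ-mono-≤ {1} {n} (ℕ.>-nonZero⁻¹ n))) (≤-reflexive (/-*-cancel 1 n)))

    leading-* : (_/_ (+ (n ℕ.^ P)) (∏[ i < l ] suc (p i)) {{∏suc-nonZero p}}) * (Π * (+ 1 / n) ^ P) ≡ 1ℚ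
    leading-* = begin
      a * (Π * (+ 1 / n) ^ P)                              ≡⟨ *-assoc a Π ((+ 1 / n) ^ P) ⟨
      a * Π * (+ 1 / n) ^ P                                ≡⟨ cong (λ b → a * b * (+ 1 / n) ^ P) (fromℕ-∏ (λ j → suc (p j))) ⟨
      a * fromℕ (∏[ i < l ] suc (p i)) * (+ 1 / n) ^ P     ≡⟨ cong (_* (+ 1 / n) ^ P) (/-*-cancel (n ℕ.^ P) (∏[ i < l ] suc (p i)) {{∏suc-nonZero p}}) ⟩
      fromℕ (n ℕ.^ P) * (+ 1 / n) ^ P                      ≡⟨ cong (_* (+ 1 / n) ^ P) (fromℕ-^ n P) ⟩
      fromℕ n ^ P * (+ 1 / n) ^ P                          ≡⟨ ^-distrib-* (fromℕ n) (+ 1 / n) P ⟨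
      (fromℕ n * (+ 1 / n)) ^ P                            ≡⟨ cong (_^ P) (trans (*-comm (fromℕ n) (+ 1 / n)) (/-*-cancel 1 n)) ⟩
      1ℚ ^ P                                               ≡⟨ 1^k≡1 P ⟩
      1ℚ                                                   ∎
      where
      open ≡-Reasoning
      a = _/_ (+ (n ℕ.^ P)) (∏[ i < l ] suc (p i)) {{∏suc-nonZero p}}

    expansion-𝔼 : ∀ {a e} → a * (Π * (+ 1 / n) ^ P) ≡ 1ℚ → coefficient ≡ e →
      ∀ M → fromℕ (l ℕ.+ M) ≡ c * fromℕ n → (l≤m : l ℕ.≤ l ℕ.+ M) →
      Σ[ r ∈ ℚ ] (∣ r ∣ ≤ C * (+ 1 / n) * (+ 1 / n)) ×
        (𝔼 (l ℕ.+ M) n (λ π → fromℕ (monomial p l≤m π)) ≡ a * (1ℚ + (+ 1 / n) * e + r))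
    expansion-𝔼 {a} {e} a-* refl M m≡cn l≤m =
      -- The remainder is what the exact product fg leaves after its first-order part, already
      -- relative to the leading factor.
      f * g - (1ℚ + x * e) , ≤-trans (error street) (≤-reflexive (sym (*-assoc C x x))) , (begin
      E                                                    ≡⟨ *-identityʳ E ⟨
      E * 1ℚ                                               ≡⟨ cong (E *_) a-* ⟨
      E * (a * (Π * x ^ P))                                ≡⟨ ring₁ E a (Π * x ^ P) ⟩
      a * (E * (Π * x ^ P))                                ≡⟨ cong (a *_) (𝔼-fg l≤m) ⟩
      a * (f * g)                                          ≡⟨ cong (a *_) (ring₂ (f * g) (1ℚ + x * e)) ⟩
      a * (1ℚ + x * e + (f * g - (1ℚ + x * e)))            ∎)
      where
      open ≡-Reasoning
      x E : ℚ
      x = + 1 / n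
      E = 𝔼 (l ℕ.+ M) n (λ π → fromℕ (monomial p l≤m π))
      street : Street
      street = record
        { n = n ; M = M ; x = x ; 0<x = positive⁻¹ x {{normalize-pos 1 n}} ; x≤1 = 1/n≤1
        ; xn≡1 = /-*-cancel 1 n ; m≡cn = m≡cn }
      open Scaled street using (f; g; 𝔼-fg)
      ring₁ : ∀ e a b → e * (a * b) ≡ a * (e * b)
      ring₁ = solve-∀ ℚ-ring
      ring₂ : ∀ a b → a ≡ b + (a - b)
      ring₂ = solve-∀ ℚ-ring

    expectation : ∀ m → fromℕ m ≡ c * fromℕ n → (l≤m : l ℕ.≤ m) → ∀ {M} → m ≡ l ℕ.+ M →
      Σ[ r ∈ ℚ ] (∣ r ∣ ≤ C * (+ 1 / n) * (+ 1 / n)) ×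
      (𝔼 m n (λ π → fromℕ (monomial p l≤m π))
        ≡ (_/_ (+ (n ℕ.^ P)) (∏[ i < l ] suc (p i)) {{∏suc-nonZero p}})
          * (1ℚ + (+ 1 / n) * ((+ (P ℕ.+ l) / 2) - _÷_ (c * fromℕ P) (1ℚ - c) {{1-c-nonZero c<1}}) + r))
    expectation m m≡cn l≤m {M} refl =
      expansion-𝔼 {_/_ (+ (n ℕ.^ P)) (∏[ i < l ] suc (p i)) {{∏suc-nonZero p}}} leading-* coefficient≡ M m≡cn l≤m
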